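{- Let $V$ be a partial Steiner triple system. Then there is an integer $N'_V$ such that for every integer $u \geq N'_V$ with $u \equiv 1$ or $3 \pmod 6$ there is a Steiner triple system $U$ on $u$ points such that: $V$ is a subsystem of $U$; $V$ is invariant under every automorphism of $U$; the group of permutations of $V$ induced by $\mathrm{Aut}\,U$ is exactly $\mathrm{Aut}\,V$; and $\mathrm{Aut}\,U \cong \mathrm{Aut}\,V$.
   Context: A partial Steiner triple system (PSTS) is a finite set of points together with a collection of 3-element subsets (triples) such that any two distinct points lie in at most one triple. A Steiner triple system (STS) is a PSTS in which any two distinct points lie in exactly one triple. A PSTS $V$ is a subsystem of an STS $U$ if the points of $V$ are points of $U$ and the triples of $V$ are precisely the triples of $U$ contained in the point set of $V$. $\mathrm{Aut}$ denotes the full automorphism group (permutations of points preserving the set of triples). -}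

module Defs where

open import Data.Nat using (ℕ)
open import Data.Bool using (Bool; true; false; _∨_; _∧_)
open import Data.Fin.Properties using (_≟_)
open import Relation.Nullary using (does)
open import Data.Fin using (Fin)
open import Data.Fin.Subset using (Subset; _∈_; ∣_∣)
open import Data.Fin.Permutation using (Permutation′; _⟨$⟩ʳ_; _⟨$⟩ˡ_; _∘ₚ_; _≈_)
open import Data.Vec using (tabulate; lookup; foldr′; zipWith; allFin)
open import Data.Product using (Σ; ∃; _×_; _,_; proj₁)
open import Relation.Binary.PropositionalEquality using (_≡_; _≢_)
open import Function.Definitions using (Injective)

record PSTS (n : ℕ) : Set where
  field
    isTriple   : Subset n → Bool
    triple-3   : ∀ S → isTriple S ≡ true → ∣ S ∣ ≡ 3
    at-most-one : ∀ (x y : Fin n) → x ≢ y → ∀ S T →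
                  isTriple S ≡ true → isTriple T ≡ true →
                  x ∈ S → y ∈ S → x ∈ T → y ∈ T → S ≡ T
open PSTS public

-- A Steiner triple system: any two distinct points lie in (exactly) one triple
-- (uniqueness is already part of PSTS).
IsSTS : ∀ {n} → PSTS n → Set
IsSTS {n} U = ∀ (x y : Fin n) → x ≢ y →
              ∃ λ S → isTriple U S ≡ true × x ∈ S × y ∈ S

record STS (n : ℕ) : Set where
  field
    psts  : PSTS n
    isSTS : IsSTS psts
open STS public

_·_ : ∀ {n} → Permutation′ n → Subset n → Subset n
σ · S = tabulate (λ x → lookup S (σ ⟨$⟩ˡ x))

IsAut : ∀ {n} → PSTS n → Permutation′ n → Set
IsAut V σ = ∀ S → isTriple V (σ · S) ≡ isTriple V S

Aut : ∀ {n} → PSTS n → Set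
Aut {n} V = Σ (Permutation′ n) (IsAut V)

img : ∀ {v u} → (Fin v → Fin u) → Subset v → Subset u
img {v} {u} f S = tabulate (λ y → isIn y)
  where
  isIn : Fin u → Bool
  isIn y = foldr′ _∨_ false (zipWith (λ x b → b ∧ does (f x ≟ y)) (allFin v) S)

-- V is a subsystem of U via the embedding f (identifying the points of V with
-- points of U): the triples of U contained in f(points of V) are exactly the
-- images of the triples of V.
IsSubsystem : ∀ {v u} → PSTS v → PSTS u → (Fin v → Fin u) → Set
IsSubsystem {v} {u} V U f =
  Injective _≡_ _≡_ f ×
  (∀ (S : Subset v) → isTriple U (img f S) ≡ isTriple V S)

record AutIso {m n} (U : PSTS m) (V : PSTS n) : Set where
  field
    φ      : Aut U → Aut V
    φ-cong : ∀ {a b} → proj₁ a ≈ proj₁ b → proj₁ (φ a) ≈ proj₁ (φ b)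
    φ-hom  : ∀ (a b : Aut U) (pab : IsAut U (proj₁ a ∘ₚ proj₁ b)) →
             proj₁ (φ (proj₁ a ∘ₚ proj₁ b , pab)) ≈ (proj₁ (φ a) ∘ₚ proj₁ (φ b))
    φ-inj  : ∀ {a b} → proj₁ (φ a) ≈ proj₁ (φ b) → proj₁ a ≈ proj₁ b
    φ-surj : ∀ (c : Aut V) → ∃ λ a → proj₁ (φ a) ≈ proj₁ c

{-# OPTIONS --safe #-}
-- V is first embedded in a projective space over F₂ in which, for each triple of V, the plane it spans is relabelled so that
-- the triple becomes a line; Aut V acts on the resulting Steiner triple system W.  Every point x of W is then inflated to a
-- group {x} × P with P = ℤ/p × ℤ/2: a line x y z of W becomes the transversal design b + b′ + b″ = 0, and each group together
-- with one common subsystem Lab is filled by a one-factorisation of the complete graph on P minus some triangles, the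
-- one-factors being labelled by the points of Lab.  The number of triangles adjusts the order modulo |W|, and the order
-- grows with p while W stays fixed.  For rigidity, the labels of the one-factors joining the two levels of P are
-- recognisable by the many quadrilaterals through them, so an automorphism permutes the groups; on groups it is affine, and
-- translating the filling of x by one of finitely many "colours" κ x, which form a set without affine symmetries, forces it
-- to be (x , b) ↦ (π x , b) with π a colour-preserving automorphism of W.  The colours mark the points of V and the extra
-- basis vectors, whence π comes from Aut V.
module Submission where

open import Defs
open import Data.Nat using (ℕ; _≤_; _%_)
open import Data.Fin using (Fin)
open import Data.Fin.Permutation using (_⟨$⟩ʳ_)
open import Data.Product using (Σ; ∃; _×_; _,_; proj₁)
open import Data.Sum using (_⊎_)
open import Relation.Binary.PropositionalEquality using (_≡_)

open import Algebra.Structures using (IsAbelianGroup)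
open import Data.Bool using (Bool; true; false; not; _xor_; _∨_; _∧_; if_then_else_)
import Data.Bool.Properties as 𝔹
open import Data.Empty using (⊥; ⊥-elim)
open import Data.Fin using (toℕ; fromℕ<; punchIn; punchOut)
import Data.Fin as F
open import Data.Fin.Patterns using (0F; 1F; 2F)
open import Data.Fin.Permutation using (Permutation′; permutation; _⟨$⟩ˡ_; flip; _∘ₚ_)
import Data.Fin.Permutation as Perm
open import Data.Fin.Properties using (toℕ-fromℕ<; toℕ<n; toℕ-injective; punchInᵢ≢i; punchIn-injective;
  punchIn-punchOut; inject≤-injective; injective⇒≤; any?; all?; +↔⊎; *↔×; 2↔Bool)
open import Data.Fin.Subset using (Subset; _∈_; _⊆_; ∣_∣; ⁅_⁆) renaming (⊥ to ∅)
open import Data.Fin.Subset.Properties using (anySubset?; _⊆?_; x∈⁅x⁆; x∈⁅y⁆⇒x≡y; ∣⁅x⁆∣≡1; ∣⊥∣≡0)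
open import Data.Nat using (zero; suc; _<_; z≤n; s≤s)
import Data.Nat as ℕ
open import Data.Nat.DivMod using (_/_; m%n<n; %-distribˡ-+; [m+kn]%n≡m%n; m<n⇒m%n≡m; n%n≡0; m≡m%n+[m/n]*n; /-monoˡ-≤; m*n/n≡m)
import Data.Nat.Properties as ℕₚ
open import Data.Nat.Tactic.RingSolver using (solve-∀)
open import Data.Product using (proj₂)
open import Data.Product.Function.NonDependent.Propositional using (_×-↔_)
open import Data.Product.Properties using (,-injectiveˡ; ,-injectiveʳ)
open import Data.Sum using (inj₁; inj₂)
open import Data.Sum.Function.Propositional using (_⊎-↔_)
open import Data.Sum.Properties using (inj₁-injective; inj₂-injective)
open import Data.Vec using (Vec; []; _∷_; lookup; replicate; zipWith; here; there; foldr′; allFin)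
open import Data.Vec.Properties using ([]=⇒lookup; lookup⇒[]=; lookup-zipWith; lookup∘tabulate; tabulate∘lookup;
  tabulate-cong; ≡-dec; lookup-replicate; lookup-allFin)
open import Function using (_∘_; case_of_)
open import Function.Bundles using (_↔_; Inverse; mk↔ₛ′)
open import Function.Construct.Composition using (_↔-∘_)
open import Function.Construct.Identity using (↔-id)
open import Function.Construct.Symmetry using (↔-sym)
open import Function.Definitions using (Injective)
open import Relation.Binary.PropositionalEquality using (_≢_; refl; sym; trans; cong; cong₂; subst; isEquivalence; module ≡-Reasoning)
open import Relation.Nullary using (Dec; yes; no; ¬_; does; contradiction)
open import Relation.Nullary.Decidable using (_×-dec_; _⊎-dec_; _→-dec_; ¬?; map′; dec-true; dec-false)

-- Abelian groups and residues modulo an odd number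

-- The transversal designs on their own admit many affine maps of `P`, so the symmetry has to be
-- broken by W and by the fillings. An automorphism acts on the groups by affine maps with a common
-- linear part, which splits because `A` has odd order. Translations in `A` vanish because W admits
-- no nonzero v with v (x ⋆ y) = - (v x + v y); an exchange of the two levels is excluded because it
-- would reverse the sign of a cross label; a scaling of `A` is excluded by the colours, a condition
-- on a fixed finite set of integers once p exceeds three times the largest of them. Orders: with M
-- = |W| + 1 and t base triangles, |Lab| = 2p - 1 - 6t, hence u + 1 + 6t = 2pM. Choosing p ≡ 5 (mod
-- 6) makes 3 invertible modulo p and |Lab| ≡ 3 (mod 6), so that a Bose system lives on Lab. As M is
-- an even number, u + 1 ≡ M (mod 6).

module AbelianSolver {A : Set} {_+_ : A → A → A} {0# : A} { -_ : A → A}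
  (isAb : IsAbelianGroup _≡_ _+_ 0# -_) where

  open IsAbelianGroup isAb using (assoc; comm; identityˡ; identityʳ; inverseˡ; inverseʳ)
  open ≡-Reasoning

  data Expr (n : ℕ) : Set where
    var   : Fin n → Expr n
    _:+_  : Expr n → Expr n → Expr n
    :-_   : Expr n → Expr n
    :0    : Expr n

  infixl 6 _:+_ _:−_
  infix 8 :-_

  _:−_ : ∀ {n} → Expr n → Expr n → Expr n
  x :− y = x :+ (:- y)

  ⟦_⟧ : ∀ {n} → Expr n → Vec A n → A
  ⟦ var i ⟧ ρ = lookup ρ i
  ⟦ e :+ e′ ⟧ ρ = ⟦ e ⟧ ρ + ⟦ e′ ⟧ ρ
  ⟦ :- e ⟧ ρ = - ⟦ e ⟧ ρ
  ⟦ :0 ⟧ ρ = 0#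

  times : ℕ → A → A
  times zero x = 0#
  times (suc n) x = x + times n x

  lin : ∀ {n} → Vec ℕ n → Vec A n → A
  lin [] [] = 0#
  lin (c ∷ cs) (x ∷ ρ) = times c x + lin cs ρ

  interchange : ∀ a b c d → (a + b) + (c + d) ≡ (a + c) + (b + d)
  interchange a b c d = begin
    (a + b) + (c + d) ≡⟨ assoc a b (c + d) ⟩
    a + (b + (c + d)) ≡⟨ cong (a +_) (sym (assoc b c d)) ⟩
    a + ((b + c) + d) ≡⟨ cong (λ z → a + (z + d)) (comm b c) ⟩
    a + ((c + b) + d) ≡⟨ cong (a +_) (assoc c b d) ⟩
    a + (c + (b + d)) ≡⟨ sym (assoc a c (b + d)) ⟩
    (a + c) + (b + d) ∎

  times-+ : ∀ m n x → times (m ℕ.+ n) x ≡ times m x + times n x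
  times-+ zero n x = sym (identityˡ _)
  times-+ (suc m) n x = trans (cong (x +_) (times-+ m n x)) (sym (assoc _ _ _))

  lin-+ : ∀ {n} (c d : Vec ℕ n) ρ → lin (zipWith ℕ._+_ c d) ρ ≡ lin c ρ + lin d ρ
  lin-+ [] [] [] = sym (identityˡ 0#)
  lin-+ (c ∷ cs) (d ∷ ds) (x ∷ ρ) =
    trans (cong₂ _+_ (times-+ c d x) (lin-+ cs ds ρ)) (interchange _ _ _ _)

  lin-0 : ∀ {n} (ρ : Vec A n) → lin (replicate n 0) ρ ≡ 0#
  lin-0 [] = refl
  lin-0 (x ∷ ρ) = trans (identityˡ _) (lin-0 ρ)

  unit : ∀ {n} → Fin n → Vec ℕ n
  unit F.zero = 1 ∷ replicate _ 0
  unit (F.suc i) = 0 ∷ unit i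

  lin-unit : ∀ {n} (i : Fin n) (ρ : Vec A n) → lin (unit i) ρ ≡ lookup ρ i
  lin-unit F.zero (x ∷ ρ) = trans (cong₂ _+_ (identityʳ x) (lin-0 ρ)) (identityʳ x)
  lin-unit (F.suc i) (x ∷ ρ) = trans (identityˡ _) (lin-unit i ρ)

  -- Expressions are normalised to a difference of two combinations with natural coefficients, which
  -- avoids integers: an identity e = e′ follows once pos e + neg e′ and pos e′ + neg e agree as
  -- coefficient vectors, and `refl` decides that.
  pos neg : ∀ {n} → Expr n → Vec ℕ n
  pos (var i) = unit i
  pos (e :+ e′) = zipWith ℕ._+_ (pos e) (pos e′)
  pos (:- e) = neg e
  pos :0 = replicate _ 0
  neg (var i) = replicate _ 0
  neg (e :+ e′) = zipWith ℕ._+_ (neg e) (neg e′)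
  neg (:- e) = pos e
  neg :0 = replicate _ 0

  split : ∀ {n} (e : Expr n) ρ → ⟦ e ⟧ ρ + lin (neg e) ρ ≡ lin (pos e) ρ
  split (var i) ρ = trans (cong (lookup ρ i +_) (lin-0 ρ)) (trans (identityʳ _) (sym (lin-unit i ρ)))
  split (e :+ e′) ρ = begin
    _ ≡⟨ cong ((⟦ e ⟧ ρ + ⟦ e′ ⟧ ρ) +_) (lin-+ (neg e) (neg e′) ρ) ⟩
    _ ≡⟨ interchange _ _ _ _ ⟩
    _ ≡⟨ cong₂ _+_ (split e ρ) (split e′ ρ) ⟩
    _ ≡⟨ sym (lin-+ (pos e) (pos e′) ρ) ⟩
    _ ∎
  split (:- e) ρ = begin
    (- x) + lin (pos e) ρ ≡⟨ cong ((- x) +_) (sym (split e ρ)) ⟩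
    (- x) + (x + lin (neg e) ρ) ≡⟨ sym (assoc _ _ _) ⟩
    ((- x) + x) + lin (neg e) ρ ≡⟨ cong (_+ lin (neg e) ρ) (inverseˡ x) ⟩
    0# + lin (neg e) ρ ≡⟨ identityˡ _ ⟩
    lin (neg e) ρ ∎
    where x = ⟦ e ⟧ ρ
  split :0 ρ = trans (identityˡ _) refl

  cancelʳ : ∀ x y z → x + z ≡ y + z → x ≡ y
  cancelʳ x y z eq = begin
    x ≡⟨ sym (strip x) ⟩
    (x + z) + (- z) ≡⟨ cong (_+ (- z)) eq ⟩
    (y + z) + (- z) ≡⟨ strip y ⟩
    y ∎
    where
    strip : ∀ u → (u + z) + (- z) ≡ u
    strip u = trans (assoc u z (- z)) (trans (cong (u +_) (inverseʳ z)) (identityʳ u))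

  solve : ∀ {n} (e e′ : Expr n) (ρ : Vec A n) →
    zipWith ℕ._+_ (pos e) (neg e′) ≡ zipWith ℕ._+_ (pos e′) (neg e) → ⟦ e ⟧ ρ ≡ ⟦ e′ ⟧ ρ
  solve e e′ ρ eq = cancelʳ _ _ (lin (neg e) ρ + lin (neg e′) ρ) (begin
    ⟦ e ⟧ ρ + (lin (neg e) ρ + lin (neg e′) ρ) ≡⟨ sym (assoc _ _ _) ⟩
    (⟦ e ⟧ ρ + lin (neg e) ρ) + lin (neg e′) ρ ≡⟨ cong (_+ _) (split e ρ) ⟩
    lin (pos e) ρ + lin (neg e′) ρ ≡⟨ sym (lin-+ (pos e) (neg e′) ρ) ⟩
    lin (zipWith ℕ._+_ (pos e) (neg e′)) ρ ≡⟨ cong (λ c → lin c ρ) eq ⟩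
    lin (zipWith ℕ._+_ (pos e′) (neg e)) ρ ≡⟨ lin-+ (pos e′) (neg e) ρ ⟩
    lin (pos e′) ρ + lin (neg e) ρ ≡⟨ cong (_+ _) (sym (split e′ ρ)) ⟩
    (⟦ e′ ⟧ ρ + lin (neg e′) ρ) + lin (neg e) ρ ≡⟨ assoc _ _ _ ⟩
    ⟦ e′ ⟧ ρ + (lin (neg e′) ρ + lin (neg e) ρ) ≡⟨ cong (⟦ e′ ⟧ ρ +_) (comm _ _) ⟩
    ⟦ e′ ⟧ ρ + (lin (neg e) ρ + lin (neg e′) ρ) ∎)

  v0 : ∀ {n} → Expr (suc n)
  v0 = var F.zero
  v1 : ∀ {n} → Expr (suc (suc n))
  v1 = var (F.suc F.zero)
  v2 : ∀ {n} → Expr (suc (suc (suc n)))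
  v2 = var (F.suc (F.suc F.zero))
  v3 : ∀ {n} → Expr (suc (suc (suc (suc n))))
  v3 = var (F.suc (F.suc (F.suc F.zero)))

module ℤ/ (h : ℕ) where

  -- Odd for every `h`, so that 2 is invertible with inverse `suc h`; this is what `half` multiplies
  -- by.
  p : ℕ
  p = suc (h ℕ.+ h)

  A : Set
  A = Fin p

  abstract
    [_] : ℕ → A
    [ n ] = fromℕ< (m%n<n n p)

    toℕ-[] : ∀ n → toℕ [ n ] ≡ n % p
    toℕ-[] n = toℕ-fromℕ< (m%n<n n p)

  []-cong : ∀ m n → m % p ≡ n % p → [ m ] ≡ [ n ]
  []-cong m n eq = toℕ-injective (trans (toℕ-[] m) (trans eq (sym (toℕ-[] n))))

  []-toℕ : ∀ a → [ toℕ a ] ≡ a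
  []-toℕ a = toℕ-injective (trans (toℕ-[] (toℕ a)) (m<n⇒m%n≡m (toℕ<n a)))

  []-injective : ∀ {m n} → m < p → n < p → [ m ] ≡ [ n ] → m ≡ n
  []-injective {m} {n} m<p n<p eq =
    trans (sym (m<n⇒m%n≡m m<p)) (trans (sym (toℕ-[] m)) (trans (cong toℕ eq) (trans (toℕ-[] n) (m<n⇒m%n≡m n<p))))

  [+k*p] : ∀ m k → [ m ℕ.+ k ℕ.* p ] ≡ [ m ]
  [+k*p] m k = []-cong (m ℕ.+ k ℕ.* p) m ([m+kn]%n≡m%n m k p)

  infixl 6 _+_ _−_
  infix 8 -_

  _+_ : A → A → A
  a + b = [ toℕ a ℕ.+ toℕ b ]

  -_ : A → A
  - a = [ p ℕ.∸ toℕ a ]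

  _−_ : A → A → A
  a − b = a + - b

  0# 1# : A
  0# = [ 0 ]
  1# = [ 1 ]

  []-+ : ∀ m n → [ m ] + [ n ] ≡ [ m ℕ.+ n ]
  []-+ m n = []-cong (toℕ [ m ] ℕ.+ toℕ [ n ]) (m ℕ.+ n) (trans (cong₂ (λ x y → (x ℕ.+ y) % p) (toℕ-[] m) (toℕ-[] n)) (sym (%-distribˡ-+ m n p)))

  +-comm : ∀ a b → a + b ≡ b + a
  +-comm a b = cong [_] (ℕₚ.+-comm (toℕ a) (toℕ b))

  private
    open ≡-Reasoning

    +-assoc : ∀ a b c → (a + b) + c ≡ a + (b + c)
    +-assoc a b c = begin
      (a + b) + c ≡⟨ cong ((a + b) +_) (sym ([]-toℕ c)) ⟩
      (a + b) + [ toℕ c ] ≡⟨ []-+ (toℕ a ℕ.+ toℕ b) (toℕ c) ⟩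
      [ toℕ a ℕ.+ toℕ b ℕ.+ toℕ c ] ≡⟨ cong [_] (ℕₚ.+-assoc (toℕ a) (toℕ b) (toℕ c)) ⟩
      [ toℕ a ℕ.+ (toℕ b ℕ.+ toℕ c) ] ≡⟨ sym ([]-+ (toℕ a) _) ⟩
      [ toℕ a ] + (b + c) ≡⟨ cong (_+ (b + c)) ([]-toℕ a) ⟩
      a + (b + c) ∎

    +-identityˡ : ∀ a → 0# + a ≡ a
    +-identityˡ a = begin
      0# + a ≡⟨ cong (0# +_) (sym ([]-toℕ a)) ⟩
      0# + [ toℕ a ] ≡⟨ []-+ 0 (toℕ a) ⟩
      [ toℕ a ] ≡⟨ []-toℕ a ⟩
      a ∎

    +-inverseʳ : ∀ a → a + - a ≡ 0#
    +-inverseʳ a = begin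
      a + - a ≡⟨ cong (_+ (- a)) (sym ([]-toℕ a)) ⟩
      [ toℕ a ] + - a ≡⟨ []-+ (toℕ a) _ ⟩
      [ toℕ a ℕ.+ (p ℕ.∸ toℕ a) ] ≡⟨ cong [_] (ℕₚ.m+[n∸m]≡n (ℕₚ.<⇒≤ (toℕ<n a))) ⟩
      [ p ] ≡⟨ []-cong p 0 (n%n≡0 p) ⟩
      0# ∎

  isAbelianGroup : IsAbelianGroup _≡_ _+_ 0# -_
  isAbelianGroup = record
    { isGroup = record
      { isMonoid = record
        { isSemigroup = record
          { isMagma = record { isEquivalence = isEquivalence ; ∙-cong = cong₂ _+_ }
          ; assoc = +-assoc }
        ; identity = +-identityˡ , λ a → trans (+-comm a 0#) (+-identityˡ a) }
      ; inverse = (λ a → trans (+-comm (- a) a) (+-inverseʳ a)) , +-inverseʳ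
      ; ⁻¹-cong = cong -_ }
    ; comm = +-comm }

  open AbelianSolver isAbelianGroup public
    using (solve; _:+_; _:−_; :-_; :0; v0; v1; v2; v3; cancelʳ)

  half : A → A
  half a = [ suc h ℕ.* toℕ a ]

  private
    double-half-ℕ : ∀ h n → suc h ℕ.* n ℕ.+ suc h ℕ.* n ≡ n ℕ.+ n ℕ.* suc (h ℕ.+ h)
    double-half-ℕ = solve-∀

    suc-p-ℕ : ∀ n m → n ℕ.* suc m ≡ n ℕ.+ n ℕ.* m
    suc-p-ℕ = solve-∀

  half+half : ∀ a → half a + half a ≡ a
  half+half a = begin
    half a + half a ≡⟨ []-+ (suc h ℕ.* toℕ a) _ ⟩
    [ suc h ℕ.* toℕ a ℕ.+ suc h ℕ.* toℕ a ] ≡⟨ cong [_] (double-half-ℕ h (toℕ a)) ⟩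
    [ toℕ a ℕ.+ toℕ a ℕ.* p ] ≡⟨ [+k*p] (toℕ a) (toℕ a) ⟩
    [ toℕ a ] ≡⟨ []-toℕ a ⟩
    a ∎

  infixr 7 _⊛_
  _⊛_ : ℕ → A → A
  zero ⊛ a = 0#
  suc n ⊛ a = a + n ⊛ a

  ⊛-[] : ∀ n m → n ⊛ [ m ] ≡ [ n ℕ.* m ]
  ⊛-[] zero m = refl
  ⊛-[] (suc n) m = trans (cong ([ m ] +_) (⊛-[] n m)) ([]-+ m (n ℕ.* m))

  ⊛-0# : ∀ n → n ⊛ 0# ≡ 0#
  ⊛-0# zero = refl
  ⊛-0# (suc n) = trans (+-identityˡ _) (⊛-0# n)

  ⊛-* : ∀ m n a → m ⊛ (n ⊛ a) ≡ (m ℕ.* n) ⊛ a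
  ⊛-* m n a = begin
    m ⊛ (n ⊛ a) ≡⟨ cong (λ b → m ⊛ (n ⊛ b)) (sym ([]-toℕ a)) ⟩
    m ⊛ (n ⊛ [ toℕ a ]) ≡⟨ cong (m ⊛_) (⊛-[] n (toℕ a)) ⟩
    m ⊛ [ n ℕ.* toℕ a ] ≡⟨ ⊛-[] m _ ⟩
    [ m ℕ.* (n ℕ.* toℕ a) ] ≡⟨ cong [_] (sym (ℕₚ.*-assoc m n (toℕ a))) ⟩
    [ (m ℕ.* n) ℕ.* toℕ a ] ≡⟨ sym (⊛-[] (m ℕ.* n) _) ⟩
    (m ℕ.* n) ⊛ [ toℕ a ] ≡⟨ cong ((m ℕ.* n) ⊛_) ([]-toℕ a) ⟩
    (m ℕ.* n) ⊛ a ∎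

  suc-p-⊛ : ∀ a → suc p ⊛ a ≡ a
  suc-p-⊛ a = begin
    suc p ⊛ a ≡⟨ cong (suc p ⊛_) (sym ([]-toℕ a)) ⟩
    suc p ⊛ [ toℕ a ] ≡⟨ ⊛-[] (suc p) (toℕ a) ⟩
    [ suc p ℕ.* toℕ a ] ≡⟨ cong [_] (trans (ℕₚ.*-comm (suc p) (toℕ a)) (suc-p-ℕ (toℕ a) p)) ⟩
    [ toℕ a ℕ.+ toℕ a ℕ.* p ] ≡⟨ [+k*p] (toℕ a) (toℕ a) ⟩
    [ toℕ a ] ≡⟨ []-toℕ a ⟩
    a ∎

  -- Since p + 1 acts as 1, a factorisation k n = p + 1 exhibits `k` as an inverse of `n`. Applied
  -- with n = 2 and n = 3.
  ⊛-torsion : ∀ n k → k ℕ.* n ≡ suc p → ∀ a → n ⊛ a ≡ 0# → a ≡ 0#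
  ⊛-torsion n k eq a na≡0 = begin
    a ≡⟨ sym (suc-p-⊛ a) ⟩
    suc p ⊛ a ≡⟨ cong (_⊛ a) (sym eq) ⟩
    (k ℕ.* n) ⊛ a ≡⟨ sym (⊛-* k n a) ⟩
    k ⊛ (n ⊛ a) ≡⟨ cong (k ⊛_) na≡0 ⟩
    k ⊛ 0# ≡⟨ ⊛-0# k ⟩
    0# ∎

  double-zero : ∀ a → a + a ≡ 0# → a ≡ 0#
  double-zero a eq = ⊛-torsion 2 (suc h) (suc-p h) a
    (trans (solve (v0 :+ (v0 :+ :0)) (v0 :+ v0) (a ∷ []) refl) eq)
    where
    suc-p : ∀ h → suc h ℕ.* 2 ≡ suc (suc (h ℕ.+ h))
    suc-p = solve-∀

  −-zero : ∀ {a b} → a − b ≡ 0# → a ≡ b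
  −-zero {a} {b} eq = trans (solve v0 ((v0 :− v1) :+ v1) (a ∷ b ∷ []) refl)
    (trans (cong (_+ b) eq) (+-identityˡ b))

  double-injective : ∀ {a b} → a + a ≡ b + b → a ≡ b
  double-injective {a} {b} eq = −-zero (double-zero (a − b)
    (trans (solve ((v0 :− v1) :+ (v0 :− v1)) ((v0 :+ v0) :− (v1 :+ v1)) (a ∷ b ∷ []) refl)
      (trans (cong (_− (b + b)) eq) (+-inverseʳ (b + b)))))

  half-double : ∀ a → half (a + a) ≡ a
  half-double a = double-injective (half+half (a + a))

  cyclic-induction : (Q : A → Set) → Q 0# → (∀ a → Q a → Q (a + 1#)) → ∀ a → Q a
  cyclic-induction Q q0 qs a = subst Q ([]-toℕ a) (go (toℕ a))
    where
    go : ∀ n → Q [ n ]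
    go zero = q0
    go (suc n) = subst Q (trans ([]-+ n 1) (cong [_] (ℕₚ.+-comm n 1))) (qs [ n ] (go n))

-- Squags and their extensions

-- For x ≢ y, the third point of the triple through x and y is x ∙ y.
record Squag (X : Set) : Set where
  infixl 7 _∙_
  field
    _∙_   : X → X → X
    idem  : ∀ x → x ∙ x ≡ x
    comm  : ∀ x y → x ∙ y ≡ y ∙ x
    invol : ∀ x y → x ∙ (x ∙ y) ≡ y

  cancelˡ : ∀ x {y z} → x ∙ y ≡ x ∙ z → y ≡ z
  cancelˡ x {y} {z} eq = trans (sym (invol x y)) (trans (cong (x ∙_) eq) (invol x z))

  ∙≡ˡ : ∀ {x y} → x ∙ y ≡ x → x ≡ y
  ∙≡ˡ {x} {y} eq = sym (cancelˡ x (trans eq (sym (idem x))))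

  ∙≡ʳ : ∀ {x y} → x ∙ y ≡ y → x ≡ y
  ∙≡ʳ {x} {y} eq = sym (∙≡ˡ (trans (comm y x) eq))

-- A Steiner triple system on Lab and one group, relative to Lab: `act l` is the one-factor named
-- `l`, and `prod` returns either the label of an edge or the third vertex of its triangle. Together
-- `prod-idem` and `prod-act` rule out fixed points of `act l`.
record Filler (Lab P : Set) : Set where
  field
    prod : P → P → Lab ⊎ P
    act  : Lab → P → P
    prod-idem : ∀ b → prod b b ≡ inj₂ b
    prod-comm : ∀ b b′ → prod b b′ ≡ prod b′ b
    act-invol : ∀ l b → act l (act l b) ≡ b
    prod-act  : ∀ l b → prod b (act l b) ≡ inj₁ l
    act-prod  : ∀ {l b b′} → prod b b′ ≡ inj₁ l → act l b ≡ b′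
    prod-prod : ∀ {b b′ b″} → prod b b′ ≡ inj₂ b″ → prod b b″ ≡ inj₂ b′

module Extension {Lab P : Set} {w : ℕ} (F : Squag Lab) (W : Squag (Fin w))
  (_⊕_ : P → P → P) (⊕-comm : ∀ b b′ → b ⊕ b′ ≡ b′ ⊕ b) (⊕-invol : ∀ b b′ → b ⊕ (b ⊕ b′) ≡ b′)
  (filler : Fin w → Filler Lab P) where

  open Squag W renaming (_∙_ to _⋆_; idem to ⋆-idem; comm to ⋆-comm; invol to ⋆-invol; ∙≡ˡ to ⋆≡ˡ) using ()
  open Squag F renaming (_∙_ to _∘ᶠ_; idem to ᶠ-idem; comm to ᶠ-comm; invol to ᶠ-invol) using ()
  module Fill (x : Fin w) = Filler (filler x)
  open Fill

  U : Set
  U = Lab ⊎ (Fin w × P)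

  place : Fin w → Lab ⊎ P → U
  place x (inj₁ l) = inj₁ l
  place x (inj₂ b) = inj₂ (x , b)

  cell : ∀ x y → Dec (x ≡ y) → P → P → U
  cell x y (yes _) b b′ = place x (prod x b b′)
  cell x y (no _) b b′ = inj₂ (x ⋆ y , b ⊕ b′)

  infixl 7 _∙_
  _∙_ : U → U → U
  inj₁ l ∙ inj₁ m = inj₁ (l ∘ᶠ m)
  inj₁ l ∙ inj₂ (x , b) = inj₂ (x , act x l b)
  inj₂ (x , b) ∙ inj₁ l = inj₂ (x , act x l b)
  inj₂ (x , b) ∙ inj₂ (y , b′) = cell x y (x F.≟ y) b b′

  ∙-same : ∀ x b b′ → inj₂ (x , b) ∙ inj₂ (x , b′) ≡ place x (prod x b b′)
  ∙-same x b b′ with x F.≟ x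
  ... | yes _ = refl
  ... | no x≢x = contradiction refl x≢x

  ∙-diff : ∀ {x y} → x ≢ y → ∀ b b′ → inj₂ (x , b) ∙ inj₂ (y , b′) ≡ inj₂ (x ⋆ y , b ⊕ b′)
  ∙-diff {x} {y} x≢y b b′ with x F.≟ y
  ... | yes x≡y = contradiction x≡y x≢y
  ... | no _ = refl

  squag : Squag U
  squag = record { _∙_ = _∙_ ; idem = idem ; comm = comm ; invol = invol }
    where
    idem : ∀ s → s ∙ s ≡ s
    idem (inj₁ l) = cong inj₁ (ᶠ-idem l)
    idem (inj₂ (x , b)) = trans (∙-same x b b) (cong (place x) (prod-idem x b))

    comm : ∀ s t → s ∙ t ≡ t ∙ s
    comm (inj₁ l) (inj₁ m) = cong inj₁ (ᶠ-comm l m)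
    comm (inj₁ l) (inj₂ _) = refl
    comm (inj₂ _) (inj₁ l) = refl
    comm (inj₂ (x , b)) (inj₂ (y , b′)) = case x F.≟ y of λ where
      (yes refl) → trans (∙-same x b b′) (trans (cong (place x) (prod-comm x b b′)) (sym (∙-same x b′ b)))
      (no x≢y) → trans (∙-diff x≢y b b′)
        (trans (cong inj₂ (cong₂ _,_ (⋆-comm x y) (⊕-comm b b′))) (sym (∙-diff (x≢y ∘ sym) b′ b)))

    invol-same : ∀ x b b′ r → prod x b b′ ≡ r → inj₂ (x , b) ∙ place x r ≡ inj₂ (x , b′)
    invol-same x b b′ (inj₁ l) eq = cong (λ b″ → inj₂ (x , b″)) (act-prod x eq)
    invol-same x b b′ (inj₂ b″) eq = trans (∙-same x b b″) (cong (place x) (prod-prod x eq))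

    invol : ∀ s t → s ∙ (s ∙ t) ≡ t
    invol (inj₁ l) (inj₁ m) = cong inj₁ (ᶠ-invol l m)
    invol (inj₁ l) (inj₂ (x , b)) = cong (λ b′ → inj₂ (x , b′)) (act-invol x l b)
    invol (inj₂ (x , b)) (inj₁ l) = trans (∙-same x b (act x l b)) (cong (place x) (prod-act x l b))
    invol (inj₂ (x , b)) (inj₂ (y , b′)) = case x F.≟ y of λ where
      (yes refl) → trans (cong (inj₂ (x , b) ∙_) (∙-same x b b′)) (invol-same x b b′ (prod x b b′) refl)
      (no x≢y) → trans (cong (inj₂ (x , b) ∙_) (∙-diff x≢y b b′))
        (trans (∙-diff (λ e → x≢y (⋆≡ˡ (sym e))) b (b ⊕ b′)) (cong inj₂ (cong₂ _,_ (⋆-invol x y) (⊕-invol b b′))))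

-- `Δ` stores its proof irrelevantly so that its elements are determined by `el`; a Boolean equation
-- can be rebuilt where it is used relevantly.
recompute-false : ∀ {s} → .(s ≡ false) → s ≡ false
recompute-false {false} _ = refl

-- D = {d : χ d ≡ true} is symmetric and contains 0#; the translates of the blocks {0#, d, ν d} decompose
-- the pairs of elements of A with difference in D into triangles (degenerate for d ≡ 0#).
record DifferenceFamily (h : ℕ) : Set where
  open ℤ/ h
  field
    χ     : A → Bool
    ν     : A → A
    χ-0   : χ 0# ≡ true
    ν-0   : ν 0# ≡ 0#
    χ-neg : ∀ d → χ (- d) ≡ χ d
    χ-ν   : ∀ {d} → χ d ≡ true → χ (ν d) ≡ true
    ν-ν   : ∀ {d} → χ d ≡ true → ν (ν d) ≡ d
    ν-neg : ∀ {d} → χ d ≡ true → ν d ≡ d + ν (- d)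

-- The filling of a group by reflections, cross factors and triangles

module StandardFiller {h : ℕ} (D : DifferenceFamily h) where
  open ℤ/ h
  open DifferenceFamily D

  record Δ : Set where
    constructor δ
    field
      el  : A
      .ok : χ el ≡ false
  open Δ public

  -- inj₁ i labels the one-factor of the reflection a ↦ 2i − a, and inj₂ d the one joining the two levels with difference d.
  Lab : Set
  Lab = A ⊎ Δ

  P : Set
  P = A × Bool

  δ-cong : ∀ {x y : Δ} → el x ≡ el y → x ≡ y
  δ-cong refl = refl

  χ-swap : ∀ a a′ → χ (a − a′) ≡ χ (a′ − a)
  χ-swap a a′ = trans (cong χ (solve (v0 :− v1) (:- (v1 :− v0)) (a ∷ a′ ∷ []) refl)) (χ-neg (a′ − a))

  -- Differences in D are used up by triangles inside each level, so a reflection must leave the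
  -- level on exactly those differences; the remaining edges between the levels form the cross
  -- factors. The shift `k` renames reflection labels only, while cross labels do not see it. The
  -- Boolean `s` is a separate argument so that the clauses can split on it.
  pr : A → ∀ a (e : Bool) a′ (e′ : Bool) s → .(χ (a′ − a) ≡ s) → Lab ⊎ P
  pr k a false a′ false true  q = inj₂ (a + ν (a′ − a) , false)
  pr k a true  a′ true  true  q = inj₂ (a + ν (a′ − a) , true)
  pr k a false a′ false false q = inj₁ (inj₁ (half (a + a′) − k))
  pr k a true  a′ true  false q = inj₁ (inj₁ (half (a + a′) − k))
  pr k a false a′ true  true  q = inj₁ (inj₁ (half (a + a′) − k))
  pr k a true  a′ false true  q = inj₁ (inj₁ (half (a + a′) − k))
  pr k a false a′ true  false q = inj₁ (inj₂ (δ (a′ − a) q))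
  pr k a true  a′ false false q = inj₁ (inj₂ (δ (a − a′) (trans (χ-swap a a′) q)))

  prod : A → P → P → Lab ⊎ P
  prod k (a , e) (a′ , e′) = pr k a e a′ e′ (χ (a′ − a)) refl

  prod≡ : ∀ k a e a′ e′ {s} (q : χ (a′ − a) ≡ s) → prod k (a , e) (a′ , e′) ≡ pr k a e a′ e′ s q
  prod≡ k a e a′ e′ refl = refl

  reflect : A → A → A
  reflect m a = m + m − a

  act : A → Lab → P → P
  act k (inj₁ i) (a , e) = reflect (i + k) a , e xor χ (reflect (i + k) a − a)
  act k (inj₂ d) (a , false) = a + el d , true
  act k (inj₂ d) (a , true)  = a − el d , false

  private
    xor-cancel : ∀ e s → (e xor s) xor s ≡ e
    xor-cancel e s = trans (𝔹.xor-assoc e s s) (trans (cong (e xor_) (𝔹.xor-same s)) (𝔹.xor-identityʳ e))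

    prod-idem : ∀ k b → prod k b b ≡ inj₂ b
    prod-idem k (a , e) = trans (prod≡ k a e a e χ-a−a) (go e χ-a−a)
      where
      a−a : a − a ≡ 0#
      a−a = solve (v0 :− v0) :0 (a ∷ []) refl
      χ-a−a : χ (a − a) ≡ true
      χ-a−a = trans (cong χ a−a) χ-0
      fix : a + ν (a − a) ≡ a
      fix = trans (cong (a +_) (trans (cong ν a−a) ν-0)) (solve (v0 :+ :0) v0 (a ∷ []) refl)
      go : ∀ e (q : χ (a − a) ≡ true) → pr k a e a e true q ≡ inj₂ (a , e)
      go false q = cong (λ z → inj₂ (z , false)) fix
      go true  q = cong (λ z → inj₂ (z , true)) fix

    prod-comm : ∀ k b b′ → prod k b b′ ≡ prod k b′ b
    prod-comm k (a , e) (a′ , e′) =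
      trans (go e e′ (χ (a′ − a)) refl) (sym (prod≡ k a′ e′ a e (χ-swap a a′)))
      where
      -- The third vertex is the same whichever end of the edge is taken as origin; this is the
      -- content of `ν-neg`.
      tri : χ (a′ − a) ≡ true → a + ν (a′ − a) ≡ a′ + ν (a − a′)
      tri q = trans (cong (a +_) (ν-neg q)) (trans
        (solve (v0 :+ ((v1 :− v0) :+ v2)) (v1 :+ v2) (a ∷ a′ ∷ ν (- (a′ − a)) ∷ []) refl)
        (cong (λ z → a′ + ν z) (solve (:- (v1 :− v0)) (v0 :− v1) (a ∷ a′ ∷ []) refl)))
      mid : half (a + a′) − k ≡ half (a′ + a) − k
      mid = cong (λ z → half z − k) (+-comm a a′)
      go : ∀ e e′ s (q : χ (a′ − a) ≡ s) → pr k a e a′ e′ s q ≡ pr k a′ e′ a e s (trans (χ-swap a a′) q)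
      go false false true  q = cong (λ z → inj₂ (z , false)) (tri q)
      go true  true  true  q = cong (λ z → inj₂ (z , true)) (tri q)
      go false false false q = cong (inj₁ ∘ inj₁) mid
      go true  true  false q = cong (inj₁ ∘ inj₁) mid
      go false true  true  q = cong (inj₁ ∘ inj₁) mid
      go true  false true  q = cong (inj₁ ∘ inj₁) mid
      go false true  false q = refl
      go true  false false q = refl

    reflect-reflect : ∀ m a → reflect m (reflect m a) ≡ a
    reflect-reflect m a = solve ((v0 :+ v0) :− ((v0 :+ v0) :− v1)) v1 (m ∷ a ∷ []) refl

    act-invol : ∀ k l b → act k l (act k l b) ≡ b
    act-invol k (inj₁ i) (a , e) = cong₂ _,_ (reflect-reflect (i + k) a)
      (trans (cong (λ s → (e xor χ (reflect (i + k) a − a)) xor s)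
        (trans (cong (λ z → χ (z − reflect (i + k) a)) (reflect-reflect (i + k) a)) (χ-swap a _)))
        (xor-cancel e _))
    act-invol k (inj₂ d) (a , false) = cong (_, false) (solve ((v0 :+ v1) :− v1) v0 (a ∷ el d ∷ []) refl)
    act-invol k (inj₂ d) (a , true) = cong (_, true) (solve ((v0 :− v1) :+ v1) v0 (a ∷ el d ∷ []) refl)

    prod-act : ∀ k l b → prod k b (act k l b) ≡ inj₁ l
    prod-act k (inj₁ i) (a , e) = go e (χ (reflect m a − a)) refl
      where
      m : A
      m = i + k
      mid : half (a + reflect m a) − k ≡ i
      mid = trans (cong (λ z → half z − k) (solve (v1 :+ ((v0 :+ v0) :− v1)) (v0 :+ v0) (m ∷ a ∷ []) refl))
        (trans (cong (_− k) (half-double m)) (solve ((v0 :+ v1) :− v1) v0 (i ∷ k ∷ []) refl))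
      go : ∀ e s (q : χ (reflect m a − a) ≡ s) →
        prod k (a , e) (reflect m a , e xor χ (reflect m a − a)) ≡ inj₁ (inj₁ i)
      go e s q = trans (cong (λ r → prod k (a , e) (reflect m a , e xor r)) q)
        (trans (prod≡ k a e _ (e xor s) q) (at e s q))
        where
        at : ∀ e s (q : χ (reflect m a − a) ≡ s) → pr k a e (reflect m a) (e xor s) s q ≡ inj₁ (inj₁ i)
        at false false q = cong (inj₁ ∘ inj₁) mid
        at false true  q = cong (inj₁ ∘ inj₁) mid
        at true  false q = cong (inj₁ ∘ inj₁) mid
        at true  true  q = cong (inj₁ ∘ inj₁) mid
    prod-act k (inj₂ (δ d q)) (a , false) =
      trans (prod≡ k a false (a + d) true (trans (cong χ eq) (recompute-false q))) (cong (inj₁ ∘ inj₂) (δ-cong eq))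
      where
      eq : a + d − a ≡ d
      eq = solve ((v0 :+ v1) :− v0) v1 (a ∷ d ∷ []) refl
    prod-act k (inj₂ (δ d q)) (a , true) =
      trans (prod≡ k a true (a − d) false (trans (χ-swap (a − d) a) (trans (cong χ eq) (recompute-false q))))
        (cong (inj₁ ∘ inj₂) (δ-cong eq))
      where
      eq : a − (a − d) ≡ d
      eq = solve (v0 :− (v0 :− v1)) v1 (a ∷ d ∷ []) refl

    act-prod : ∀ k {l b b′} → prod k b b′ ≡ inj₁ l → act k l b ≡ b′
    act-prod k {l} {a , e} {a′ , e′} eq = go e e′ (χ (a′ − a)) refl eq
      where
      m : A
      m = half (a + a′) − k + k
      ref : reflect m a ≡ a′
      ref = trans (solve (((v2 :− v3) :+ v3) :+ ((v2 :− v3) :+ v3) :− v0) ((v2 :+ v2) :− v0) (a ∷ a′ ∷ half (a + a′) ∷ k ∷ []) refl)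
        (trans (cong (_− a) (half+half (a + a′))) (solve ((v0 :+ v1) :− v0) v1 (a ∷ a′ ∷ []) refl))
      to : ∀ e {e′ s} → χ (a′ − a) ≡ s → e xor s ≡ e′ → act k (inj₁ (half (a + a′) − k)) (a , e) ≡ (a′ , e′)
      to e q eq = cong₂ _,_ ref (trans (cong (λ z → e xor χ (z − a)) ref) (trans (cong (e xor_) q) eq))
      go : ∀ e e′ s (q : χ (a′ − a) ≡ s) → pr k a e a′ e′ s q ≡ inj₁ l → act k l (a , e) ≡ (a′ , e′)
      go false false false q refl = to false q refl
      go true  true  false q refl = to true q refl
      go false true  true  q refl = to false q refl
      go true  false true  q refl = to true q refl
      go false true  false q refl = cong (_, true) (solve (v0 :+ (v1 :− v0)) v1 (a ∷ a′ ∷ []) refl)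
      go true  false false q refl = cong (_, false) (solve (v0 :− (v0 :− v1)) v1 (a ∷ a′ ∷ []) refl)

    prod-prod : ∀ k {b b′ b″} → prod k b b′ ≡ inj₂ b″ → prod k b b″ ≡ inj₂ b′
    prod-prod k {a , e} {a′ , e′} {b″} eq = go e e′ (χ (a′ − a)) refl eq
      where
      third : A
      third = a + ν (a′ − a)
      diff : third − a ≡ ν (a′ − a)
      diff = solve ((v0 :+ v1) :− v0) v1 (a ∷ ν (a′ − a) ∷ []) refl
      back : χ (a′ − a) ≡ true → a + ν (third − a) ≡ a′
      back q = trans (cong (λ z → a + z) (trans (cong ν diff) (ν-ν q))) (solve (v0 :+ (v1 :− v0)) v1 (a ∷ a′ ∷ []) refl)
      go : ∀ e e′ s (q : χ (a′ − a) ≡ s) → pr k a e a′ e′ s q ≡ inj₂ b″ → prod k (a , e) b″ ≡ inj₂ (a′ , e′)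
      go false false true q refl = trans (prod≡ k a false third false (trans (cong χ diff) (χ-ν q)))
        (cong (λ z → inj₂ (z , false)) (back q))
      go false true true q ()
      go false true false q ()
      go true false true q ()
      go true false false q ()
      go true true true q refl = trans (prod≡ k a true third true (trans (cong χ diff) (χ-ν q)))
        (cong (λ z → inj₂ (z , true)) (back q))

  filler : A → Filler Lab P
  filler k = record
    { prod = prod k ; act = act k ; prod-idem = prod-idem k ; prod-comm = prod-comm k ; act-invol = act-invol k
    ; prod-act = prod-act k ; act-prod = act-prod k ; prod-prod = prod-prod k }

  -- P is the abelian group A × ℤ/2, and b ⊕ b′ is the third solution of b + b′ + b″ = 0.
  infixl 6 _⊕_
  _⊕_ : P → P → P
  (a , e) ⊕ (a′ , e′) = - (a + a′) , e xor e′

  ⊕-comm : ∀ b b′ → b ⊕ b′ ≡ b′ ⊕ b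
  ⊕-comm (a , e) (a′ , e′) = cong₂ _,_ (cong -_ (+-comm a a′)) (𝔹.xor-comm e e′)

  ⊕-invol : ∀ b b′ → b ⊕ (b ⊕ b′) ≡ b′
  ⊕-invol (a , e) (a′ , e′) = cong₂ _,_ (solve (:- (v0 :+ :- (v0 :+ v1))) v1 (a ∷ a′ ∷ []) refl)
    (trans (sym (𝔹.xor-assoc e e e′)) (cong (_xor e′) (𝔹.xor-same e)))

-- Recognition and rigidity

xor-isAbelianGroup : IsAbelianGroup _≡_ _xor_ false (λ e → e)
xor-isAbelianGroup = record
  { isGroup = record
    { isMonoid = record
      { isSemigroup = record
        { isMagma = record { isEquivalence = isEquivalence ; ∙-cong = cong₂ _xor_ }
        ; assoc = 𝔹.xor-assoc }
      ; identity = 𝔹.xor-identity }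
    ; inverse = 𝔹.xor-same , 𝔹.xor-same
    ; ⁻¹-cong = λ eq → eq }
  ; comm = 𝔹.xor-comm }

NoInjection : Set → Set → Set
NoInjection X Y = ∀ (f : X → Y) → (∀ {x y} → f x ≡ f y → x ≡ y) → ⊥

AtLeast : {X : Set} → Set → (X → Set) → Set
AtLeast {X} T Q = Σ (T → X) λ f → (∀ {s t} → f s ≡ f t → s ≡ t) × (∀ t → Q (f t))

-- For x ≢ y the functions f x, f y, f (x ⋆ y) are affine with a common linear part.
module Isotopy {h : ℕ} (D : DifferenceFamily h) {G : Set} {_+ᴳ_ : G → G → G} {0ᴳ : G} { -ᴳ_ : G → G}
  (isAb : IsAbelianGroup _≡_ _+ᴳ_ 0ᴳ -ᴳ_) where
  open ℤ/ h
  open StandardFiller D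
  module Sol = AbelianSolver isAb

  0ᴾ : P
  0ᴾ = 0# , false

  infixl 6 _⊞_
  _⊞_ : P → P → P
  (a , e) ⊞ (a′ , e′) = a + a′ , e xor e′

  ⊞-⊕ : ∀ b b′ → b ⊕ b′ ≡ (b ⊞ b′) ⊕ 0ᴾ
  ⊞-⊕ (a , e) (a′ , e′) = cong₂ _,_ (solve (:- (v0 :+ v1)) (:- ((v0 :+ v1) :+ :0)) (a ∷ a′ ∷ []) refl)
    (sym (𝔹.xor-identityʳ _))

  0⊞ : ∀ b → 0ᴾ ⊞ b ≡ b
  0⊞ (a , e) = cong (_, e) (solve (:0 :+ v0) v0 (a ∷ []) refl)

  module _ (f g k : P → G) (iso : ∀ b b′ → k (b ⊕ b′) ≡ -ᴳ (f b +ᴳ g b′)) where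

    -- `b ⊕ b′` depends on the sum `b ⊞ b′` alone, so `b′` can be moved from the argument of `g`
    -- into that of `f`.
    shift : ∀ b b′ → f (b ⊞ b′) +ᴳ g 0ᴾ ≡ f b +ᴳ g b′
    shift b b′ = trans (Sol.solve (Sol.v0 Sol.:+ Sol.v1) (Sol.:- Sol.:- (Sol.v0 Sol.:+ Sol.v1)) (_ ∷ _ ∷ []) refl)
      (trans (cong -ᴳ_ (trans (sym (iso _ _)) (trans (cong k (sym (⊞-⊕ b b′))) (iso b b′))))
        (Sol.solve (Sol.:- Sol.:- (Sol.v0 Sol.:+ Sol.v1)) (Sol.v0 Sol.:+ Sol.v1) (_ ∷ _ ∷ []) refl))

    same-linear : ∀ b → g b +ᴳ (-ᴳ g 0ᴾ) ≡ f b +ᴳ (-ᴳ f 0ᴾ)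
    same-linear b = Sol.cancelʳ _ _ (f 0ᴾ +ᴳ g 0ᴾ) (trans
      (Sol.solve ((Sol.v0 Sol.:− Sol.v1) Sol.:+ (Sol.v2 Sol.:+ Sol.v1)) (Sol.v2 Sol.:+ Sol.v0) (g b ∷ g 0ᴾ ∷ f 0ᴾ ∷ []) refl)
      (trans (sym (shift 0ᴾ b)) (trans (cong (λ z → f z +ᴳ g 0ᴾ) (0⊞ b))
        (Sol.solve (Sol.v0 Sol.:+ Sol.v2) ((Sol.v0 Sol.:− Sol.v1) Sol.:+ (Sol.v1 Sol.:+ Sol.v2)) (f b ∷ f 0ᴾ ∷ g 0ᴾ ∷ []) refl))))

    additive : ∀ b b′ → f (b ⊞ b′) +ᴳ (-ᴳ f 0ᴾ) ≡ (f b +ᴳ (-ᴳ f 0ᴾ)) +ᴳ (f b′ +ᴳ (-ᴳ f 0ᴾ))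
    additive b b′ = trans (Sol.solve (Sol.v0 Sol.:− Sol.v1) ((Sol.v0 Sol.:+ Sol.v2) Sol.:+ (Sol.:- Sol.v1 Sol.:− Sol.v2)) (f (b ⊞ b′) ∷ f 0ᴾ ∷ g 0ᴾ ∷ []) refl)
      (trans (cong (_+ᴳ ((-ᴳ f 0ᴾ) +ᴳ (-ᴳ g 0ᴾ))) (shift b b′))
      (trans (Sol.solve ((Sol.v0 Sol.:+ Sol.v1) Sol.:+ (Sol.:- Sol.v2 Sol.:− Sol.v3)) ((Sol.v0 Sol.:− Sol.v2) Sol.:+ (Sol.v1 Sol.:− Sol.v3)) (f b ∷ g b′ ∷ f 0ᴾ ∷ g 0ᴾ ∷ []) refl)
        (cong ((f b +ᴳ (-ᴳ f 0ᴾ)) +ᴳ_) (same-linear b′))))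

module Recognition {h : ℕ} (D : DifferenceFamily h) {w′ : ℕ} (W : Squag (Fin (suc w′)))
  (F : Squag (StandardFiller.Lab D)) (κ : Fin (suc w′) → ℤ/.A h) where

  open ℤ/ h
  open DifferenceFamily D
  open StandardFiller D
  open Extension F W _⊕_ ⊕-comm ⊕-invol (filler ∘ κ) public
  open Squag W using () renaming (_∙_ to _⋆_; cancelˡ to ⋆-cancelˡ)

  private
    w : ℕ
    w = suc w′

  -- In the nondegenerate case the blocks through `p q`, `p r`, `q r` and through `p ∙ q`, `p ∙ r`
  -- form a quadrilateral (Pasch configuration). Degenerate `r` are not excluded; the counts below
  -- absorb them.
  Link : U → U → U → Set
  Link p q r = (p ∙ q) ∙ (p ∙ r) ≡ q ∙ r

  Rich : U → U → Set
  Rich p q = AtLeast (Fin w′ × A) (Link p q)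

  -- Every line through inj₁ (inj₂ d) that leaves Lab is linked to many lines through it; this fails for the points outside Lab.
  Special : U → Set
  Special p = AtLeast (Fin w × P) (Rich p)

  -- The label shifts the two levels by `el d` in opposite directions, so the shifts cancel in the
  -- product of points from opposite levels. The witnesses for `Rich` are all points of the opposite
  -- level in the other groups.
  special-cross : ∀ d → Special (inj₁ (inj₂ d))
  special-cross d = inj₂ , inj₂-injective , rich
    where
    link : ∀ x y → x ≢ y → ∀ a b e → Link (inj₁ (inj₂ d)) (inj₂ (x , (a , e))) (inj₂ (y , (b , not e)))
    link x y x≢y a b false = trans (∙-diff x≢y _ _) (trans
      (cong (λ z → inj₂ (x ⋆ y , (z , true)))
        (solve (:- ((v0 :+ v2) :+ (v1 :− v2))) (:- (v0 :+ v1)) (a ∷ b ∷ el d ∷ []) refl)) (sym (∙-diff x≢y _ _)))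
    link x y x≢y a b true = trans (∙-diff x≢y _ _) (trans
      (cong (λ z → inj₂ (x ⋆ y , (z , true)))
        (solve (:- ((v0 :− v2) :+ (v1 :+ v2))) (:- (v0 :+ v1)) (a ∷ b ∷ el d ∷ []) refl)) (sym (∙-diff x≢y _ _)))
    rich : ∀ t → Rich (inj₁ (inj₂ d)) (inj₂ t)
    rich (x , (a , e)) = (λ (j , b) → inj₂ (punchIn x j , (b , not e)))
      , (λ eq → cong₂ _,_ (punchIn-injective x _ _ (,-injectiveˡ (inj₂-injective eq)))
                           (,-injectiveˡ (,-injectiveʳ (inj₂-injective eq))))
      , λ (j , b) → link x (punchIn x j) (punchInᵢ≢i x j ∘ sym) a b e

  -- Comparing first coordinates gives 2 (a + b + b′) = 0, and p is odd. Hence each third group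
  -- contains at most one linked point per level.
  link-determined : ∀ {x y y′} → x ≢ y → y′ ≢ x → y′ ≢ y → ∀ {a e b s b′ s′} →
    Link (inj₂ (x , (a , e))) (inj₂ (y , (b , s))) (inj₂ (y′ , (b′ , s′))) → b′ ≡ - (a + b)
  link-determined {x} {y} {y′} x≢y y′≢x y′≢y {a} {e} {b} {s} {b′} {s′} link = −-zero (double-zero _ (trans
    (solve ((v2 :− :- (v0 :+ v1)) :+ (v2 :− :- (v0 :+ v1))) ((:- (:- (v0 :+ v1) :+ :- (v0 :+ v2))) :+ (v1 :+ v2))
      (a ∷ b ∷ b′ ∷ []) refl)
    (trans (cong (_+ (b + b′)) eq) (solve ((:- (v0 :+ v1)) :+ (v0 :+ v1)) :0 (b ∷ b′ ∷ []) refl))))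
    where
    eq : - (- (a + b) + - (a + b′)) ≡ - (b + b′)
    eq = ,-injectiveˡ (,-injectiveʳ (inj₂-injective (begin
      inj₂ ((x ⋆ y) ⋆ (x ⋆ y′) , ((a , e) ⊕ (b , s)) ⊕ ((a , e) ⊕ (b′ , s′)))
        ≡⟨ sym (∙-diff (λ z → y′≢y (sym (⋆-cancelˡ x z))) _ _) ⟩
      inj₂ (x ⋆ y , (a , e) ⊕ (b , s)) ∙ inj₂ (x ⋆ y′ , (a , e) ⊕ (b′ , s′))
        ≡⟨ cong₂ _∙_ (sym (∙-diff x≢y _ _)) (sym (∙-diff (y′≢x ∘ sym) _ _)) ⟩
      (inj₂ (x , (a , e)) ∙ inj₂ (y , (b , s))) ∙ (inj₂ (x , (a , e)) ∙ inj₂ (y′ , (b′ , s′)))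
        ≡⟨ link ⟩
      inj₂ (y , (b , s)) ∙ inj₂ (y′ , (b′ , s′))
        ≡⟨ ∙-diff (y′≢y ∘ sym) _ _ ⟩
      inj₂ (y ⋆ y′ , (b , s) ⊕ (b′ , s′)) ∎)))
      where open ≡-Reasoning

  -- An upper bound for the points linked to a transversal pair: all of `Lab`, the two groups of the
  -- pair, and one point for each group and level.
  Code : Set
  Code = Lab ⊎ ((P ⊎ P) ⊎ (Fin w × Bool))

  module _ (small-code : NoInjection (Fin w′ × A) Code) where

    ¬rich-transversal : ∀ {x y} → x ≢ y → ∀ {b b′} → ¬ Rich (inj₂ (x , b)) (inj₂ (y , b′))
    ¬rich-transversal {x} {y} x≢y {a , e} {b , s} (f , f-inj , f-link) =
      small-code (λ t → code (f t)) (λ {t} {t′} eq → f-inj (code-inj (f t) (f t′) (f-link t) (f-link t′) eq))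
      where
      code-at : ∀ z → P → Dec (z ≡ x) → Dec (z ≡ y) → Code
      code-at z b (yes _) _ = inj₂ (inj₁ (inj₁ b))
      code-at z b (no _) (yes _) = inj₂ (inj₁ (inj₂ b))
      code-at z (_ , s) (no _) (no _) = inj₂ (inj₂ (z , s))
      code : U → Code
      code (inj₁ l) = inj₁ l
      code (inj₂ (z , b)) = code-at z b (z F.≟ x) (z F.≟ y)
      LinkXY : U → Set
      LinkXY = Link (inj₂ (x , (a , e))) (inj₂ (y , (b , s)))
      code-at-lab : ∀ {l z b} d d′ → inj₁ l ≢ code-at z b d d′
      code-at-lab (yes _) _ ()
      code-at-lab (no _) (yes _) ()
      code-at-lab (no _) (no _) ()
      code-at-inj : ∀ z b z′ b′ d₁ d₂ d₃ d₄ → LinkXY (inj₂ (z , b)) → LinkXY (inj₂ (z′ , b′)) →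
        code-at z b d₁ d₂ ≡ code-at z′ b′ d₃ d₄ → (z , b) ≡ (z′ , b′)
      code-at-inj z b z′ b′ (yes refl) _ (yes refl) _ _ _ refl = refl
      code-at-inj z b z′ b′ (no _) (yes refl) (no _) (yes refl) _ _ refl = refl
      code-at-inj z b z′ b′ (yes _) _ (no _) (yes _) _ _ ()
      code-at-inj z b z′ b′ (yes _) _ (no _) (no _) _ _ ()
      code-at-inj z b z′ b′ (no _) (yes _) (yes _) _ _ _ ()
      code-at-inj z b z′ b′ (no _) (no _) (yes _) _ _ _ ()
      code-at-inj z b z′ b′ (no _) (yes _) (no _) (no _) _ _ ()
      code-at-inj z b z′ b′ (no _) (no _) (no _) (yes _) _ _ ()
      code-at-inj z (b₁ , s₁) z′ (b₂ , s₂) (no z≢x) (no z≢y) (no _) (no _) l₁ l₂ refl =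
        cong (λ b → z , (b , s₁)) (trans (link-determined x≢y z≢x z≢y l₁) (sym (link-determined x≢y z≢x z≢y l₂)))
      code-inj : ∀ r r′ → LinkXY r → LinkXY r′ → code r ≡ code r′ → r ≡ r′
      code-inj (inj₁ l) (inj₁ l′) _ _ eq = cong inj₁ (inj₁-injective eq)
      code-inj (inj₁ l) (inj₂ (z , b)) _ _ eq = ⊥-elim (code-at-lab (z F.≟ x) (z F.≟ y) eq)
      code-inj (inj₂ (z , b)) (inj₁ l) _ _ eq = ⊥-elim (code-at-lab (z F.≟ x) (z F.≟ y) (sym eq))
      code-inj (inj₂ (z , b)) (inj₂ (z′ , b′)) l₁ l₂ eq =
        cong inj₂ (code-at-inj z b z′ b′ (z F.≟ x) (z F.≟ y) (z′ F.≟ x) (z′ F.≟ y) l₁ l₂ eq)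

    -- Rich partners of a point outside `Lab` lie in `Lab` or in its own group, which is fewer
    -- points than the |W| · |P| that `Special` demands.
    ¬special-transversal : NoInjection (Fin w × P) (Lab ⊎ P) → ∀ {x b} → ¬ Special (inj₂ (x , b))
    ¬special-transversal small-group {x} {b} (f , f-inj , f-rich) =
      small-group (λ t → code (f t)) (λ {t} {t′} eq → f-inj (code-inj (f t) (f t′) (f-rich t) (f-rich t′) eq))
      where
      code : U → Lab ⊎ P
      code (inj₁ l) = inj₁ l
      code (inj₂ (_ , b)) = inj₂ b
      in-group : ∀ {y b′} → Rich (inj₂ (x , b)) (inj₂ (y , b′)) → x ≡ y
      in-group {y} {b′} rich = case x F.≟ y of λ where
        (yes x≡y) → x≡y
        (no x≢y) → ⊥-elim (¬rich-transversal x≢y {b} {b′} rich)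
      code-inj : ∀ q q′ → Rich (inj₂ (x , b)) q → Rich (inj₂ (x , b)) q′ → code q ≡ code q′ → q ≡ q′
      code-inj (inj₁ l) (inj₁ l′) _ _ refl = refl
      code-inj (inj₂ (y , c)) (inj₂ (y′ , c′)) r r′ refl = cong (λ z → inj₂ (z , c)) (trans (sym (in-group r)) (in-group r′))

-- Automorphisms of the extension

module Rigidity {h : ℕ} (D : DifferenceFamily h) {w′ : ℕ} (W : Squag (Fin (suc w′)))
  (F : Squag (StandardFiller.Lab D)) {m : ℕ} (num : Fin m → ℕ) (col : Fin (suc w′) → Fin m) where

  open ℤ/ h
  open DifferenceFamily D
  open StandardFiller D

  κ : Fin (suc w′) → A
  κ x = [ num (col x) ]

  open Recognition D W F κ public
  open Squag W using () renaming (_∙_ to _⋆_; idem to ⋆-idem; ∙≡ʳ to ⋆≡ʳ)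

  -- Collects what rigidity asks of the parameters, so that the argument is independent of how p, D,
  -- W and the colours are chosen. `d₀` and `d₁` are consecutive because the two cross factors then
  -- generate all translations of a level.
  record Generic : Set where
    field
      small-code  : NoInjection (Fin w′ × A) Code
      small-group : NoInjection (Fin (suc w′) × P) (Lab ⊎ P)
      small-lab   : NoInjection P Lab
      d₀ d₁ : Δ
      d₁≡   : el d₁ ≡ el d₀ + 1#
      x₀ x₁ x₃ : Fin (suc w′)
      num-x₀ : num (col x₀) ≡ 0
      num-x₁ : num (col x₁) ≡ 1
      num-x₃ : num (col x₃) ≡ 3
      num-bound : ∀ i → num i ℕ.+ (num i ℕ.+ num i) < p
      num-injective : ∀ {i j} → num i ≡ num j → i ≡ j
      -- The only affine maps of A taking 0, 1, 3 to colours are the constant ones and the identity.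
      num-rigid : ∀ a b c → num c ℕ.+ (num a ℕ.+ num a) ≡ num b ℕ.+ (num b ℕ.+ num b) →
                  a ≡ b ⊎ (num a ≡ 0 × num b ≡ 1)
      no-affine : ∀ (v : Fin (suc w′) → A) → (∀ x y → x ≢ y → v (x ⋆ y) ≡ - (v x + v y)) → ∀ x → v x ≡ 0#

  module Induced (G : Generic) (σ : U → U) (hom : ∀ s t → σ (s ∙ t) ≡ σ s ∙ σ t)
    (σ-injective : ∀ {s t} → σ s ≡ σ t → s ≡ t) where

    open Generic G

    special-image : ∀ {q} → Special q → Special (σ q)
    special-image {q} (f , f-inj , f-rich) = (σ ∘ f) , (f-inj ∘ σ-injective) , λ t → rich (f-rich t)
      where
      rich : ∀ {r} → Rich q r → Rich (σ q) (σ r)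
      rich {r} (g , g-inj , g-link) = (σ ∘ g) , (g-inj ∘ σ-injective) , λ t → begin
        (σ q ∙ σ r) ∙ (σ q ∙ σ (g t)) ≡⟨ sym (cong₂ _∙_ (hom q r) (hom q (g t))) ⟩
        σ (q ∙ r) ∙ σ (q ∙ g t) ≡⟨ sym (hom _ _) ⟩
        σ ((q ∙ r) ∙ (q ∙ g t)) ≡⟨ cong σ (g-link t) ⟩
        σ (r ∙ g t) ≡⟨ hom _ _ ⟩
        σ r ∙ σ (g t) ∎
        where open ≡-Reasoning

    IsLab : U → Set
    IsLab s = ∃ λ l → s ≡ inj₁ l

    cross-to-lab : ∀ d → IsLab (σ (inj₁ (inj₂ d)))
    cross-to-lab d = go (σ (inj₁ (inj₂ d))) refl
      where
      go : ∀ s → σ (inj₁ (inj₂ d)) ≡ s → IsLab s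
      go (inj₁ l) eq = l , refl
      go (inj₂ (x , b)) eq = ⊥-elim (¬special-transversal small-code small-group {x} {b}
        (subst Special eq (special-image (special-cross d))))

    -- Going up along `d₁` and down along `d₀` translates a level by `1#`, so cross factors alone
    -- connect the whole group.
    connected : (Q : P → Set) → (∀ d b → Q b → Q (act 0# (inj₂ d) b)) → ∀ b b′ → Q b → Q b′
    connected Q step b b′ q = up b′ (at-false b q)
      where
      translate : ∀ c a → Q (a , false) → Q (a + c , false)
      translate = cyclic-induction _ (λ a → subst (λ z → Q (z , false)) (solve v0 (v0 :+ :0) (a ∷ []) refl))
        λ c ih a qa → subst (λ z → Q (z , false))
          (trans (cong (λ z → a + c + z − el d₀) d₁≡) (solve (((v0 :+ v1) :+ (v2 :+ v3)) :− v2) (v0 :+ (v1 :+ v3)) (a ∷ c ∷ el d₀ ∷ 1# ∷ []) refl))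
          (step d₀ _ (step d₁ _ (ih a qa)))
      at-false : ∀ b → Q b → Q (0# , false)
      at-false (a , false) qa = subst (λ z → Q (z , false)) (solve (v0 :+ (:- v0)) :0 (a ∷ []) refl) (translate (- a) a qa)
      at-false (a , true) qa = at-false (a − el d₀ , false) (step d₀ _ qa)
      up : ∀ b → Q (0# , false) → Q b
      up (a , false) q0 = subst (λ z → Q (z , false)) (solve (:0 :+ v0) v0 (a ∷ []) refl) (translate a 0# q0)
      up (a , true) q0 = subst (λ z → Q (z , true)) (solve ((v0 :− v1) :+ v1) v0 (a ∷ el d₀ ∷ []) refl)
        (step d₀ _ (up (a − el d₀ , false) q0))

    act-cross : ∀ k d b → act k (inj₂ d) b ≡ act 0# (inj₂ d) b
    act-cross k d (a , false) = refl
    act-cross k d (a , true) = refl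

    σ-cross : ∀ x d b → σ (inj₂ (x , act 0# (inj₂ d) b)) ≡ σ (inj₁ (inj₂ d)) ∙ σ (inj₂ (x , b))
    σ-cross x d b = trans (cong (λ z → σ (inj₂ (x , z))) (sym (act-cross (κ x) d b))) (hom (inj₁ (inj₂ d)) (inj₂ (x , b)))

    -- The images of cross labels lie in `Lab`, which is closed under the product; so one point of
    -- the group landing in `Lab` would drag all of `P` into it, and `P` is larger.
    group-not-lab : ∀ x b → ¬ IsLab (σ (inj₂ (x , b)))
    group-not-lab x b lab = small-lab (λ b′ → proj₁ (all b′))
      λ {b₁} {b₂} eq → ,-injectiveʳ (inj₂-injective (σ-injective
        (trans (proj₂ (all b₁)) (trans (cong inj₁ eq) (sym (proj₂ (all b₂)))))))
      where
      all : ∀ b′ → IsLab (σ (inj₂ (x , b′)))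
      all b′ = connected (λ b → IsLab (σ (inj₂ (x , b))))
        (λ d b (l , eq) → let (l′ , eq′) = cross-to-lab d in
          _ , trans (σ-cross x d b) (cong₂ _∙_ eq′ eq)) b b′ lab

    σ-group : ∀ x b → ∃ λ yb → σ (inj₂ (x , b)) ≡ inj₂ yb
    σ-group x b = go (σ (inj₂ (x , b))) refl
      where
      go : ∀ s → σ (inj₂ (x , b)) ≡ s → ∃ λ yb → s ≡ inj₂ yb
      go (inj₁ l) eq = ⊥-elim (group-not-lab x b (l , eq))
      go (inj₂ yb) eq = yb , refl

    π : Fin (suc w′) → Fin (suc w′)
    π x = proj₁ (proj₁ (σ-group x (0# , false)))

    β : Fin (suc w′) → P → P
    β x b = proj₂ (proj₁ (σ-group x b))

    σ≡ : ∀ x b → σ (inj₂ (x , b)) ≡ inj₂ (π x , β x b)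
    σ≡ x b = trans (proj₂ (σ-group x b)) (cong (λ y → inj₂ (y , β x b)) (same b))
      where
      same : ∀ b → proj₁ (proj₁ (σ-group x b)) ≡ π x
      same b = connected (λ b → proj₁ (proj₁ (σ-group x b)) ≡ π x) step (0# , false) b refl
        where
        step : ∀ d b → proj₁ (proj₁ (σ-group x b)) ≡ π x → proj₁ (proj₁ (σ-group x (act 0# (inj₂ d) b))) ≡ π x
        step d b eq = trans (,-injectiveˡ (inj₂-injective (trans (sym (proj₂ (σ-group x (act 0# (inj₂ d) b))))
          (trans (σ-cross x d b) (cong₂ _∙_ (proj₂ (cross-to-lab d)) (proj₂ (σ-group x b))))))) eq

  module Automorphism (G : Generic) (σ σ⁻¹ : U → U) (hom : ∀ s t → σ (s ∙ t) ≡ σ s ∙ σ t)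
    (σσ⁻¹ : ∀ s → σ (σ⁻¹ s) ≡ s) (σ⁻¹σ : ∀ s → σ⁻¹ (σ s) ≡ s) where

    open Generic G

    σ-injective : ∀ {s t} → σ s ≡ σ t → s ≡ t
    σ-injective {s} {t} eq = trans (sym (σ⁻¹σ s)) (trans (cong σ⁻¹ eq) (σ⁻¹σ t))

    σ⁻¹-injective : ∀ {s t} → σ⁻¹ s ≡ σ⁻¹ t → s ≡ t
    σ⁻¹-injective {s} {t} eq = trans (sym (σσ⁻¹ s)) (trans (cong σ eq) (σσ⁻¹ t))

    hom⁻¹ : ∀ s t → σ⁻¹ (s ∙ t) ≡ σ⁻¹ s ∙ σ⁻¹ t
    hom⁻¹ s t = σ-injective (trans (σσ⁻¹ _) (trans (cong₂ _∙_ (sym (σσ⁻¹ s)) (sym (σσ⁻¹ t))) (sym (hom _ _))))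

    open Induced G σ hom σ-injective public
    private module Inv = Induced G σ⁻¹ hom⁻¹ σ⁻¹-injective

    π-injective : ∀ {x y} → π x ≡ π y → x ≡ y
    π-injective {x} {y} eq = trans (sym (back x)) (trans (cong Inv.π eq) (back y))
      where
      back : ∀ x → Inv.π (π x) ≡ x
      back x = ,-injectiveˡ (inj₂-injective (trans (sym (Inv.σ≡ (π x) (β x (0# , false))))
        (trans (cong σ⁻¹ (sym (σ≡ x (0# , false)))) (σ⁻¹σ _))))

    β-injective : ∀ x {b b′} → β x b ≡ β x b′ → b ≡ b′
    β-injective x {b} {b′} eq = ,-injectiveʳ (inj₂-injective (σ-injective
      (trans (σ≡ x b) (trans (cong (λ z → inj₂ (π x , z)) eq) (sym (σ≡ x b′))))))

    x₀≢x₁ : x₀ ≢ x₁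
    x₀≢x₁ eq with trans (sym num-x₀) (trans (cong (num ∘ col) eq) num-x₁)
    ... | ()

    -- Counting recognised only the cross labels; this covers the reflections as well. A label acts
    -- inside every group, so an image in the group `z` would force `π x ≡ z` for all `x`, against
    -- the injectivity of `π`.
    lab-to-lab : ∀ l → IsLab (σ (inj₁ l))
    lab-to-lab l = go (σ (inj₁ l)) refl
      where
      go : ∀ s → σ (inj₁ l) ≡ s → IsLab s
      go (inj₁ l′) eq = l′ , refl
      go (inj₂ (z , b)) eq = ⊥-elim (x₀≢x₁ (π-injective (trans (sym (index x₀)) (index x₁))))
        where
        index : ∀ x → z ≡ π x
        index x = case z F.≟ π x of λ where
          (yes z≡) → z≡
          (no z≢) → ⊥-elim (z≢ (⋆≡ʳ (,-injectiveˡ (inj₂-injective (trans (sym (∙-diff z≢ b (β x (0# , false))))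
            (trans (cong₂ _∙_ (sym eq) (sym (σ≡ x (0# , false)))) (trans (sym (hom (inj₁ l) (inj₂ (x , (0# , false)))))
              (σ≡ x _))))))))

    τ : Lab → Lab
    τ l = proj₁ (lab-to-lab l)

    τ≡ : ∀ l → σ (inj₁ l) ≡ inj₁ (τ l)
    τ≡ l = proj₂ (lab-to-lab l)

    π-β-hom : ∀ {x y} → x ≢ y → ∀ b b′ → (π (x ⋆ y) , β (x ⋆ y) (b ⊕ b′)) ≡ (π x ⋆ π y , β x b ⊕ β y b′)
    π-β-hom {x} {y} x≢y b b′ = inj₂-injective (begin
      inj₂ (π (x ⋆ y) , β (x ⋆ y) (b ⊕ b′)) ≡⟨ sym (σ≡ _ _) ⟩
      σ (inj₂ (x ⋆ y , b ⊕ b′)) ≡⟨ cong σ (sym (∙-diff x≢y b b′)) ⟩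
      σ (inj₂ (x , b) ∙ inj₂ (y , b′)) ≡⟨ hom _ _ ⟩
      σ (inj₂ (x , b)) ∙ σ (inj₂ (y , b′)) ≡⟨ cong₂ _∙_ (σ≡ x b) (σ≡ y b′) ⟩
      inj₂ (π x , β x b) ∙ inj₂ (π y , β y b′) ≡⟨ ∙-diff (x≢y ∘ π-injective) _ _ ⟩
      inj₂ (π x ⋆ π y , β x b ⊕ β y b′) ∎)
      where open ≡-Reasoning

    π-hom : ∀ x y → π (x ⋆ y) ≡ π x ⋆ π y
    π-hom x y = case x F.≟ y of λ where
      (yes refl) → trans (cong π (⋆-idem x)) (sym (⋆-idem (π x)))
      (no x≢y) → ,-injectiveˡ (π-β-hom x≢y (0# , false) (0# , false))

    private
      module Isoᴬ = Isotopy D isAbelianGroup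
      module Isoᴮ = Isotopy D xor-isAbelianGroup
    open Isoᴬ using (_⊞_; 0ᴾ)

    α : Fin (suc w′) → P → A
    α x b = proj₁ (β x b)

    lev : Fin (suc w′) → P → Bool
    lev x b = proj₂ (β x b)

    isoᴬ : ∀ {x y} → x ≢ y → ∀ b b′ → α (x ⋆ y) (b ⊕ b′) ≡ - (α x b + α y b′)
    isoᴬ x≢y b b′ = cong proj₁ (,-injectiveʳ (π-β-hom x≢y b b′))

    isoᴮ : ∀ {x y} → x ≢ y → ∀ b b′ → lev (x ⋆ y) (b ⊕ b′) ≡ lev x b xor lev y b′
    isoᴮ x≢y b b′ = cong proj₂ (,-injectiveʳ (π-β-hom x≢y b b′))

    -- `θᴬ` and `θᴮ` are the coordinates of the linear part shared by all `β x`, read off in the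
    -- group of `x₀`.
    θᴬ : P → A
    θᴬ b = α x₀ b − α x₀ 0ᴾ

    θᴮ : P → Bool
    θᴮ b = lev x₀ b xor lev x₀ 0ᴾ

    α-affine : ∀ x b → α x b ≡ θᴬ b + α x 0ᴾ
    α-affine x b = case x₀ F.≟ x of λ where
      (yes refl) → solve v0 ((v0 :− v1) :+ v1) (α x b ∷ α x 0ᴾ ∷ []) refl
      (no x₀≢x) → trans (solve v0 ((v0 :− v1) :+ v1) (α x b ∷ α x 0ᴾ ∷ []) refl)
        (cong (_+ α x 0ᴾ) (Isoᴬ.same-linear (α x₀) (α x) (α (x₀ ⋆ x)) (isoᴬ x₀≢x) b))

    lev-affine : ∀ x b → lev x b ≡ θᴮ b xor lev x 0ᴾ
    lev-affine x b = case x₀ F.≟ x of λ where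
        (yes refl) → undo (lev x b) (lev x 0ᴾ)
        (no x₀≢x) → trans (undo (lev x b) (lev x 0ᴾ))
          (cong (_xor lev x 0ᴾ) (Isoᴮ.same-linear (lev x₀) (lev x) (lev (x₀ ⋆ x)) (isoᴮ x₀≢x) b))
      where
      undo : ∀ e s → e ≡ (e xor s) xor s
      undo e s = sym (trans (𝔹.xor-assoc e s s) (trans (cong (e xor_) (𝔹.xor-same s)) (𝔹.xor-identityʳ e)))

    θᴬ-⊞ : ∀ b b′ → θᴬ (b ⊞ b′) ≡ θᴬ b + θᴬ b′
    θᴬ-⊞ = Isoᴬ.additive (α x₀) (α x₁) (α (x₀ ⋆ x₁)) (isoᴬ x₀≢x₁)

    θᴮ-⊞ : ∀ b b′ → θᴮ (b ⊞ b′) ≡ θᴮ b xor θᴮ b′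
    θᴮ-⊞ = Isoᴮ.additive (lev x₀) (lev x₁) (lev (x₀ ⋆ x₁)) (isoᴮ x₀≢x₁)

    θ : A → A
    θ a = θᴬ (a , false)

    θ-+ : ∀ a a′ → θ (a + a′) ≡ θ a + θ a′
    θ-+ a a′ = θᴬ-⊞ (a , false) (a′ , false)

    0+0 : 0# + 0# ≡ 0#
    0+0 = solve (:0 :+ :0) :0 [] refl

    +0 : ∀ a → a + 0# ≡ a
    +0 a = solve (v0 :+ :0) v0 (a ∷ []) refl

    θ-0 : θ 0# ≡ 0#
    θ-0 = solve (v0 :− v0) :0 (α x₀ 0ᴾ ∷ []) refl

    -- An element of order 2 maps to 0 in a group of odd order. In the other direction, `θᴮ-bottom`
    -- writes its argument as a double. So the linear part respects the decomposition of `P`.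
    θᴬ-top : θᴬ (0# , true) ≡ 0#
    θᴬ-top = double-zero _ (trans (sym (θᴬ-⊞ (0# , true) (0# , true))) (trans (cong θ 0+0) θ-0))

    θᴬ≡ : ∀ a e → θᴬ (a , e) ≡ θ a
    θᴬ≡ a false = refl
    θᴬ≡ a true = trans (cong (λ z → θᴬ (z , true)) (sym (+0 a)))
      (trans (θᴬ-⊞ (a , false) (0# , true)) (trans (cong (θ a +_) θᴬ-top) (+0 (θ a))))

    θᴮ-bottom : ∀ a → θᴮ (a , false) ≡ false
    θᴮ-bottom a = trans (cong (λ z → θᴮ (z , false)) (sym (half+half a)))
      (trans (θᴮ-⊞ (half a , false) (half a , false)) (𝔹.xor-same (θᴮ (half a , false))))

    θᴮ-top : θᴮ (0# , true) ≡ true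
    θᴮ-top = go (θᴮ (0# , true)) refl
      where
      go : ∀ s → θᴮ (0# , true) ≡ s → s ≡ true
      go true _ = refl
      go false eq = case ,-injectiveʳ (β-injective x₀ {0# , true} {0# , false} (cong₂ _,_
        (trans (α-affine x₀ (0# , true)) (trans (cong (_+ α x₀ 0ᴾ) θᴬ-top) (solve (:0 :+ v0) v0 (α x₀ 0ᴾ ∷ []) refl)))
        (trans (lev-affine x₀ (0# , true)) (cong (_xor lev x₀ 0ᴾ) eq)))) of λ ()

    θᴮ≡ : ∀ a e → θᴮ (a , e) ≡ e
    θᴮ≡ a false = θᴮ-bottom a
    θᴮ≡ a true = trans (cong (λ z → θᴮ (z , true)) (sym (+0 a)))
      (trans (θᴮ-⊞ (a , false) (0# , true)) (cong₂ _xor_ (θᴮ-bottom a) θᴮ-top))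

    v : Fin (suc w′) → A
    v x = α x 0ᴾ

    -- The level component of the translation. Unlike `v` it cannot be removed by W: in the W used
    -- later, a coordinate functional on the extra vectors satisfies `η-⋆` too. The fillings have to
    -- exclude it.
    η : Fin (suc w′) → Bool
    η x = lev x 0ᴾ

    0⊕0 : 0ᴾ ⊕ 0ᴾ ≡ 0ᴾ
    0⊕0 = cong (_, false) (solve (:- (:0 :+ :0)) :0 [] refl)

    v≡0 : ∀ x → v x ≡ 0#
    v≡0 = no-affine v λ x y x≢y → trans (cong (α (x ⋆ y)) (sym 0⊕0)) (isoᴬ x≢y 0ᴾ 0ᴾ)

    η-⋆ : ∀ {x y} → x ≢ y → η (x ⋆ y) ≡ η x xor η y
    η-⋆ {x} {y} x≢y = trans (cong (lev (x ⋆ y)) (sym 0⊕0)) (isoᴮ x≢y 0ᴾ 0ᴾ)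

    β-affine : ∀ x a e → β x (a , e) ≡ (θ a , e xor η x)
    β-affine x a e = cong₂ _,_
      (trans (α-affine x (a , e)) (trans (cong₂ _+_ (θᴬ≡ a e) (v≡0 x)) (+0 (θ a))))
      (trans (lev-affine x (a , e)) (cong (_xor η x) (θᴮ≡ a e)))

    θ-injective : ∀ {a a′} → θ a ≡ θ a′ → a ≡ a′
    θ-injective {a} {a′} eq = ,-injectiveˡ (β-injective x₀ (trans (β-affine x₀ a false)
      (trans (cong (_, η x₀) eq) (sym (β-affine x₀ a′ false)))))

    1≢0 : 1# ≢ 0#
    1≢0 eq = case []-injective {1} {0} (ℕₚ.<-trans (s≤s (s≤s z≤n)) 3<p) (s≤s z≤n) eq of λ ()
      where
      3<p : 3 < p
      3<p = subst (λ n → n ℕ.+ (n ℕ.+ n) < p) num-x₁ (num-bound (col x₁))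

    σ-prod : ∀ x b b′ {l} → prod (κ x) b b′ ≡ inj₁ l → prod (κ (π x)) (β x b) (β x b′) ≡ inj₁ (τ l)
    σ-prod x b b′ {l} eq = place-lab (begin
      place (π x) (prod (κ (π x)) (β x b) (β x b′)) ≡⟨ sym (∙-same (π x) (β x b) (β x b′)) ⟩
      inj₂ (π x , β x b) ∙ inj₂ (π x , β x b′) ≡⟨ sym (cong₂ _∙_ (σ≡ x b) (σ≡ x b′)) ⟩
      σ (inj₂ (x , b)) ∙ σ (inj₂ (x , b′)) ≡⟨ sym (hom _ _) ⟩
      σ (inj₂ (x , b) ∙ inj₂ (x , b′)) ≡⟨ cong σ (trans (∙-same x b b′) (cong (place x) eq)) ⟩
      σ (inj₁ l) ≡⟨ τ≡ l ⟩
      inj₁ (τ l) ∎)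
      where
      open ≡-Reasoning
      place-lab : ∀ {y r m} → place y r ≡ inj₁ m → r ≡ inj₁ m
      place-lab {r = inj₁ _} refl = refl

    pr-cross-true : ∀ k a e a′ q → pr k a e a′ (not e) true q ≡ inj₁ (inj₁ (half (a + a′) − k))
    pr-cross-true k a false a′ q = refl
    pr-cross-true k a true a′ q = refl

    τ-cross : ∀ x a → prod (κ (π x)) (θ a , η x) (θ a + θ (el d₀) , not (η x)) ≡ inj₁ (τ (inj₂ d₀))
    τ-cross x a = trans (cong₂ (prod (κ (π x))) (sym (β-affine x a false))
      (trans (cong (_, not (η x)) (sym (θ-+ a (el d₀)))) (sym (β-affine x (a + el d₀) true))))
      (σ-prod x (a , false) (a + el d₀ , true) (prod-cross))
      where
      prod-cross : prod (κ x) (a , false) (a + el d₀ , true) ≡ inj₁ (inj₂ d₀)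
      prod-cross = Filler.prod-act (filler (κ x)) (inj₂ d₀) (a , false)

    +−ˡ : ∀ a d → a + d − a ≡ d
    +−ˡ a d = solve ((v0 :+ v1) :− v0) v1 (a ∷ d ∷ []) refl

    -- Otherwise the edges from `a` to `a + el d₀` between the levels, which all carry one label,
    -- would go to edges labelled by their midpoints, and these vary with `a`.
    χ-θ : χ (θ (el d₀)) ≡ false
    χ-θ = go (χ (θ (el d₀))) refl
      where
      go : ∀ s → χ (θ (el d₀)) ≡ s → s ≡ false
      go false _ = refl
      go true q = ⊥-elim (1≢0 (θ-injective (double-injective (cancelʳ _ _ (θ (el d₀)) (trans (rearrange (θ 1#))
        (trans (trans (sym (half+half _)) (trans (cong (λ z → z + z) (cancelʳ _ _ (- κ (π x₀)) (inj₁-injective (inj₁-injective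
          (trans (sym (mid 1#)) (mid 0#)))))) (half+half _))) (sym (rearrange (θ 0#)))))))))
        where
        rearrange : ∀ z → z + z + θ (el d₀) ≡ z + (z + θ (el d₀))
        rearrange z = solve ((v0 :+ v0) :+ v1) (v0 :+ (v0 :+ v1)) (z ∷ θ (el d₀) ∷ []) refl
        mid : ∀ a → inj₁ (τ (inj₂ d₀)) ≡ inj₁ (inj₁ (half (θ a + (θ a + θ (el d₀))) − κ (π x₀)))
        mid a = trans (sym (τ-cross x₀ a)) (trans (prod≡ _ _ _ _ _ q′) (pr-cross-true _ _ _ _ q′))
          where
          q′ : χ (θ a + θ (el d₀) − θ a) ≡ true
          q′ = trans (cong χ (+−ˡ (θ a) (θ (el d₀)))) q

    -- A cross label records the difference from bottom to top, so exchanging the levels negates it.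
    -- As `τ (inj₂ d₀)` does not depend on `x` and a nonzero residue is not its own negative, the
    -- levels are exchanged in all groups or in none.
    crossing-label : ∀ x → ∃ λ d → τ (inj₂ d₀) ≡ inj₂ d × el d ≡ (if η x then - θ (el d₀) else θ (el d₀))
    crossing-label x = go (η x) refl
      where
      q : χ (θ 0# + θ (el d₀) − θ 0#) ≡ false
      q = trans (cong χ (+−ˡ (θ 0#) (θ (el d₀)))) χ-θ
      at : ∀ e → η x ≡ e → pr (κ (π x)) (θ 0#) e (θ 0# + θ (el d₀)) (not e) false q ≡ inj₁ (τ (inj₂ d₀))
      at e eq = trans (sym (prod≡ _ _ _ _ _ q)) (subst
        (λ e → prod (κ (π x)) (θ 0# , e) (θ 0# + θ (el d₀) , not e) ≡ inj₁ (τ (inj₂ d₀))) eq (τ-cross x 0#))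
      go : ∀ e → η x ≡ e → ∃ λ d → τ (inj₂ d₀) ≡ inj₂ d × el d ≡ (if e then - θ (el d₀) else θ (el d₀))
      go false eq = _ , sym (inj₁-injective (at false eq)) , +−ˡ (θ 0#) (θ (el d₀))
      go true eq = _ , sym (inj₁-injective (at true eq)) ,
        solve (v0 :− (v0 :+ v1)) (:- v1) (θ 0# ∷ θ (el d₀) ∷ []) refl

    η-constant : ∀ x y → η x ≡ η y
    η-constant x y = let (d , eq , el≡) = crossing-label x ; (d′ , eq′ , el≡′) = crossing-label y in
      go (η x) (η y) (trans (sym el≡) (trans (cong el (inj₂-injective (trans (sym eq) eq′))) el≡′))
      where
      d₀≢0 : θ (el d₀) ≢ 0#
      d₀≢0 eq = case trans (sym χ-θ) (trans (cong χ eq) χ-0) of λ ()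
      opp : ∀ z → - z ≡ z → z ≡ 0#
      opp z eq = double-zero z (trans (cong (_+ z) (sym eq)) (solve (:- v0 :+ v0) :0 (z ∷ []) refl))
      go : ∀ e e′ → (if e then - θ (el d₀) else θ (el d₀)) ≡ (if e′ then - θ (el d₀) else θ (el d₀)) → e ≡ e′
      go false false _ = refl
      go true true _ = refl
      go false true eq = ⊥-elim (d₀≢0 (opp _ (sym eq)))
      go true false eq = ⊥-elim (d₀≢0 (opp _ eq))

    η≡false : ∀ x → η x ≡ false
    η≡false x = trans (η-constant x (x₀ ⋆ x₁)) (trans (η-⋆ x₀≢x₁)
      (trans (cong (_xor η x₁) (η-constant x₀ x₁)) (𝔹.xor-same (η x₁))))

    β≡ : ∀ x a e → β x (a , e) ≡ (θ a , e)
    β≡ x a e = trans (β-affine x a e) (cong (θ a ,_) (trans (cong (e xor_) (η≡false x)) (𝔹.xor-identityʳ e)))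

    prod-vertical : ∀ k a → prod k (a , false) (a , true) ≡ inj₁ (inj₁ (a − k))
    prod-vertical k a = trans (prod≡ k a false a true χ-a−a) (cong (λ z → inj₁ (inj₁ (z − k))) (half-double a))
      where
      χ-a−a : χ (a − a) ≡ true
      χ-a−a = trans (cong χ (solve (v0 :− v0) :0 (a ∷ []) refl)) χ-0

    -- The vertical edge over `κ x` has the label `inj₁ 0#` in every group, so its image, the
    -- vertical edge over `θ (κ x)`, has a label independent of `x`.
    colour-shift : ∀ x → inj₁ (θ (κ x) − κ (π x)) ≡ τ (inj₁ 0#)
    colour-shift x = inj₁-injective (trans (sym (prod-vertical (κ (π x)) (θ (κ x))))
      (trans (cong₂ (prod (κ (π x))) (sym (β≡ x (κ x) false)) (sym (β≡ x (κ x) true)))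
        (σ-prod x (κ x , false) (κ x , true) (trans (prod-vertical (κ x) (κ x))
          (cong (λ z → inj₁ (inj₁ z)) (solve (v0 :− v0) :0 (κ x ∷ []) refl))))))

    C : A
    C = θ (κ x₀) − κ (π x₀)

    κ-π : ∀ x → κ (π x) ≡ θ (κ x) − C
    κ-π x = trans (solve v1 (v0 :− (v0 :− v1)) (θ (κ x) ∷ κ (π x) ∷ []) refl)
      (cong (θ (κ x) −_) (inj₁-injective (trans (colour-shift x) (sym (colour-shift x₀)))))

    κx₀ : κ x₀ ≡ 0#
    κx₀ = cong [_] num-x₀

    κx₁ : κ x₁ ≡ 1#
    κx₁ = cong [_] num-x₁

    κx₃ : κ x₃ ≡ 1# + (1# + 1#)
    κx₃ = trans (cong [_] num-x₃) (sym (trans (cong (1# +_) ([]-+ 1 1)) ([]-+ 1 2)))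

    -- The colours 0, 1, 3 satisfy 3 + 2 · 0 = 3 · 1, and affine maps preserve this relation. By
    -- `num-bound` neither side wraps around modulo p, so it holds between natural numbers.
    colour-relation : num (col (π x₃)) ℕ.+ (num (col (π x₀)) ℕ.+ num (col (π x₀)))
                    ≡ num (col (π x₁)) ℕ.+ (num (col (π x₁)) ℕ.+ num (col (π x₁)))
    colour-relation = []-injective (bound (col (π x₃)) (col (π x₀))) (num-bound _) (begin
      [ n₃ ℕ.+ (n₀ ℕ.+ n₀) ] ≡⟨ sym (trans (cong ([ n₃ ] +_) ([]-+ n₀ n₀)) ([]-+ n₃ _)) ⟩
      κ (π x₃) + (κ (π x₀) + κ (π x₀)) ≡⟨ cong₂ _+_ at₃ (cong₂ _+_ at₀ at₀) ⟩
      (θ 1# + (θ 1# + θ 1#) − C) + ((0# − C) + (0# − C))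
        ≡⟨ solve ((v0 :+ (v0 :+ v0) :− v1) :+ ((:0 :− v1) :+ (:0 :− v1))) ((v0 :− v1) :+ ((v0 :− v1) :+ (v0 :− v1))) (θ 1# ∷ C ∷ []) refl ⟩
      (θ 1# − C) + ((θ 1# − C) + (θ 1# − C)) ≡⟨ sym (cong₂ _+_ at₁ (cong₂ _+_ at₁ at₁)) ⟩
      κ (π x₁) + (κ (π x₁) + κ (π x₁)) ≡⟨ trans (cong ([ n₁ ] +_) ([]-+ n₁ n₁)) ([]-+ n₁ _) ⟩
      [ n₁ ℕ.+ (n₁ ℕ.+ n₁) ] ∎)
      where
      open ≡-Reasoning
      n₀ n₁ n₃ : ℕ
      n₀ = num (col (π x₀))
      n₁ = num (col (π x₁))
      n₃ = num (col (π x₃))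
      at₀ : κ (π x₀) ≡ 0# − C
      at₀ = trans (κ-π x₀) (cong (_− C) (trans (cong θ κx₀) θ-0))
      at₁ : κ (π x₁) ≡ θ 1# − C
      at₁ = trans (κ-π x₁) (cong (λ z → θ z − C) κx₁)
      at₃ : κ (π x₃) ≡ θ 1# + (θ 1# + θ 1#) − C
      at₃ = trans (κ-π x₃) (cong (_− C) (trans (cong θ κx₃) (trans (θ-+ 1# _) (cong (θ 1# +_) (θ-+ 1# 1#)))))
      bound : ∀ i j → num i ℕ.+ (num j ℕ.+ num j) < p
      bound i j = case ℕₚ.≤-total (num i) (num j) of λ where
        (inj₁ i≤j) → ℕₚ.≤-<-trans (ℕₚ.+-monoˡ-≤ (num j ℕ.+ num j) i≤j) (num-bound j)
        (inj₂ j≤i) → ℕₚ.≤-<-trans (ℕₚ.+-monoʳ-≤ (num i) (ℕₚ.+-mono-≤ j≤i j≤i)) (num-bound i)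

    rigid-colours : C ≡ 0# × θ 1# ≡ 1#
    rigid-colours = case num-rigid (col (π x₀)) (col (π x₁)) (col (π x₃)) colour-relation of λ where
      (inj₁ same) → ⊥-elim (1≢0 (sym (trans (sym κx₀) (trans (θ-injective (cancelʳ _ _ (- C)
        (trans (sym (κ-π x₀)) (trans (cong (λ c → [ num c ]) same) (κ-π x₁))))) κx₁))))
      (inj₂ (is0 , is1)) →
        let C≡0 = trans (cong₂ _−_ (trans (cong θ κx₀) θ-0) (cong [_] is0)) (solve (:0 :− :0) :0 [] refl) in
        C≡0 , trans (trans (solve v0 ((v0 :− v1) :+ v1) (θ 1# ∷ C ∷ []) refl)
          (cong₂ _+_ (trans (sym (trans (κ-π x₁) (cong (λ z → θ z − C) κx₁))) (cong [_] is1)) C≡0)) (+0 1#)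

    θ≡id : ∀ a → θ a ≡ a
    θ≡id = cyclic-induction _ θ-0 λ a ih → trans (θ-+ a 1#) (cong₂ _+_ ih (proj₂ rigid-colours))

    κ-invariant : ∀ x → κ (π x) ≡ κ x
    κ-invariant x = trans (κ-π x) (trans (cong₂ _−_ (θ≡id (κ x)) (proj₁ rigid-colours)) (solve (v0 :− :0) v0 (κ x ∷ []) refl))

    col-invariant : ∀ x → col (π x) ≡ col x
    col-invariant x = num-injective ([]-injective (small (col (π x))) (small (col x)) (κ-invariant x))
      where
      small : ∀ i → num i < p
      small i = ℕₚ.≤-<-trans (ℕₚ.m≤m+n (num i) _) (num-bound i)

    σ-group≡ : ∀ x b → σ (inj₂ (x , b)) ≡ inj₂ (π x , b)
    σ-group≡ x (a , e) = trans (σ≡ x (a , e)) (cong (λ b → inj₂ (π x , b)) (trans (β≡ x a e) (cong (_, e) (θ≡id a))))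

    -- Every label names an edge at `0ᴾ` in the group of `x₀`; this edge is carried to the same edge
    -- of a group of the same colour, where it has the same label.
    σ-lab≡ : ∀ l → σ (inj₁ l) ≡ inj₁ l
    σ-lab≡ l = begin
      σ (inj₁ l) ≡⟨ τ≡ l ⟩
      inj₁ (τ l) ≡⟨ cong inj₁ (sym (inj₁-injective (trans (sym fixed)
        (σ-prod x₀ 0ᴾ (act (κ x₀) l 0ᴾ) (Filler.prod-act (filler (κ x₀)) l 0ᴾ))))) ⟩
      inj₁ l ∎
      where
      open ≡-Reasoning
      β-id : ∀ b → β x₀ b ≡ b
      β-id (a , e) = trans (β≡ x₀ a e) (cong (_, e) (θ≡id a))
      fixed : prod (κ (π x₀)) (β x₀ 0ᴾ) (β x₀ (act (κ x₀) l 0ᴾ)) ≡ inj₁ l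
      fixed = trans (cong₂ (prod (κ (π x₀))) (β-id 0ᴾ) (trans (β-id _) (cong (λ k → act k l 0ᴾ) (sym (κ-invariant x₀)))))
        (Filler.prod-act (filler (κ (π x₀))) l 0ᴾ)

-- The coloured system W

infixl 6 _△_
_△_ : ∀ {n} → Subset n → Subset n → Subset n
_△_ = zipWith _xor_

△-comm : ∀ {n} (s t : Subset n) → s △ t ≡ t △ s
△-comm [] [] = refl
△-comm (a ∷ s) (b ∷ t) = cong₂ _∷_ (𝔹.xor-comm a b) (△-comm s t)

△-assoc : ∀ {n} (s t r : Subset n) → (s △ t) △ r ≡ s △ (t △ r)
△-assoc [] [] [] = refl
△-assoc (a ∷ s) (b ∷ t) (c ∷ r) = cong₂ _∷_ (𝔹.xor-assoc a b c) (△-assoc s t r)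

△-self : ∀ {n} (s : Subset n) → s △ s ≡ ∅
△-self [] = refl
△-self (a ∷ s) = cong₂ _∷_ (𝔹.xor-same a) (△-self s)

∅△ : ∀ {n} (s : Subset n) → ∅ △ s ≡ s
∅△ [] = refl
∅△ (a ∷ s) = cong (a ∷_) (∅△ s)

△∅ : ∀ {n} (s : Subset n) → s △ ∅ ≡ s
△∅ s = trans (△-comm s ∅) (∅△ s)

△-invol : ∀ {n} (s t : Subset n) → s △ (s △ t) ≡ t
△-invol s t = trans (sym (△-assoc s s t)) (trans (cong (_△ t) (△-self s)) (∅△ t))

△-cancelˡ : ∀ {n} (s : Subset n) {t r} → s △ t ≡ s △ r → t ≡ r
△-cancelˡ s {t} {r} eq = trans (sym (△-invol s t)) (trans (cong (s △_) eq) (△-invol s r))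

△≡∅ : ∀ {n} {s t : Subset n} → s △ t ≡ ∅ → s ≡ t
△≡∅ {s = s} {t} eq = △-cancelˡ s (trans (△-self s) (sym eq))

△≡ˡ : ∀ {n} {s t : Subset n} → s △ t ≡ s → t ≡ ∅
△≡ˡ {s = s} {t} eq = △-cancelˡ s (trans eq (sym (△∅ s)))

△≡ʳ : ∀ {n} {s t : Subset n} → s △ t ≡ t → s ≡ ∅
△≡ʳ {s = s} {t} eq = △≡ˡ (trans (△-comm t s) eq)

infix 4 _≟ˢ_
_≟ˢ_ : ∀ {n} (s t : Subset n) → Dec (s ≡ t)
_≟ˢ_ = ≡-dec 𝔹._≟_

subset-ext : ∀ {n} {s t : Subset n} → (∀ x → lookup s x ≡ lookup t x) → s ≡ t
subset-ext {s = s} {t} eq = trans (sym (tabulate∘lookup s)) (trans (tabulate-cong eq) (tabulate∘lookup t))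

lookup-△ : ∀ {n} (s t : Subset n) x → lookup (s △ t) x ≡ lookup s x xor lookup t x
lookup-△ s t x = lookup-zipWith _xor_ x s t

∈-true : ∀ {n} {s : Subset n} {x} → x ∈ s → lookup s x ≡ true
∈-true = []=⇒lookup

true-∈ : ∀ {n} {s : Subset n} {x} → lookup s x ≡ true → x ∈ s
true-∈ {s = s} {x} = lookup⇒[]= x s

lookup-∅ : ∀ {n} (x : Fin n) → lookup ∅ x ≡ false
lookup-∅ x = lookup-replicate x false

lookup-⁅x⁆ : ∀ {n} (x : Fin n) → lookup ⁅ x ⁆ x ≡ true
lookup-⁅x⁆ x = ∈-true (x∈⁅x⁆ x)

lookup-⁅y⁆ : ∀ {n} {x y : Fin n} → x ≢ y → lookup ⁅ y ⁆ x ≡ false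
lookup-⁅y⁆ {x = x} {y} x≢y = go (lookup ⁅ y ⁆ x) refl
  where
  go : ∀ e → lookup ⁅ y ⁆ x ≡ e → e ≡ false
  go false _ = refl
  go true eq = ⊥-elim (x≢y (x∈⁅y⁆⇒x≡y y (true-∈ eq)))

⁅⁆-injective : ∀ {n} {x y : Fin n} → ⁅ x ⁆ ≡ ⁅ y ⁆ → x ≡ y
⁅⁆-injective {x = x} {y} eq = x∈⁅y⁆⇒x≡y y (subst (x ∈_) eq (x∈⁅x⁆ x))

⁅⁆≢∅ : ∀ {n} {x : Fin n} → ⁅ x ⁆ ≢ ∅
⁅⁆≢∅ {x = x} eq = case trans (sym (lookup-⁅x⁆ x)) (trans (cong (λ s → lookup s x) eq) (lookup-∅ x)) of λ ()

△-⊆ : ∀ {n} {s t r : Subset n} → s ⊆ r → t ⊆ r → s △ t ⊆ r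
△-⊆ {s = s} {t} s⊆r t⊆r {x} x∈ = go (lookup s x) (lookup t x) refl refl
  where
  go : ∀ a b → lookup s x ≡ a → lookup t x ≡ b → x ∈ _
  go true _ eq _ = s⊆r (true-∈ eq)
  go false true _ eq = t⊆r (true-∈ eq)
  go false false eq eq′ = case trans (sym (∈-true x∈)) (trans (lookup-△ s t x) (cong₂ _xor_ eq eq′)) of λ ()

∅≢⇒∈ : ∀ {n} (s : Subset n) → s ≢ ∅ → ∃ λ x → x ∈ s
∅≢⇒∈ [] ne = ⊥-elim (ne refl)
∅≢⇒∈ (true ∷ s) ne = F.zero , here
∅≢⇒∈ (false ∷ s) ne = let (x , x∈) = ∅≢⇒∈ s (ne ∘ cong (false ∷_)) in F.suc x , there x∈

△-generated : ∀ {n} (Q : Subset n → Set) → Q ∅ → (∀ s x → Q s → Q (s △ ⁅ x ⁆)) → ∀ s → Q s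
△-generated Q q0 step [] = q0
△-generated Q q0 step (c ∷ s) = head c
  where
  tail : Q (false ∷ s)
  tail = △-generated (λ s → Q (false ∷ s)) q0 (λ s x → step (false ∷ s) (F.suc x)) s
  head : ∀ c → Q (c ∷ s)
  head false = tail
  head true = subst (λ t → Q (true ∷ t)) (△∅ s) (step (false ∷ s) F.zero tail)

∣∣≡0 : ∀ {n} (s : Subset n) → ∣ s ∣ ≡ 0 → s ≡ ∅
∣∣≡0 [] _ = refl
∣∣≡0 (false ∷ s) eq = cong (false ∷_) (∣∣≡0 s eq)

∣△⁅∈⁆∣ : ∀ {n} {s : Subset n} {x} → x ∈ s → suc ∣ s △ ⁅ x ⁆ ∣ ≡ ∣ s ∣
∣△⁅∈⁆∣ {s = true ∷ s} here = cong (suc ∘ ∣_∣) (△∅ s)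
∣△⁅∈⁆∣ {s = true ∷ s} (there x∈) = cong suc (∣△⁅∈⁆∣ x∈)
∣△⁅∈⁆∣ {s = false ∷ s} (there x∈) = ∣△⁅∈⁆∣ x∈

∣△⁅∉⁆∣ : ∀ {n} (s : Subset n) x → lookup s x ≡ false → ∣ s △ ⁅ x ⁆ ∣ ≡ suc ∣ s ∣
∣△⁅∉⁆∣ (false ∷ s) F.zero _ = cong (suc ∘ ∣_∣) (△∅ s)
∣△⁅∉⁆∣ (true ∷ s) (F.suc x) eq = cong suc (∣△⁅∉⁆∣ s x eq)
∣△⁅∉⁆∣ (false ∷ s) (F.suc x) eq = ∣△⁅∉⁆∣ s x eq

-- Built from symmetric differences so that points can be cancelled; for distinct arguments it is
-- the three-element set.
tri : ∀ {n} → Fin n → Fin n → Fin n → Subset n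
tri x y z = (⁅ x ⁆ △ ⁅ y ⁆) △ ⁅ z ⁆

∣pair∣ : ∀ {n} {x y : Fin n} → x ≢ y → ∣ ⁅ x ⁆ △ ⁅ y ⁆ ∣ ≡ 2
∣pair∣ {x = x} {y} x≢y = trans (∣△⁅∉⁆∣ ⁅ x ⁆ y (lookup-⁅y⁆ (x≢y ∘ sym))) (cong suc (∣⁅x⁆∣≡1 x))

lookup-pair-∉ : ∀ {n} {x y z : Fin n} → z ≢ x → z ≢ y → lookup (⁅ x ⁆ △ ⁅ y ⁆) z ≡ false
lookup-pair-∉ {x = x} {y} {z} z≢x z≢y = trans (lookup-△ ⁅ x ⁆ ⁅ y ⁆ z) (cong₂ _xor_ (lookup-⁅y⁆ z≢x) (lookup-⁅y⁆ z≢y))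

∣tri∣ : ∀ {n} {x y z : Fin n} → x ≢ y → x ≢ z → y ≢ z → ∣ tri x y z ∣ ≡ 3
∣tri∣ {x = x} {y} {z} x≢y x≢z y≢z =
  trans (∣△⁅∉⁆∣ (⁅ x ⁆ △ ⁅ y ⁆) z (lookup-pair-∉ (x≢z ∘ sym) (y≢z ∘ sym))) (cong suc (∣pair∣ x≢y))

pair-∈ʳ : ∀ {n} {x y : Fin n} → x ≢ y → y ∈ ⁅ x ⁆ △ ⁅ y ⁆
pair-∈ʳ {x = x} {y} x≢y = true-∈ (trans (lookup-△ ⁅ x ⁆ ⁅ y ⁆ y) (cong₂ _xor_ (lookup-⁅y⁆ (x≢y ∘ sym)) (lookup-⁅x⁆ y)))

tri-∈₂ : ∀ {n} {x y z : Fin n} → x ≢ y → y ≢ z → y ∈ tri x y z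
tri-∈₂ {x = x} {y} {z} x≢y y≢z = true-∈ (trans (lookup-△ (⁅ x ⁆ △ ⁅ y ⁆) ⁅ z ⁆ y)
  (cong₂ _xor_ (∈-true (pair-∈ʳ x≢y)) (lookup-⁅y⁆ y≢z)))

tri-swap : ∀ {n} (x y z : Fin n) → tri x y z ≡ tri y x z
tri-swap x y z = cong (_△ ⁅ z ⁆) (△-comm ⁅ x ⁆ ⁅ y ⁆)

tri-rotate : ∀ {n} (x y z : Fin n) → tri x y z ≡ tri z x y
tri-rotate x y z = trans (△-comm _ ⁅ z ⁆) (sym (△-assoc ⁅ z ⁆ ⁅ x ⁆ ⁅ y ⁆))

tri-∈₁ : ∀ {n} {x y z : Fin n} → x ≢ y → x ≢ z → x ∈ tri x y z
tri-∈₁ {x = x} {y} {z} x≢y x≢z = subst (x ∈_) (tri-swap y x z) (tri-∈₂ (x≢y ∘ sym) x≢z)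

tri-∈₃ : ∀ {n} {x y z : Fin n} → x ≢ z → y ≢ z → z ∈ tri x y z
tri-∈₃ {x = x} {y} {z} x≢z y≢z = subst (z ∈_) (sym (tri-rotate x y z)) (tri-∈₁ (x≢z ∘ sym) (y≢z ∘ sym))

tri-∈⁻ : ∀ {n} {x y z t : Fin n} → t ∈ tri x y z → t ≢ x → t ≢ y → t ≡ z
tri-∈⁻ {x = x} {y} {z} {t} t∈ t≢x t≢y = x∈⁅y⁆⇒x≡y z (true-∈ (trans
  (sym (trans (lookup-△ (⁅ x ⁆ △ ⁅ y ⁆) ⁅ z ⁆ t) (cong (_xor lookup ⁅ z ⁆ t) (lookup-pair-∉ t≢x t≢y)))) (∈-true t∈)))

three-points : ∀ {n} {s : Subset n} → ∣ s ∣ ≡ 3 → ∀ {x y} → x ≢ y → x ∈ s → y ∈ s →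
  ∃ λ z → s ≡ tri x y z × x ≢ z × y ≢ z
three-points {n} {s} eq {x} {y} x≢y x∈ y∈ = z , s≡ ,
  (λ x≡z → case trans (sym size-last-2) (trans (cong (suc ∘ ∣_∣ ∘ (rest △_) ∘ ⁅_⁆) (sym x≡z)) (absurd-size x∉)) of λ ()) ,
  (λ y≡z → case trans (sym size-last-2) (trans (cong (suc ∘ ∣_∣ ∘ (rest △_) ∘ ⁅_⁆) (sym y≡z)) (absurd-size y∉)) of λ ())
  where
  y∈′ : y ∈ s △ ⁅ x ⁆
  y∈′ = true-∈ (trans (lookup-△ s ⁅ x ⁆ y) (cong₂ _xor_ (∈-true y∈) (lookup-⁅y⁆ (x≢y ∘ sym))))
  rest : Subset _
  rest = (s △ ⁅ x ⁆) △ ⁅ y ⁆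
  size-rest : ∣ rest ∣ ≡ 1
  size-rest = ℕₚ.suc-injective (ℕₚ.suc-injective (trans (cong suc (∣△⁅∈⁆∣ y∈′)) (trans (∣△⁅∈⁆∣ x∈) eq)))
  x∉ : lookup rest x ≡ false
  x∉ = trans (lookup-△ (s △ ⁅ x ⁆) ⁅ y ⁆ x) (cong₂ _xor_
    (trans (lookup-△ s ⁅ x ⁆ x) (cong₂ _xor_ (∈-true x∈) (lookup-⁅x⁆ x))) (lookup-⁅y⁆ x≢y))
  y∉ : lookup rest y ≡ false
  y∉ = trans (lookup-△ (s △ ⁅ x ⁆) ⁅ y ⁆ y) (cong₂ _xor_ (∈-true y∈′) (lookup-⁅x⁆ y))
  ne : rest ≢ ∅
  ne eq = case trans (sym size-rest) (trans (cong ∣_∣ eq) (∣⊥∣≡0 n)) of λ ()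
  z : Fin _
  z = proj₁ (∅≢⇒∈ rest ne)
  z∈ : z ∈ rest
  z∈ = proj₂ (∅≢⇒∈ rest ne)
  size-last-2 : suc ∣ rest △ ⁅ z ⁆ ∣ ≡ 1
  size-last-2 = trans (∣△⁅∈⁆∣ z∈) size-rest
  absurd-size : ∀ {t} → lookup rest t ≡ false → suc ∣ rest △ ⁅ t ⁆ ∣ ≡ 3
  absurd-size {t} t∉ = cong suc (trans (∣△⁅∉⁆∣ rest t t∉) (cong suc size-rest))
  rest≡ : rest ≡ ⁅ z ⁆
  rest≡ = △≡∅ (∣∣≡0 _ (ℕₚ.suc-injective size-last-2))
  s≡ : s ≡ tri x y z
  s≡ = sym (trans (cong ((⁅ x ⁆ △ ⁅ y ⁆) △_) (sym rest≡)) (trans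
    (cong ((⁅ x ⁆ △ ⁅ y ⁆) △_) (trans (△-comm (s △ ⁅ x ⁆) ⁅ y ⁆) (cong (⁅ y ⁆ △_) (△-comm s ⁅ x ⁆))))
    (trans (△-assoc ⁅ x ⁆ ⁅ y ⁆ _) (trans (cong (⁅ x ⁆ △_) (△-invol ⁅ y ⁆ _)) (△-invol ⁅ x ⁆ s)))))

-- The nonidentity elements of a sloop are the points of a Steiner triple system.
record Sloop (L : Set) : Set where
  infixl 7 _•_
  field
    _•_ : L → L → L
    ε   : L
    identityˡ : ∀ x → ε • x ≡ x
    comm  : ∀ x y → x • y ≡ y • x
    invol : ∀ x y → x • (x • y) ≡ y

  identityʳ : ∀ x → x • ε ≡ x
  identityʳ x = trans (comm x ε) (identityˡ x)

  square : ∀ x → x • x ≡ ε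
  square x = trans (cong (x •_) (sym (identityʳ x))) (invol x ε)

  •≡ε : ∀ {x y} → x • y ≡ ε → x ≡ y
  •≡ε {x} {y} eq = sym (trans (sym (invol x y)) (trans (cong (x •_) eq) (identityʳ x)))

-- Switching the planes of the triples

module SwitchedSloop {v : ℕ} (V : PSTS v) where

  -- In the plane spanned by the singletons of a triple T of V, two points are joined inside T instead of by their symmetric difference.
  Switched : Subset v → Subset v → Subset v → Set
  Switched s t T = isTriple V T ≡ true × s ⊆ T × t ⊆ T × s ≢ ∅ × t ≢ ∅ × s ≢ t × s ≢ T × t ≢ T × s △ t ≢ T

  switched? : ∀ s t → Dec (∃ λ T → Switched s t T)
  switched? s t = anySubset? λ T → (isTriple V T 𝔹.≟ true) ×-dec ((s ⊆? T) ×-dec ((t ⊆? T) ×-dec (¬? (s ≟ˢ ∅) ×-dec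
    (¬? (t ≟ˢ ∅) ×-dec (¬? (s ≟ˢ t) ×-dec (¬? (s ≟ˢ T) ×-dec (¬? (t ≟ˢ T) ×-dec ¬? (s △ t ≟ˢ T))))))))

  -- Distinct triples share at most one point, so nonempty `s` and `t` inside both would be the same
  -- singleton.
  switched-unique : ∀ {s t T T′} → Switched s t T → Switched s t T′ → T ≡ T′
  switched-unique {s} {t} {T} {T′} (tT , s⊆T , t⊆T , s≢∅ , t≢∅ , s≢t , _) (tT′ , s⊆T′ , t⊆T′ , _) = case T ≟ˢ T′ of λ where
      (yes eq) → eq
      (no T≢T′) → ⊥-elim (s≢t (same-singleton λ x y x∈ y∈ → case x F.≟ y of λ where
        (yes eq) → eq
        (no x≢y) → ⊥-elim (T≢T′ (at-most-one V x y x≢y T T′ tT tT′ (s⊆T x∈) (t⊆T y∈) (s⊆T′ x∈) (t⊆T′ y∈)))))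
    where
    same-singleton : (∀ x y → x ∈ s → y ∈ t → x ≡ y) → s ≡ t
    same-singleton all-eq = subset-ext λ z → go z (lookup s z) (lookup t z) refl refl
      where
      x₀ = ∅≢⇒∈ s s≢∅
      y₀ = ∅≢⇒∈ t t≢∅
      go : ∀ z a b → lookup s z ≡ a → lookup t z ≡ b → lookup s z ≡ lookup t z
      go z true true eq eq′ = trans eq (sym eq′)
      go z false false eq eq′ = trans eq (sym eq′)
      go z true false eq _ = trans eq (sym (∈-true (subst (_∈ t) (sym (all-eq z _ (true-∈ eq) (proj₂ y₀))) (proj₂ y₀))))
      go z false true _ eq′ = trans (∈-true (subst (_∈ s) (all-eq _ z (proj₂ x₀) (true-∈ eq′)) (proj₂ x₀))) (sym eq′)

  switched-sym : ∀ {s t T} → Switched s t T → Switched t s T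
  switched-sym {s} {t} (a , s⊆ , t⊆ , s≢∅ , t≢∅ , s≢t , s≢T , t≢T , st≢T) =
    a , t⊆ , s⊆ , t≢∅ , s≢∅ , s≢t ∘ sym , t≢T , s≢T , st≢T ∘ trans (△-comm s t)

  △△-cancel : ∀ (s t T : Subset v) → s △ ((s △ t) △ T) ≡ t △ T
  △△-cancel s t T = trans (cong (s △_) (△-assoc s t T)) (△-invol s (t △ T))

  -- The four lines of the plane that miss the point T form a Pasch configuration. Complementing the
  -- third point in T trades them for the opposite Pasch configuration on the same six points, so a
  -- switched line is switched from any two of its points.
  switched-third : ∀ {s t T} → Switched s t T → Switched s ((s △ t) △ T) T
  switched-third {s} {t} {T} (a , s⊆ , t⊆ , s≢∅ , t≢∅ , s≢t , s≢T , t≢T , st≢T) =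
    a , s⊆ , △-⊆ (△-⊆ s⊆ t⊆) (λ x∈ → x∈) , s≢∅ , st≢T ∘ △≡∅
    , (λ eq → t≢T (△≡∅ (△≡ˡ (sym (trans eq (△-assoc s t T)))))) , s≢T
    , (λ eq → s≢t (△≡∅ (△≡ʳ eq)))
    , (λ eq → t≢∅ (△≡ʳ (trans (sym (△△-cancel s t T)) eq)))

  switched-△ : ∀ {s t T} → Switched s (s △ t) T → Switched s t T
  switched-△ {s} {t} {T} (a , s⊆ , st⊆ , s≢∅ , st≢∅ , s≢st , s≢T , st≢T , t≢T) =
    a , s⊆ , subst (_⊆ T) (△-invol s t) (△-⊆ s⊆ st⊆) , s≢∅ , (λ eq → s≢st (sym (trans (cong (s △_) eq) (△∅ s))))
    , (λ eq → st≢∅ (trans (cong (_△ t) eq) (△-self t))) , s≢T , t≢T ∘ trans (△-invol s t) , st≢T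

  join : ∀ s t → Dec (∃ λ T → Switched s t T) → Subset v
  join s t (yes (T , _)) = (s △ t) △ T
  join s t (no _) = s △ t

  infixl 7 _∘ˢ_
  _∘ˢ_ : Subset v → Subset v → Subset v
  s ∘ˢ t = join s t (switched? s t)

  ∘-switched : ∀ {s t T} → Switched s t T → s ∘ˢ t ≡ (s △ t) △ T
  ∘-switched {s} {t} {T} sw with switched? s t
  ... | yes (T′ , sw′) = cong ((s △ t) △_) (switched-unique sw′ sw)
  ... | no ¬sw = ⊥-elim (¬sw (T , sw))

  ∘-plain : ∀ {s t} → (∀ T → ¬ Switched s t T) → s ∘ˢ t ≡ s △ t
  ∘-plain {s} {t} ¬sw with switched? s t
  ... | yes (T , sw) = ⊥-elim (¬sw T sw)
  ... | no _ = refl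

  ∘-comm : ∀ s t → s ∘ˢ t ≡ t ∘ˢ s
  ∘-comm s t = case switched? s t of λ where
    (yes (T , sw)) → trans (∘-switched sw) (trans (cong (_△ T) (△-comm s t)) (sym (∘-switched (switched-sym sw))))
    (no ¬sw) → trans (∘-plain λ T sw → ¬sw (T , sw)) (trans (△-comm s t) (sym (∘-plain λ T sw → ¬sw (T , switched-sym sw))))

  ∘-invol : ∀ s t → s ∘ˢ (s ∘ˢ t) ≡ t
  ∘-invol s t = case switched? s t of λ where
    (yes (T , sw)) → trans (cong (s ∘ˢ_) (∘-switched sw)) (trans (∘-switched (switched-third sw))
      (trans (cong (_△ T) (△△-cancel s t T)) (trans (△-comm (t △ T) T) (trans (cong (T △_) (△-comm t T)) (△-invol T t)))))
    (no ¬sw) → trans (cong (s ∘ˢ_) (∘-plain λ T sw → ¬sw (T , sw)))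
      (trans (∘-plain λ T sw → ¬sw (T , switched-△ sw)) (△-invol s t))

  ∅∘ : ∀ s → ∅ ∘ˢ s ≡ s
  ∅∘ s = trans (∘-plain λ T (_ , _ , _ , ∅≢∅ , _) → ∅≢∅ refl) (∅△ s)

  triple-join : ∀ {x y z} → x ≢ y → x ≢ z → y ≢ z → isTriple V (tri x y z) ≡ true → ⁅ x ⁆ ∘ˢ ⁅ y ⁆ ≡ ⁅ z ⁆
  triple-join {x} {y} {z} x≢y x≢z y≢z isT = trans (∘-switched sw) (△-invol (⁅ x ⁆ △ ⁅ y ⁆) ⁅ z ⁆)
    where
    T = tri x y z
    single≢T : ∀ {t} → ⁅ t ⁆ ≢ T
    single≢T {t} eq = case trans (sym (∣⁅x⁆∣≡1 t)) (trans (cong ∣_∣ eq) (∣tri∣ x≢y x≢z y≢z)) of λ ()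
    single⊆ : ∀ {t} → t ∈ T → ⁅ t ⁆ ⊆ T
    single⊆ {t} t∈ u∈ = subst (_∈ T) (sym (x∈⁅y⁆⇒x≡y t u∈)) t∈
    sw : Switched ⁅ x ⁆ ⁅ y ⁆ T
    sw = isT , single⊆ (tri-∈₁ x≢y x≢z) , single⊆ (tri-∈₂ x≢y y≢z) , ⁅⁆≢∅ , ⁅⁆≢∅ , x≢y ∘ ⁅⁆-injective , single≢T , single≢T
      , λ eq → case trans (sym (∣pair∣ x≢y)) (trans (cong ∣_∣ eq) (∣tri∣ x≢y x≢z y≢z)) of λ ()

  join-triple : ∀ {x y z} → x ≢ y → ⁅ x ⁆ ∘ˢ ⁅ y ⁆ ≡ ⁅ z ⁆ → isTriple V (tri x y z) ≡ true
  join-triple {x} {y} {z} x≢y eq = case switched? ⁅ x ⁆ ⁅ y ⁆ of λ where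
    (yes (T , sw)) → subst (λ S → isTriple V S ≡ true)
      (sym (trans (cong ((⁅ x ⁆ △ ⁅ y ⁆) △_) (sym (trans (sym (∘-switched sw)) eq))) (△-invol (⁅ x ⁆ △ ⁅ y ⁆) T))) (proj₁ sw)
    (no ¬sw) → case trans (sym (∣pair∣ x≢y)) (trans (cong ∣_∣ (trans (sym (∘-plain λ T sw → ¬sw (T , sw))) eq)) (∣⁅x⁆∣≡1 z)) of λ ()

  module _ (k : ℕ) where

    L : Set
    L = Subset k × Subset v

    -- Switching is confined to the subspace without extra coordinates. As soon as one of them is
    -- present the product is the symmetric difference, which is what makes `generated` and
    -- `no-affine` computable.
    mix : ∀ {b b′ : Subset k} → Dec (b ≡ ∅ × b′ ≡ ∅) → Subset v → Subset v → Subset v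
    mix (yes _) s t = s ∘ˢ t
    mix (no _) s t = s △ t

    _•ᴸ_ : L → L → L
    (b , s) •ᴸ (b′ , t) = b △ b′ , mix ((b ≟ˢ ∅) ×-dec (b′ ≟ˢ ∅)) s t

    •-inner : ∀ s t → (∅ , s) •ᴸ (∅ , t) ≡ (∅ , s ∘ˢ t)
    •-inner s t with (∅ {k} ≟ˢ ∅) ×-dec (∅ {k} ≟ˢ ∅)
    ... | yes _ = cong (_, s ∘ˢ t) (△-self ∅)
    ... | no ne = ⊥-elim (ne (refl , refl))

    •-outer : ∀ {b b′} → ¬ (b ≡ ∅ × b′ ≡ ∅) → ∀ s t → (b , s) •ᴸ (b′ , t) ≡ (b △ b′ , s △ t)
    •-outer {b} {b′} ne s t with (b ≟ˢ ∅) ×-dec (b′ ≟ˢ ∅)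
    ... | yes eq = ⊥-elim (ne eq)
    ... | no _ = refl

    sloop : Sloop L
    sloop = record { _•_ = _•ᴸ_ ; ε = ∅ , ∅ ; identityˡ = idˡ ; comm = comm ; invol = invol }
      where
      both? : ∀ (b b′ : Subset k) → Dec (b ≡ ∅ × b′ ≡ ∅)
      both? b b′ = (b ≟ˢ ∅) ×-dec (b′ ≟ˢ ∅)
      idˡ : ∀ x → (∅ , ∅) •ᴸ x ≡ x
      idˡ (b , s) = case both? ∅ b of λ where
        (yes (_ , refl)) → trans (•-inner ∅ s) (cong (∅ ,_) (∅∘ s))
        (no ne) → trans (•-outer ne ∅ s) (cong₂ _,_ (∅△ b) (∅△ s))
      comm : ∀ x y → x •ᴸ y ≡ y •ᴸ x
      comm (b , s) (b′ , t) = case both? b b′ of λ where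
        (yes (refl , refl)) → trans (•-inner s t) (trans (cong (∅ ,_) (∘-comm s t)) (sym (•-inner t s)))
        (no ne) → trans (•-outer ne s t) (trans (cong₂ _,_ (△-comm b b′) (△-comm s t))
          (sym (•-outer (λ (p , q) → ne (q , p)) t s)))
      invol : ∀ x y → x •ᴸ (x •ᴸ y) ≡ y
      invol (b , s) (b′ , t) = case both? b b′ of λ where
        (yes (refl , refl)) → trans (cong ((∅ , s) •ᴸ_) (•-inner s t)) (trans (•-inner s (s ∘ˢ t)) (cong (∅ ,_) (∘-invol s t)))
        (no ne) → trans (cong ((b , s) •ᴸ_) (•-outer ne s t))
          (trans (•-outer (λ (p , q) → ne (p , trans (sym (△-invol b b′)) (trans (cong₂ _△_ p q) (△-self ∅)))) s (s △ t))
            (cong₂ _,_ (△-invol b b′) (△-invol s t)))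

module SloopPoints {L : Set} (S : Sloop L) {w : ℕ} (en : Fin (suc w) ↔ L) where
  open Sloop S

  private
    to : Fin (suc w) → L
    to = Inverse.to en
    from : L → Fin (suc w)
    from = Inverse.from en
    to-from : ∀ l → to (from l) ≡ l
    to-from l = Inverse.inverseˡ en refl
    from-to : ∀ i → from (to i) ≡ i
    from-to i = Inverse.inverseʳ en refl

  abstract
    elt : Fin w → L
    elt i = to (punchIn (from ε) i)

    elt≢ε : ∀ i → elt i ≢ ε
    elt≢ε i eq = punchInᵢ≢i (from ε) i (trans (sym (from-to _)) (cong from eq))

    elt-injective : ∀ {i j} → elt i ≡ elt j → i ≡ j
    elt-injective {i} {j} eq = punchIn-injective (from ε) i j (trans (sym (from-to _)) (trans (cong from eq) (from-to _)))

    index : ∀ l → l ≢ ε → Fin w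
    index l l≢ε = punchOut {i = from ε} {j = from l} λ eq → l≢ε (trans (sym (to-from l)) (trans (cong to (sym eq)) (to-from ε)))

    elt-index : ∀ l (l≢ε : l ≢ ε) → elt (index l l≢ε) ≡ l
    elt-index l l≢ε = trans (cong to (punchIn-punchOut _)) (to-from l)

    ε-or-elt : ∀ l → l ≡ ε ⊎ ∃ λ i → elt i ≡ l
    ε-or-elt l = case from l F.≟ from ε of λ where
      (yes eq) → inj₁ (trans (sym (to-from l)) (trans (cong to eq) (to-from ε)))
      (no ne) → let l≢ε = λ eq → ne (cong from eq) in inj₂ (index l l≢ε , elt-index l l≢ε)

  meet : ∀ i j → Dec (i ≡ j) → Fin w
  meet i j (yes _) = i
  meet i j (no i≢j) = index (elt i • elt j) (λ eq → i≢j (elt-injective (•≡ε eq)))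

  infixl 7 _⋆_
  _⋆_ : Fin w → Fin w → Fin w
  i ⋆ j = meet i j (i F.≟ j)

  ⋆-idem : ∀ i → i ⋆ i ≡ i
  ⋆-idem i with i F.≟ i
  ... | yes _ = refl
  ... | no i≢i = ⊥-elim (i≢i refl)

  elt-⋆ : ∀ {i j} → i ≢ j → elt (i ⋆ j) ≡ elt i • elt j
  elt-⋆ {i} {j} i≢j with i F.≟ j
  ... | yes i≡j = ⊥-elim (i≢j i≡j)
  ... | no i≢j = elt-index (elt i • elt j) (λ eq → i≢j (elt-injective (•≡ε eq)))

  squag : Squag (Fin w)
  squag = record { _∙_ = _⋆_ ; idem = ⋆-idem ; comm = ⋆-comm ; invol = ⋆-invol }
    where
    ⋆-comm : ∀ i j → i ⋆ j ≡ j ⋆ i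
    ⋆-comm i j = case i F.≟ j of λ where
      (yes refl) → refl
      (no i≢j) → elt-injective (trans (elt-⋆ i≢j) (trans (comm _ _) (sym (elt-⋆ (i≢j ∘ sym)))))
    ⋆-invol : ∀ i j → i ⋆ (i ⋆ j) ≡ j
    ⋆-invol i j = case i F.≟ j of λ where
        (yes refl) → trans (cong (i ⋆_) (⋆-idem i)) (⋆-idem i)
        (no i≢j) → elt-injective (trans (elt-⋆ (third i≢j)) (trans (cong (elt i •_) (elt-⋆ i≢j)) (invol _ _)))
      where
      third : i ≢ j → i ≢ i ⋆ j
      third i≢j eq = elt≢ε j (sym (trans (sym (square (elt i)))
        (trans (cong (elt i •_) (trans (cong elt eq) (elt-⋆ i≢j))) (invol (elt i) (elt j)))))

  -- Agreement is phrased over elements of the sloop, where it is vacuous at `ε`; it thereby becomes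
  -- a predicate closed under the product, to which induction over generators applies.
  homs-agree : ∀ (f g : Fin w → Fin w) → (∀ i j → f (i ⋆ j) ≡ f i ⋆ f j) → (∀ i j → g (i ⋆ j) ≡ g i ⋆ g j) →
    let Agree = λ l → ∀ i → elt i ≡ l → f i ≡ g i in Agree ε × (∀ l m → Agree l → Agree m → Agree (l • m))
  homs-agree f g f-hom g-hom = (λ i eq → ⊥-elim (elt≢ε i eq)) , λ l m al am i eq →
    case ε-or-elt l , ε-or-elt m of λ where
      (inj₁ refl , _) → am i (trans eq (identityˡ m))
      (inj₂ _ , inj₁ refl) → al i (trans eq (identityʳ l))
      (inj₂ (j , refl) , inj₂ (j′ , refl)) → case j F.≟ j′ of λ where
        (yes refl) → ⊥-elim (elt≢ε i (trans eq (square (elt j))))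
        (no j≢j′) → let i≡ = elt-injective (trans eq (sym (elt-⋆ j≢j′))) in
          trans (cong f i≡) (trans (f-hom j j′) (trans (cong₂ _⋆_ (al j refl) (am j′ refl))
            (trans (sym (g-hom j j′)) (cong g (sym i≡)))))

-- Permutations acting on subsets and on the switched sloop

module Action {n : ℕ} (σ : Permutation′ n) where

  lookup-· : ∀ S x → lookup (σ · S) x ≡ lookup S (σ ⟨$⟩ˡ x)
  lookup-· S x = lookup∘tabulate _ x

  ·-△ : ∀ S T → σ · (S △ T) ≡ σ · S △ σ · T
  ·-△ S T = subset-ext λ x → trans (lookup-· (S △ T) x) (trans (lookup-△ S T _)
    (sym (trans (lookup-△ (σ · S) (σ · T) x) (cong₂ _xor_ (lookup-· S x) (lookup-· T x)))))

  ·-∅ : σ · ∅ ≡ ∅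
  ·-∅ = subset-ext λ x → trans (lookup-· ∅ x) (trans (lookup-∅ (σ ⟨$⟩ˡ x)) (sym (lookup-∅ x)))

  ·-⁅⁆ : ∀ x → σ · ⁅ x ⁆ ≡ ⁅ σ ⟨$⟩ʳ x ⁆
  ·-⁅⁆ x = subset-ext λ y → trans (lookup-· ⁅ x ⁆ y) (case (σ ⟨$⟩ˡ y) F.≟ x of λ where
    (yes refl) → trans (lookup-⁅x⁆ (σ ⟨$⟩ˡ y)) (sym (trans (cong (λ z → lookup ⁅ z ⁆ y) (Perm.inverseʳ σ)) (lookup-⁅x⁆ y)))
    (no ne) → trans (lookup-⁅y⁆ ne) (sym (lookup-⁅y⁆ λ eq → ne (trans (cong (σ ⟨$⟩ˡ_) eq) (Perm.inverseˡ σ)))))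

  ·-tri : ∀ x y z → σ · tri x y z ≡ tri (σ ⟨$⟩ʳ x) (σ ⟨$⟩ʳ y) (σ ⟨$⟩ʳ z)
  ·-tri x y z = trans (·-△ (⁅ x ⁆ △ ⁅ y ⁆) ⁅ z ⁆) (cong₂ _△_ (trans (·-△ ⁅ x ⁆ ⁅ y ⁆) (cong₂ _△_ (·-⁅⁆ x) (·-⁅⁆ y))) (·-⁅⁆ z))

  ·-⊆ : ∀ {S T} → S ⊆ T → σ · S ⊆ σ · T
  ·-⊆ {S} {T} S⊆T {x} x∈ = true-∈ (trans (lookup-· T x) (∈-true (S⊆T (true-∈ (trans (sym (lookup-· S x)) (∈-true x∈))))))

flip-· : ∀ {n} (σ : Permutation′ n) S → flip σ · (σ · S) ≡ S
flip-· σ S = subset-ext λ x → trans (Action.lookup-· (flip σ) (σ · S) x)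
  (trans (Action.lookup-· σ S _) (cong (lookup S) (Perm.inverseˡ σ)))

·-flip : ∀ {n} (σ : Permutation′ n) S → σ · (flip σ · S) ≡ S
·-flip σ S = flip-· (flip σ) S

·-injective : ∀ {n} (σ : Permutation′ n) {S T} → σ · S ≡ σ · T → S ≡ T
·-injective σ {S} {T} eq = trans (sym (flip-· σ S)) (trans (cong (flip σ ·_) eq) (flip-· σ T))

flip-IsAut : ∀ {n} (V : PSTS n) (σ : Permutation′ n) → IsAut V σ → IsAut V (flip σ)
flip-IsAut V σ aut S = trans (sym (aut (flip σ · S))) (cong (isTriple V) (·-flip σ S))

module SwitchedAction {v : ℕ} (V : PSTS v) (σ : Permutation′ v) (aut : IsAut V σ) where
  open SwitchedSloop V
  open Action σ

  ·-switched : ∀ {s t T} → Switched s t T → Switched (σ · s) (σ · t) (σ · T)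
  ·-switched {s} {t} {T} (a , s⊆ , t⊆ , s≢∅ , t≢∅ , s≢t , s≢T , t≢T , st≢T) =
    trans (aut T) a , ·-⊆ s⊆ , ·-⊆ t⊆ , (λ eq → s≢∅ (·-injective σ (trans eq (sym ·-∅)))) ,
    (λ eq → t≢∅ (·-injective σ (trans eq (sym ·-∅)))) , s≢t ∘ ·-injective σ , s≢T ∘ ·-injective σ , t≢T ∘ ·-injective σ ,
    λ eq → st≢T (·-injective σ (trans (·-△ s t) eq))

·-∘ˢ : ∀ {v} (V : PSTS v) (σ : Permutation′ v) → IsAut V σ → let open SwitchedSloop V in
  ∀ s t → σ · (s ∘ˢ t) ≡ (σ · s) ∘ˢ (σ · t)
·-∘ˢ V σ aut s t = case switched? s t of λ where
    (yes (T , sw)) → trans (cong (σ ·_) (∘-switched sw)) (trans (·-△ (s △ t) T)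
      (trans (cong (_△ (σ · T)) (·-△ s t)) (sym (∘-switched (SwitchedAction.·-switched V σ aut sw)))))
    (no ¬sw) → trans (cong (σ ·_) (∘-plain λ T sw → ¬sw (T , sw))) (trans (·-△ s t) (sym (∘-plain λ T sw →
      ¬sw (flip σ · T , subst (λ s′ → Switched s′ t (flip σ · T)) (flip-· σ s)
        (subst (λ t′ → Switched _ t′ (flip σ · T)) (flip-· σ t)
          (SwitchedAction.·-switched V (flip σ) (flip-IsAut V σ aut) sw))))))
  where
  open SwitchedSloop V
  open Action σ

-- The coloured system W and its lifted automorphisms

module Frame {v : ℕ} (V : PSTS v) (k′ : ℕ) {w′ : ℕ}
  (en : Fin (suc (suc w′)) ↔ SwitchedSloop.L V (4 ℕ.+ k′)) where

  k : ℕ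
  k = 4 ℕ.+ k′

  open SwitchedSloop V
  open Sloop (sloop k) using (_•_; ε)
  open SloopPoints (sloop k) en public renaming (squag to W)

  private
    w : ℕ
    w = suc w′

  extraᴸ : Fin k → L k
  extraᴸ i = ⁅ i ⁆ , ∅

  pointᴸ : Fin v → L k
  pointᴸ j = ∅ , ⁅ j ⁆

  extra : Fin k → Fin w
  extra i = index (extraᴸ i) (⁅⁆≢∅ ∘ cong proj₁)

  point : Fin v → Fin w
  point j = index (pointᴸ j) (⁅⁆≢∅ ∘ cong proj₂)

  elt-extra : ∀ i → elt (extra i) ≡ extraᴸ i
  elt-extra i = elt-index _ (⁅⁆≢∅ ∘ cong proj₁)

  elt-point : ∀ j → elt (point j) ≡ pointᴸ j
  elt-point j = elt-index _ (⁅⁆≢∅ ∘ cong proj₂)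

  point-injective : ∀ {i j} → point i ≡ point j → i ≡ j
  point-injective {i} {j} eq = ⁅⁆-injective (cong proj₂ (trans (sym (elt-point i)) (trans (cong elt eq) (elt-point j))))

  elt-point-⋆ : ∀ {x y} → x ≢ y → elt (point x ⋆ point y) ≡ (∅ , ⁅ x ⁆ ∘ˢ ⁅ y ⁆)
  elt-point-⋆ {x} {y} x≢y = trans (elt-⋆ (x≢y ∘ point-injective))
    (trans (cong₂ _•_ (elt-point x) (elt-point y)) (•-inner k ⁅ x ⁆ ⁅ y ⁆))

  point-⋆ : ∀ {x y z} → x ≢ y → x ≢ z → y ≢ z → isTriple V (tri x y z) ≡ true → point x ⋆ point y ≡ point z
  point-⋆ {x} {y} {z} x≢y x≢z y≢z isT = elt-injective (trans (elt-point-⋆ x≢y)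
    (trans (cong (∅ ,_) (triple-join x≢y x≢z y≢z isT)) (sym (elt-point z))))

  ⋆-point : ∀ {x y z} → x ≢ y → point x ⋆ point y ≡ point z → isTriple V (tri x y z) ≡ true
  ⋆-point {x} {y} {z} x≢y eq = join-triple x≢y (cong proj₂ (trans (sym (elt-point-⋆ x≢y)) (trans (cong elt eq) (elt-point z))))

  data Kind (l : L k) : Set where
    extraK : ∀ i → l ≡ extraᴸ i → Kind l
    pointK : ∀ j → l ≡ pointᴸ j → Kind l
    otherK : (∀ i → l ≢ extraᴸ i) → (∀ j → l ≢ pointᴸ j) → Kind l

  _≟ᴸ_ : (l m : L k) → Dec (l ≡ m)
  (b , s) ≟ᴸ (b′ , s′) = map′ (λ (p , q) → cong₂ _,_ p q) (λ eq → cong proj₁ eq , cong proj₂ eq) ((b ≟ˢ b′) ×-dec (s ≟ˢ s′))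

  kind : ∀ l → Kind l
  kind l = split (any? λ i → l ≟ᴸ extraᴸ i) (any? λ j → l ≟ᴸ pointᴸ j)
    where
    split : Dec (∃ λ i → l ≡ extraᴸ i) → Dec (∃ λ j → l ≡ pointᴸ j) → Kind l
    split (yes (i , eq)) _ = extraK i eq
    split (no _) (yes (j , eq)) = pointK j eq
    split (no ne) (no ne′) = otherK (λ i eq → ne (i , eq)) (λ j eq → ne′ (j , eq))

  Colour : Set
  Colour = Fin (2 ℕ.+ k)

  colour : ∀ {l} → Kind l → Colour
  colour (extraK i _) = F.suc (F.suc i)
  colour (pointK _ _) = F.suc F.zero
  colour (otherK _ _) = F.zero

  colour-unique : ∀ {l} (c c′ : Kind l) → colour c ≡ colour c′
  colour-unique (extraK i eq) (extraK i′ eq′) = cong (F.suc ∘ F.suc) (⁅⁆-injective (cong proj₁ (trans (sym eq) eq′)))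
  colour-unique (extraK i eq) (pointK j eq′) = ⊥-elim (⁅⁆≢∅ (cong proj₁ (trans (sym eq) eq′)))
  colour-unique (extraK i eq) (otherK ne _) = ⊥-elim (ne i eq)
  colour-unique (pointK j eq) (extraK i eq′) = ⊥-elim (⁅⁆≢∅ (cong proj₁ (trans (sym eq′) eq)))
  colour-unique (pointK _ _) (pointK _ _) = refl
  colour-unique (pointK j eq) (otherK _ ne) = ⊥-elim (ne j eq)
  colour-unique (otherK ne _) (extraK i eq) = ⊥-elim (ne i eq)
  colour-unique (otherK _ ne) (pointK j eq) = ⊥-elim (ne j eq)
  colour-unique (otherK _ _) (otherK _ _) = refl

  col : Fin w → Colour
  col x = colour (kind (elt x))

  col-kind : ∀ {x} (c : Kind (elt x)) → col x ≡ colour c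
  col-kind {x} c = colour-unique (kind (elt x)) c

  col-extra : ∀ i → col (extra i) ≡ F.suc (F.suc i)
  col-extra i = col-kind (extraK i (elt-extra i))

  col-point : ∀ j → col (point j) ≡ F.suc F.zero
  col-point j = col-kind (pointK j (elt-point j))

  extra-col : ∀ {x i} → col x ≡ F.suc (F.suc i) → x ≡ extra i
  extra-col {x} {i} eq = go (kind (elt x)) refl
    where
    go : ∀ c → kind (elt x) ≡ c → x ≡ extra i
    go (extraK i′ el≡) eq′ with trans (sym (cong colour eq′)) eq
    ... | refl = elt-injective (trans el≡ (sym (elt-extra i)))
    go (pointK _ _) eq′ = case trans (sym (cong colour eq′)) eq of λ ()
    go (otherK _ _) eq′ = case trans (sym (cong colour eq′)) eq of λ ()

  point-col : ∀ {x} → col x ≡ F.suc F.zero → ∃ λ j → x ≡ point j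
  point-col {x} eq = go (kind (elt x)) refl
    where
    go : ∀ c → kind (elt x) ≡ c → ∃ λ j → x ≡ point j
    go (extraK _ _) eq′ = case trans (sym (cong colour eq′)) eq of λ ()
    go (pointK j el≡) _ = j , elt-injective (trans el≡ (sym (elt-point j)))
    go (otherK _ _) eq′ = case trans (sym (cong colour eq′)) eq of λ ()

  e₀ e₁ : Subset k
  e₀ = ⁅ F.zero ⁆
  e₁ = ⁅ F.suc F.zero ⁆

  -- A sum of two extra vectors is neither a basis vector nor a point of V; it witnesses that the
  -- colour of unmarked points occurs.
  plain : Fin w
  plain = index (e₀ △ e₁ , ∅) λ ()

  elt-plain : elt plain ≡ (e₀ △ e₁ , ∅)
  elt-plain = elt-index _ λ ()

  col-plain : col plain ≡ F.zero
  col-plain = col-kind (otherK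
    (λ i eq → two≢one i (cong proj₁ (trans (sym elt-plain) eq)))
    (λ j eq → case cong proj₁ (trans (sym elt-plain) eq) of λ ()))
    where
    two≢one : ∀ i → e₀ △ e₁ ≢ ⁅ i ⁆
    two≢one i eq = case trans (sym (∣pair∣ {k} {F.zero} {F.suc F.zero} λ ())) (trans (cong ∣_∣ eq) (∣⁅x⁆∣≡1 i)) of λ ()

  -- Products inside the subspace of V are switched and do not give sums. The element `(b , s)` is
  -- therefore reached through the layer of `e₀`, where adding a singleton is a plain product, and
  -- one final product moves it to the layer of `b`.
  generated : (Q : L k → Set) → Q ε → (∀ l m → Q l → Q m → Q (l • m)) →
    (∀ i → Q (extraᴸ i)) → (∀ j → Q (pointᴸ j)) → ∀ l → Q l
  generated Q qε q• q-extra q-point (b , s) = subst Q eq (q• _ _ (lifted s) (extras (e₀ △ b)))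
    where
    extras : ∀ b → Q (b , ∅)
    extras = △-generated _ qε λ b i qb → subst Q
      (trans (•-outer k (⁅⁆≢∅ ∘ proj₂) ∅ ∅) (cong (b △ ⁅ i ⁆ ,_) (△-self ∅))) (q• _ _ qb (q-extra i))
    e₀≢∅ : e₀ ≢ ∅
    e₀≢∅ ()
    lifted : ∀ s → Q (e₀ , s)
    lifted = △-generated _ (q-extra F.zero) λ s j qs → subst Q
      (trans (•-outer k (e₀≢∅ ∘ proj₁) s ⁅ j ⁆) (cong (_, s △ ⁅ j ⁆) (△∅ e₀))) (q• _ _ qs (q-point j))
    eq : (e₀ , s) • (e₀ △ b , ∅) ≡ (b , s)
    eq = trans (•-outer k (e₀≢∅ ∘ proj₁) s ∅) (cong₂ _,_ (△-invol e₀ b) (△∅ s))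

  homs-equal : ∀ (f g : Fin w → Fin w) → (∀ i j → f (i ⋆ j) ≡ f i ⋆ f j) → (∀ i j → g (i ⋆ j) ≡ g i ⋆ g j) →
    (∀ i → f (extra i) ≡ g (extra i)) → (∀ j → f (point j) ≡ g (point j)) → ∀ x → f x ≡ g x
  homs-equal f g f-hom g-hom same-extra same-point x = generated (λ l → ∀ i → elt i ≡ l → f i ≡ g i)
    (proj₁ agree) (proj₂ agree)
    (λ i y eq → subst (λ z → f z ≡ g z) (sym (elt-injective (trans eq (sym (elt-extra i))))) (same-extra i))
    (λ j y eq → subst (λ z → f z ≡ g z) (sym (elt-injective (trans eq (sym (elt-point j))))) (same-point j))
    (elt x) x refl
    where
    agree = homs-agree f g f-hom g-hom

  module Lift (τ : Aut V) where
    private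
      t : Permutation′ v
      t = proj₁ τ

    liftᴸ : L k → L k
    liftᴸ (b , s) = b , t · s

    lift≢ε : ∀ x → liftᴸ (elt x) ≢ ε
    lift≢ε x eq = elt≢ε x (cong₂ _,_ (cong proj₁ eq) (·-injective t (trans (cong proj₂ eq) (sym (Action.·-∅ t)))))

    liftᴸ-• : ∀ l m → liftᴸ (l • m) ≡ liftᴸ l • liftᴸ m
    liftᴸ-• (b , s) (b′ , s′) = case (b ≟ˢ ∅) ×-dec (b′ ≟ˢ ∅) of λ where
      (yes (refl , refl)) → trans (cong liftᴸ (•-inner k s s′)) (trans (cong (∅ ,_) (·-∘ˢ V t (proj₂ τ) s s′)) (sym (•-inner k _ _)))
      (no ne) → trans (cong liftᴸ (•-outer k ne s s′)) (trans (cong (b △ b′ ,_) (Action.·-△ t s s′)) (sym (•-outer k ne _ _)))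

    lift : Fin w → Fin w
    lift x = index (liftᴸ (elt x)) (lift≢ε x)

    elt-lift : ∀ x → elt (lift x) ≡ liftᴸ (elt x)
    elt-lift x = elt-index _ (lift≢ε x)

    lift-injective : ∀ {x y} → lift x ≡ lift y → x ≡ y
    lift-injective {x} {y} eq = elt-injective (cong₂ _,_ (cong proj₁ eq′) (·-injective t (cong proj₂ eq′)))
      where
      eq′ : liftᴸ (elt x) ≡ liftᴸ (elt y)
      eq′ = trans (sym (elt-lift x)) (trans (cong elt eq) (elt-lift y))

    lift-hom : ∀ x y → lift (x ⋆ y) ≡ lift x ⋆ lift y
    lift-hom x y = case x F.≟ y of λ where
      (yes refl) → trans (cong lift (⋆-idem x)) (sym (⋆-idem (lift x)))
      (no x≢y) → elt-injective (trans (elt-lift (x ⋆ y)) (trans (cong liftᴸ (elt-⋆ x≢y)) (trans (liftᴸ-• (elt x) (elt y))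
        (trans (cong₂ _•_ (sym (elt-lift x)) (sym (elt-lift y))) (sym (elt-⋆ (x≢y ∘ lift-injective)))))))

    lift-extra : ∀ i → lift (extra i) ≡ extra i
    lift-extra i = elt-injective (trans (elt-lift (extra i)) (trans (cong liftᴸ (elt-extra i))
      (trans (cong (⁅ i ⁆ ,_) (Action.·-∅ t)) (sym (elt-extra i)))))

    lift-point : ∀ j → lift (point j) ≡ point (t ⟨$⟩ʳ j)
    lift-point j = elt-injective (trans (elt-lift (point j)) (trans (cong liftᴸ (elt-point j))
      (trans (cong (∅ ,_) (Action.·-⁅⁆ t j)) (sym (elt-point (t ⟨$⟩ʳ j))))))

    col-lift : ∀ x → col (lift x) ≡ col x
    col-lift x = go (kind (elt x)) refl
      where
      at : ∀ {l} → elt (lift x) ≡ l → Kind l → Kind (elt (lift x))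
      at eq c = subst Kind (sym eq) c
      unlift : ∀ {l m} → liftᴸ l ≡ liftᴸ m → l ≡ m
      unlift eq = cong₂ _,_ (cong proj₁ eq) (·-injective t (cong proj₂ eq))
      go : ∀ c → kind (elt x) ≡ c → col (lift x) ≡ col x
      go (extraK i eq) eq′ = trans (cong col (trans (cong lift (elt-injective (trans eq (sym (elt-extra i))))) (lift-extra i)))
        (trans (col-extra i) (sym (cong colour eq′)))
      go (pointK j eq) eq′ = trans (cong col (trans (cong lift (elt-injective (trans eq (sym (elt-point j))))) (lift-point j)))
        (trans (col-point (t ⟨$⟩ʳ j)) (sym (cong colour eq′)))
      go (otherK ne ne′) eq′ = trans (col-kind (otherK
        (λ i eq → ne i (unlift (trans (sym (elt-lift x)) (trans eq (cong (⁅ i ⁆ ,_) (sym (Action.·-∅ t)))))))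
        (λ j eq → ne′ (t ⟨$⟩ˡ j) (unlift (trans (sym (elt-lift x)) (trans eq (cong (∅ ,_)
          (sym (trans (Action.·-⁅⁆ t _) (cong ⁅_⁆ (Perm.inverseʳ t)))))))))))
        (sym (cong colour eq′))

  -- Three-fold sums can be bracketed in two ways, which forces f to be constant and then 3 f = 0.
  no-affine : ∀ {h} (let open ℤ/ h) → (∀ a → 3 ⊛ a ≡ 0# → a ≡ 0#) →
    ∀ (f : Fin w → A) → (∀ x y → x ≢ y → f (x ⋆ y) ≡ - (f x + f y)) → ∀ x → f x ≡ 0#
  no-affine {h} torsion f affine x = trans (constant x) (torsion _ (trans
    (solve (v0 :+ (v0 :+ (v0 :+ :0))) ((v0 :+ v0) :+ v0) (c ∷ []) refl)
    (trans (cong (c + c +_) (trans (sym (constant (o ⋆ plain))) (trans (affine o plain o≢plain) (cong (λ z → - (c + z)) (constant plain)))))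
      (solve ((v0 :+ v0) :− (v0 :+ v0)) :0 (c ∷ []) refl))))
    where
    open ℤ/ h
    o : Fin w
    o = extra F.zero
    c : A
    c = f o
    o≢plain : o ≢ plain
    o≢plain eq = case cong proj₁ (trans (sym (elt-extra F.zero)) (trans (cong elt eq) elt-plain)) of λ ()
    module Via (y : Fin w) (y≢o : y ≢ o) (i : Fin k) (i≢0 : i ≢ F.zero)
      (b≢ : proj₁ (elt y) ≢ ⁅ i ⁆) (b≢′ : proj₁ (elt y) ≢ ⁅ i ⁆ △ e₀) where
      b : Subset k
      b = proj₁ (elt y)
      s : Subset v
      s = proj₂ (elt y)
      X : Fin w
      X = extra i
      X≢y : X ≢ y
      X≢y eq = b≢ (cong proj₁ (trans (cong elt (sym eq)) (elt-extra i)))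
      X≢o : X ≢ o
      X≢o eq = i≢0 (⁅⁆-injective (cong proj₁ (trans (sym (elt-extra i)) (trans (cong elt eq) (elt-extra F.zero)))))
      elt-Xy : elt (X ⋆ y) ≡ (⁅ i ⁆ △ b , ∅ △ s)
      elt-Xy = trans (elt-⋆ X≢y) (trans (cong (_• elt y) (elt-extra i)) (•-outer k (⁅⁆≢∅ ∘ proj₁) ∅ s))
      elt-Xo : elt (X ⋆ o) ≡ (⁅ i ⁆ △ e₀ , ∅ △ ∅)
      elt-Xo = trans (elt-⋆ X≢o) (trans (cong₂ _•_ (elt-extra i) (elt-extra F.zero)) (•-outer k (⁅⁆≢∅ ∘ proj₁) ∅ ∅))
      Xy≢o : X ⋆ y ≢ o
      Xy≢o eq = b≢′ (△-cancelˡ ⁅ i ⁆ (trans (cong proj₁ (trans (sym elt-Xy) (trans (cong elt eq) (elt-extra F.zero)))) (sym (△-invol ⁅ i ⁆ e₀))))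
      Xo≢y : X ⋆ o ≢ y
      Xo≢y eq = b≢′ (sym (cong proj₁ (trans (sym elt-Xo) (cong elt eq))))
      bracket : (X ⋆ y) ⋆ o ≡ (X ⋆ o) ⋆ y
      bracket = elt-injective (trans (elt-⋆ Xy≢o) (trans (cong₂ _•_ elt-Xy (elt-extra F.zero))
        (trans (•-outer k (λ (eq , _) → b≢ (sym (△≡∅ eq))) _ _) (trans (cong₂ _,_ swap (trans (△∅ _) (cong (_△ s) (sym (△-self ∅)))))
        (trans (sym (•-outer k (λ (eq , _) → i≢0 (⁅⁆-injective (△≡∅ eq))) (∅ △ ∅) s)) (sym (trans (elt-⋆ Xo≢y) (cong (_• elt y) elt-Xo))))))))
        where
        swap : (⁅ i ⁆ △ b) △ e₀ ≡ (⁅ i ⁆ △ e₀) △ b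
        swap = trans (△-assoc _ b e₀) (trans (cong (⁅ i ⁆ △_) (△-comm b e₀)) (sym (△-assoc _ e₀ b)))
      -- The two bracketings evaluate to f X + f y - c and f X + c - f y.
      same : f y ≡ c
      same = double-injective (cancelʳ _ _ (f X − (f y + c)) (trans
        (solve ((v1 :+ v1) :+ (v0 :− (v1 :+ v2))) (:- (:- (v0 :+ v1) :+ v2)) (f X ∷ f y ∷ c ∷ []) refl)
        (trans (sym (trans (affine (X ⋆ y) o Xy≢o) (cong (λ z → - (z + c)) (affine X y X≢y))))
        (trans (cong f bracket) (trans (trans (affine (X ⋆ o) y Xo≢y) (cong (λ z → - (z + f y)) (affine X o X≢o)))
        (solve (:- (:- (v0 :+ v2) :+ v1)) ((v2 :+ v2) :+ (v0 :− (v1 :+ v2))) (f X ∷ f y ∷ c ∷ []) refl))))))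
    constant : ∀ y → f y ≡ c
    constant y = split (y F.≟ o) (proj₁ (elt y) ≟ˢ e₁) (proj₁ (elt y) ≟ˢ e₁ △ e₀)
      where
      split : Dec (y ≡ o) → Dec (proj₁ (elt y) ≡ e₁) → Dec (proj₁ (elt y) ≡ e₁ △ e₀) → f y ≡ c
      split (yes refl) _ _ = refl
      -- The auxiliary vector `X` must differ from `y`, and `X ⋆ y` from `o`. If `e₁` fails for this
      -- `y`, the next basis vector succeeds.
      split (no y≢o) (no ne) (no ne′) = Via.same y y≢o (F.suc F.zero) (λ ()) ne ne′
      split (no y≢o) (yes eq) _ = Via.same y y≢o (F.suc (F.suc F.zero)) (λ ())
        (λ eq′ → case trans (sym eq) eq′ of λ ()) (λ eq′ → case trans (sym eq) eq′ of λ ())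
      split (no y≢o) (no _) (yes eq) = Via.same y y≢o (F.suc (F.suc F.zero)) (λ ())
        (λ eq′ → case trans (sym eq) eq′ of λ ()) (λ eq′ → case trans (sym eq) eq′ of λ ())

-- Conversion between squags and Steiner triple systems

does-true : ∀ {P : Set} (d : Dec P) → does d ≡ true → P
does-true (yes q) _ = q

true-iff⇒≡ : ∀ {a b} → (a ≡ true → b ≡ true) → (b ≡ true → a ≡ true) → a ≡ b
true-iff⇒≡ {false} {false} _ _ = refl
true-iff⇒≡ {false} {true} _ g = g refl
true-iff⇒≡ {true} {b} f _ = sym (f refl)

IsHom : ∀ {X : Set} → Squag X → (X → X) → Set
IsHom Q σ = ∀ x y → σ (x ∙ y) ≡ σ x ∙ σ y
  where open Squag Q

module SquagSTS {u : ℕ} (Q : Squag (Fin u)) where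
  open Squag Q

  Block : Subset u → Set
  Block S = ∃ λ x → ∃ λ y → x ≢ y × S ≡ tri x y (x ∙ y)

  block? : ∀ S → Dec (Block S)
  block? S = any? λ x → any? λ y → ¬? (x F.≟ y) ×-dec (S ≟ˢ tri x y (x ∙ y))

  isT : Subset u → Bool
  isT S = does (block? S)

  block⇒isT : ∀ {S} → Block S → isT S ≡ true
  block⇒isT {S} = dec-true (block? S)

  isT⇒block : ∀ {S} → isT S ≡ true → Block S
  isT⇒block {S} = does-true (block? S)

  ∣block∣ : ∀ {S} → Block S → ∣ S ∣ ≡ 3
  ∣block∣ (x , y , x≢y , refl) = ∣tri∣ x≢y (λ eq → x≢y (∙≡ˡ (sym eq))) (λ eq → x≢y (∙≡ʳ (sym eq)))

  block-member : ∀ {x y a} → a ∈ tri x y (x ∙ y) → a ≡ x ⊎ (a ≡ y ⊎ a ≡ x ∙ y)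
  block-member {x} {y} {a} a∈ = split (a F.≟ x) (a F.≟ y)
    where
    split : Dec (a ≡ x) → Dec (a ≡ y) → a ≡ x ⊎ (a ≡ y ⊎ a ≡ x ∙ y)
    split (yes eq) _ = inj₁ eq
    split (no _) (yes eq) = inj₂ (inj₁ eq)
    split (no ne) (no ne′) = inj₂ (inj₂ (tri-∈⁻ a∈ ne ne′))

  block-closed : ∀ {S} → Block S → ∀ {a b} → a ≢ b → a ∈ S → b ∈ S → a ∙ b ∈ S
  block-closed (x , y , x≢y , refl) {a} {b} a≢b a∈ b∈ = go (block-member a∈) (block-member b∈)
    where
    x≢xy : x ≢ x ∙ y
    x≢xy eq = x≢y (∙≡ˡ (sym eq))
    y≢xy : y ≢ x ∙ y
    y≢xy eq = x≢y (∙≡ʳ (sym eq))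
    T = tri x y (x ∙ y)
    x∈ : x ∈ T
    x∈ = tri-∈₁ x≢y x≢xy
    y∈ : y ∈ T
    y∈ = tri-∈₂ x≢y y≢xy
    xy∈ : x ∙ y ∈ T
    xy∈ = tri-∈₃ x≢xy y≢xy
    x-xy : x ∙ (x ∙ y) ∈ T
    x-xy = subst (_∈ T) (sym (invol x y)) y∈
    y-xy : y ∙ (x ∙ y) ∈ T
    y-xy = subst (_∈ T) (sym (trans (cong (y ∙_) (comm x y)) (invol y x))) x∈
    go : a ≡ x ⊎ (a ≡ y ⊎ a ≡ x ∙ y) → b ≡ x ⊎ (b ≡ y ⊎ b ≡ x ∙ y) → a ∙ b ∈ T
    go (inj₁ refl) (inj₁ refl) = ⊥-elim (a≢b refl)
    go (inj₁ refl) (inj₂ (inj₁ refl)) = xy∈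
    go (inj₁ refl) (inj₂ (inj₂ refl)) = x-xy
    go (inj₂ (inj₁ refl)) (inj₁ refl) = subst (_∈ T) (comm x y) xy∈
    go (inj₂ (inj₁ refl)) (inj₂ (inj₁ refl)) = ⊥-elim (a≢b refl)
    go (inj₂ (inj₁ refl)) (inj₂ (inj₂ refl)) = y-xy
    go (inj₂ (inj₂ refl)) (inj₁ refl) = subst (_∈ T) (comm x _) x-xy
    go (inj₂ (inj₂ refl)) (inj₂ (inj₁ refl)) = subst (_∈ T) (comm y _) y-xy
    go (inj₂ (inj₂ refl)) (inj₂ (inj₂ refl)) = ⊥-elim (a≢b refl)

  block-through : ∀ {S} → Block S → ∀ {a b} → a ≢ b → a ∈ S → b ∈ S → S ≡ tri a b (a ∙ b)
  block-through {S} B {a} {b} a≢b a∈ b∈ = let (z , S≡ , _ , _) = three-points (∣block∣ B) a≢b a∈ b∈ in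
    trans S≡ (cong (tri a b) (sym (tri-∈⁻ (subst (a ∙ b ∈_) S≡ (block-closed B a≢b a∈ b∈))
      (λ eq → a≢b (∙≡ˡ eq)) (λ eq → a≢b (∙≡ʳ eq)))))

  sts : STS u
  sts = record
    { psts = record
      { isTriple = isT
      ; triple-3 = λ S eq → ∣block∣ (isT⇒block eq)
      ; at-most-one = λ x y x≢y S T tS tT xS yS xT yT →
          trans (block-through (isT⇒block tS) x≢y xS yS) (sym (block-through (isT⇒block tT) x≢y xT yT)) }
    ; isSTS = λ x y x≢y → tri x y (x ∙ y) , block⇒isT (x , y , x≢y , refl) ,
        tri-∈₁ x≢y (λ eq → x≢y (∙≡ˡ (sym eq))) , tri-∈₂ x≢y (λ eq → x≢y (∙≡ʳ (sym eq))) }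

  hom-block : ∀ (σ : Permutation′ u) → IsHom Q (σ ⟨$⟩ʳ_) → ∀ {S} → Block S → Block (σ · S)
  hom-block σ hom (x , y , x≢y , refl) = σ ⟨$⟩ʳ x , σ ⟨$⟩ʳ y ,
    (λ eq → x≢y (trans (sym (Perm.inverseˡ σ)) (trans (cong (σ ⟨$⟩ˡ_) eq) (Perm.inverseˡ σ)))) ,
    trans (Action.·-tri σ x y (x ∙ y)) (cong (tri _ _) (hom x y))

  flip-hom : ∀ (σ : Permutation′ u) → IsHom Q (σ ⟨$⟩ʳ_) → IsHom Q (flip σ ⟨$⟩ʳ_)
  flip-hom σ hom x y = trans (cong (σ ⟨$⟩ˡ_) (trans (cong₂ _∙_ (sym (Perm.inverseʳ σ)) (sym (Perm.inverseʳ σ))) (sym (hom _ _))))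
    (Perm.inverseˡ σ)

  hom⇒aut : ∀ (σ : Permutation′ u) → IsHom Q (σ ⟨$⟩ʳ_) → IsAut (psts sts) σ
  hom⇒aut σ hom S = true-iff⇒≡
    (λ eq → block⇒isT (subst Block (flip-· σ S) (hom-block (flip σ) (flip-hom σ hom) (isT⇒block eq))))
    (λ eq → block⇒isT (hom-block σ hom (isT⇒block eq)))

  aut⇒hom : ∀ (σ : Permutation′ u) → IsAut (psts sts) σ → IsHom Q (σ ⟨$⟩ʳ_)
  aut⇒hom σ aut x y = case x F.≟ y of λ where
      (yes refl) → trans (cong (σ ⟨$⟩ʳ_) (idem x)) (sym (idem _))
      (no x≢y) → at x≢y
    where
    s : Fin u → Fin u
    s = σ ⟨$⟩ʳ_
    s-inj : ∀ {a b} → s a ≡ s b → a ≡ b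
    s-inj eq = trans (sym (Perm.inverseˡ σ)) (trans (cong (σ ⟨$⟩ˡ_) eq) (Perm.inverseˡ σ))
    at : x ≢ y → s (x ∙ y) ≡ s x ∙ s y
    at x≢y = ⁅⁆-injective (△-cancelˡ (⁅ s x ⁆ △ ⁅ s y ⁆) (block-through B (x≢y ∘ s-inj)
        (tri-∈₁ (x≢y ∘ s-inj) λ eq → x≢y (∙≡ˡ (sym (s-inj eq))))
        (tri-∈₂ (x≢y ∘ s-inj) λ eq → x≢y (∙≡ʳ (sym (s-inj eq))))))
      where
      B : Block (tri (s x) (s y) (s (x ∙ y)))
      B = subst Block (Action.·-tri σ x y (x ∙ y)) (isT⇒block (trans (aut _) (block⇒isT (x , y , x≢y , refl))))

any-zipWith⁺ : ∀ {n} {X : Set} (g : X → Bool → Bool) (xs : Vec X n) (S : Subset n) i →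
  g (lookup xs i) (lookup S i) ≡ true → foldr′ _∨_ false (zipWith g xs S) ≡ true
any-zipWith⁺ g (x ∷ xs) (s ∷ S) F.zero eq = cong (_∨ foldr′ _∨_ false (zipWith g xs S)) eq
any-zipWith⁺ g (x ∷ xs) (s ∷ S) (F.suc i) eq = trans (cong (g x s ∨_) (any-zipWith⁺ g xs S i eq)) (𝔹.∨-zeroʳ _)

any-zipWith⁻ : ∀ {n} {X : Set} (g : X → Bool → Bool) (xs : Vec X n) (S : Subset n) →
  foldr′ _∨_ false (zipWith g xs S) ≡ true → ∃ λ i → g (lookup xs i) (lookup S i) ≡ true
any-zipWith⁻ g [] [] ()
any-zipWith⁻ g (x ∷ xs) (s ∷ S) eq = go (g x s) refl
  where
  go : ∀ e → g x s ≡ e → ∃ λ i → g (lookup (x ∷ xs) i) (lookup (s ∷ S) i) ≡ true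
  go true eq′ = F.zero , eq′
  go false eq′ = let (i , eq″) = any-zipWith⁻ g xs S (trans (cong (_∨ foldr′ _∨_ false (zipWith g xs S)) (sym eq′)) eq) in F.suc i , eq″

-- Images of triples under an embedding

module Image {v u : ℕ} (f : Fin v → Fin u) where

  img-∈ : ∀ {S x} → x ∈ S → f x ∈ img f S
  img-∈ {S} {x} x∈ = true-∈ (trans (lookup∘tabulate _ (f x)) (any-zipWith⁺ _ (allFin v) S x
    (trans (cong₂ (λ z b → b ∧ does (f z F.≟ f x)) (lookup-allFin x) (∈-true x∈)) (dec-true (f x F.≟ f x) refl))))

  ∈-img : ∀ {S y} → y ∈ img f S → ∃ λ x → x ∈ S × f x ≡ y
  ∈-img {S} {y} y∈ = x , true-∈ (proj₁ both) , does-true (f x F.≟ y) (proj₂ both)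
    where
    found = any-zipWith⁻ (λ z b → b ∧ does (f z F.≟ y)) (allFin v) S (trans (sym (lookup∘tabulate _ y)) (∈-true y∈))
    x = proj₁ found
    ∧-true : ∀ {a b} → a ∧ b ≡ true → a ≡ true × b ≡ true
    ∧-true {true} eq = refl , eq
    both : lookup S x ≡ true × does (f x F.≟ y) ≡ true
    both = ∧-true (trans (cong (λ z → lookup S x ∧ does (f z F.≟ y)) (sym (lookup-allFin x))) (proj₂ found))

  ⊆-antisym′ : ∀ {n} {S T : Subset n} → S ⊆ T → T ⊆ S → S ≡ T
  ⊆-antisym′ S⊆T T⊆S = subset-ext λ x → true-iff⇒≡ (λ eq → ∈-true (S⊆T (true-∈ eq))) (λ eq → ∈-true (T⊆S (true-∈ eq)))

  module _ (f-injective : Injective _≡_ _≡_ f) where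

    img-injective : ∀ {S T} → img f S ≡ img f T → S ≡ T
    img-injective {S} {T} eq = ⊆-antisym′ (half′ eq) (half′ (sym eq))
      where
      half′ : ∀ {S T} → img f S ≡ img f T → S ⊆ T
      half′ {S} {T} eq {x} x∈ = let (y , y∈ , fy≡) = ∈-img {T} (subst (f x ∈_) eq (img-∈ x∈)) in
        subst (_∈ T) (f-injective fy≡) y∈

    img-tri : ∀ {x y z} → x ≢ y → x ≢ z → y ≢ z → img f (tri x y z) ≡ tri (f x) (f y) (f z)
    img-tri {x} {y} {z} x≢y x≢z y≢z = ⊆-antisym′ to from
      where
      to : img f (tri x y z) ⊆ tri (f x) (f y) (f z)
      to b∈ with ∈-img {tri x y z} b∈
      ... | a , a∈ , refl = split (a F.≟ x) (a F.≟ y)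
        where
        split : Dec (a ≡ x) → Dec (a ≡ y) → f a ∈ tri (f x) (f y) (f z)
        split (yes refl) _ = tri-∈₁ (x≢y ∘ f-injective) (x≢z ∘ f-injective)
        split (no _) (yes refl) = tri-∈₂ (x≢y ∘ f-injective) (y≢z ∘ f-injective)
        split (no ne) (no ne′) = subst (λ c → f c ∈ tri (f x) (f y) (f z)) (sym (tri-∈⁻ a∈ ne ne′))
          (tri-∈₃ (x≢z ∘ f-injective) (y≢z ∘ f-injective))
      from : tri (f x) (f y) (f z) ⊆ img f (tri x y z)
      from {b} b∈ = split (b F.≟ f x) (b F.≟ f y)
        where
        split : Dec (b ≡ f x) → Dec (b ≡ f y) → b ∈ img f (tri x y z)
        split (yes refl) _ = img-∈ (tri-∈₁ x≢y x≢z)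
        split (no _) (yes refl) = img-∈ (tri-∈₂ x≢y y≢z)
        split (no ne) (no ne′) = subst (_∈ img f (tri x y z)) (sym (tri-∈⁻ b∈ ne ne′)) (img-∈ (tri-∈₃ x≢z y≢z))

two-points : ∀ {n} {S : Subset n} → ∣ S ∣ ≡ 3 → ∃ λ x → ∃ λ y → x ≢ y × x ∈ S × y ∈ S
two-points {n} {S} eq = x , y , x≢y , x∈ , true-∈ (trans (sym (𝔹.xor-identityʳ _))
    (trans (cong (lookup S y xor_) (sym (lookup-⁅y⁆ (x≢y ∘ sym)))) (trans (sym (lookup-△ S ⁅ x ⁆ y)) (∈-true y∈′))))
  where
  S≢∅ : S ≢ ∅
  S≢∅ eq′ = case trans (sym eq) (trans (cong ∣_∣ eq′) (∣⊥∣≡0 n)) of λ ()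
  x = proj₁ (∅≢⇒∈ S S≢∅)
  x∈ = proj₂ (∅≢⇒∈ S S≢∅)
  rest≢∅ : S △ ⁅ x ⁆ ≢ ∅
  rest≢∅ eq′ = case trans (sym eq) (trans (sym (∣△⁅∈⁆∣ x∈)) (cong suc (trans (cong ∣_∣ eq′) (∣⊥∣≡0 n)))) of λ ()
  y = proj₁ (∅≢⇒∈ (S △ ⁅ x ⁆) rest≢∅)
  y∈′ = proj₂ (∅≢⇒∈ (S △ ⁅ x ⁆) rest≢∅)
  x≢y : x ≢ y
  x≢y x≡y = case trans (sym (∈-true y∈′)) (trans (cong (lookup (S △ ⁅ x ⁆)) (sym x≡y)) (trans (lookup-△ S ⁅ x ⁆ x) (cong₂ _xor_ (∈-true x∈) (lookup-⁅x⁆ x)))) of λ ()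

Realizes : ∀ {v} → PSTS v → ℕ → Set
Realizes {v} V u = Σ (STS u) λ U → Σ (Fin v → Fin u) λ f →
  IsSubsystem V (psts U) f
  × (∀ (σ : Aut (psts U)) (x : Fin v) → ∃ λ y → proj₁ σ ⟨$⟩ʳ f x ≡ f y)
  × (∀ (σ : Aut (psts U)) → Σ (Aut V) λ τ → ∀ x → proj₁ σ ⟨$⟩ʳ f x ≡ f (proj₁ τ ⟨$⟩ʳ x))
  × (∀ (τ : Aut V) → Σ (Aut (psts U)) λ σ → ∀ x → proj₁ σ ⟨$⟩ʳ f x ≡ f (proj₁ τ ⟨$⟩ʳ x))
  × AutIso (psts U) V

transport : ∀ {X Y : Set} → X ↔ Y → Squag X → Squag Y
transport e Q = record
  { _∙_ = λ x y → to (from x ∙ from y)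
  ; idem = λ x → trans (cong to (idem (from x))) (to-from x)
  ; comm = λ x y → cong to (comm (from x) (from y))
  ; invol = λ x y → trans (cong (λ z → to (from x ∙ z)) (from-to _)) (trans (cong to (invol (from x) (from y))) (to-from y)) }
  where
  open Squag Q
  open Inverse e using (to; from)
  to-from : ∀ y → to (from y) ≡ y
  to-from y = Inverse.inverseˡ e refl
  from-to : ∀ x → from (to x) ≡ x
  from-to x = Inverse.inverseʳ e refl

-- From a squag with an embedding and lifts to the required triple system

module Assemble {v : ℕ} (V : PSTS v) {C : Set} (Q : Squag C) {u : ℕ} (e : C ↔ Fin u)
  (f : Fin v → C) (f-injective : ∀ {x y} → f x ≡ f y → x ≡ y)
  (triple⇒∙ : ∀ {x y z} → x ≢ y → x ≢ z → y ≢ z → isTriple V (tri x y z) ≡ true → Squag._∙_ Q (f x) (f y) ≡ f z)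
  (∙⇒triple : ∀ {x y z} → x ≢ y → Squag._∙_ Q (f x) (f y) ≡ f z → isTriple V (tri x y z) ≡ true)
  (lift : Aut V → C → C) (lift-hom : ∀ τ → IsHom Q (lift τ))
  (lift-f : ∀ τ x → lift τ (f x) ≡ f (proj₁ τ ⟨$⟩ʳ x))
  (lift-cong : ∀ τ τ′ → proj₁ τ Perm.≈ proj₁ τ′ → ∀ c → lift τ c ≡ lift τ′ c)
  (lift-inverse : ∀ τ τ′ → (∀ x → proj₁ τ ⟨$⟩ʳ (proj₁ τ′ ⟨$⟩ʳ x) ≡ x) → ∀ c → lift τ (lift τ′ c) ≡ c)
  (classify : ∀ (σ σ⁻¹ : C → C) → IsHom Q σ → (∀ c → σ (σ⁻¹ c) ≡ c) → (∀ c → σ⁻¹ (σ c) ≡ c) →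
    Σ (Aut V) λ τ → ∀ c → σ c ≡ lift τ c) where

  open Squag Q using (_∙_)
  open Inverse e using (to; from)

  private
    to-from : ∀ y → to (from y) ≡ y
    to-from y = Inverse.inverseˡ e refl
    from-to : ∀ x → from (to x) ≡ x
    from-to x = Inverse.inverseʳ e refl

  Q′ : Squag (Fin u)
  Q′ = transport e Q

  open Squag Q′ using () renaming (_∙_ to _∙′_; ∙≡ˡ to ∙′≡ˡ; ∙≡ʳ to ∙′≡ʳ)
  open SquagSTS Q′

  g : Fin v → Fin u
  g = to ∘ f

  g-injective : Injective _≡_ _≡_ g
  g-injective eq = f-injective (trans (sym (from-to _)) (trans (cong from eq) (from-to _)))

  g-∙ : ∀ x y → g x ∙′ g y ≡ to (f x ∙ f y)
  g-∙ x y = cong to (cong₂ _∙_ (from-to (f x)) (from-to (f y)))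

  open Image g

  subsystem : ∀ S → isT (img g S) ≡ isTriple V S
  subsystem S = true-iff⇒≡ (λ eq → ⇒triple (isT⇒block eq)) (λ eq → block⇒isT (⇒block eq))
    where
    ⇒triple : Block (img g S) → isTriple V S ≡ true
    ⇒triple (a , b , a≢b , img≡) = through
        (∈-img {S} (subst (a ∈_) (sym img≡) (tri-∈₁ a≢b a≢ab)))
        (∈-img {S} (subst (b ∈_) (sym img≡) (tri-∈₂ a≢b b≢ab)))
        (∈-img {S} (subst (a ∙′ b ∈_) (sym img≡) (tri-∈₃ a≢ab b≢ab)))
      where
      a≢ab : a ≢ a ∙′ b
      a≢ab eq = a≢b (∙′≡ˡ (sym eq))
      b≢ab : b ≢ a ∙′ b
      b≢ab eq = a≢b (∙′≡ʳ (sym eq))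
      through : (∃ λ x → x ∈ S × g x ≡ a) → (∃ λ y → y ∈ S × g y ≡ b) → (∃ λ z → z ∈ S × g z ≡ a ∙′ b) →
        isTriple V S ≡ true
      through (x , _ , refl) (y , _ , refl) (z , _ , gz≡) = subst (λ T → isTriple V T ≡ true)
          (img-injective g-injective (trans (img-tri g-injective x≢y x≢z y≢z) (trans (cong (tri (g x) (g y)) gz≡) (sym img≡))))
          (∙⇒triple x≢y (trans (sym (from-to _)) (trans (cong from (trans (sym (g-∙ x y)) (sym gz≡))) (from-to _))))
        where
        x≢y : x ≢ y
        x≢y eq = a≢b (cong g eq)
        x≢z : x ≢ z
        x≢z eq = a≢ab (trans (cong g eq) gz≡)
        y≢z : y ≢ z
        y≢z eq = b≢ab (trans (cong g eq) gz≡)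
    ⇒block : isTriple V S ≡ true → Block (img g S)
    ⇒block isTr = at (two-points (triple-3 V S isTr))
      where
      at : (∃ λ x → ∃ λ y → x ≢ y × x ∈ S × y ∈ S) → Block (img g S)
      at (x , y , x≢y , x∈ , y∈) = let (z , S≡ , x≢z , y≢z) = three-points (triple-3 V S isTr) x≢y x∈ y∈ in
        g x , g y , x≢y ∘ g-injective ,
        trans (cong (img g) S≡) (trans (img-tri g-injective x≢y x≢z y≢z) (cong (tri (g x) (g y))
          (sym (trans (g-∙ x y) (cong to (triple⇒∙ x≢y x≢z y≢z (subst (λ T → isTriple V T ≡ true) S≡ isTr)))))))

  classify′ : ∀ (σ : Aut (psts sts)) → Σ (Aut V) λ τ → ∀ c → from (proj₁ σ ⟨$⟩ʳ to c) ≡ lift τ c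
  classify′ (σ , aut) = classify (λ c → from (σ ⟨$⟩ʳ to c)) (λ c → from (σ ⟨$⟩ˡ to c))
    (λ x y → trans (cong (λ z → from (σ ⟨$⟩ʳ z)) (cong to (sym (cong₂ _∙_ (from-to x) (from-to y)))))
      (trans (cong from (aut⇒hom σ aut (to x) (to y))) (from-to _)))
    (λ c → trans (cong (λ z → from (σ ⟨$⟩ʳ z)) (to-from _)) (trans (cong from (Perm.inverseʳ σ)) (from-to c)))
    (λ c → trans (cong (λ z → from (σ ⟨$⟩ˡ z)) (to-from _)) (trans (cong from (Perm.inverseˡ σ)) (from-to c)))

  restrict : Aut (psts sts) → Aut V
  restrict σ = proj₁ (classify′ σ)

  -- An automorphism is recovered from its restriction by lifting; this yields the injectivity of
  -- `φ`, while the other laws are checked on the points of V.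
  restrict≡ : ∀ (σ : Aut (psts sts)) y → proj₁ σ ⟨$⟩ʳ y ≡ to (lift (restrict σ) (from y))
  restrict≡ σ y = trans (cong (proj₁ σ ⟨$⟩ʳ_) (sym (to-from y)))
    (trans (sym (to-from _)) (cong to (proj₂ (classify′ σ) (from y))))

  restrict-g : ∀ (σ : Aut (psts sts)) x → proj₁ σ ⟨$⟩ʳ g x ≡ g (proj₁ (restrict σ) ⟨$⟩ʳ x)
  restrict-g σ x = trans (restrict≡ σ (g x)) (cong to (trans (cong (lift (restrict σ)) (from-to (f x))) (lift-f (restrict σ) x)))

  flipAut : Aut V → Aut V
  flipAut (τ , aut) = flip τ , flip-IsAut V τ aut

  extend : Aut V → Aut (psts sts)
  extend τ = σ , hom⇒aut σ λ x y → trans (cong (λ z → to (lift τ z)) (from-to _))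
      (trans (cong to (lift-hom τ (from x) (from y))) (cong to (sym (cong₂ _∙_ (from-to _) (from-to _)))))
    where
    inv : ∀ τ τ′ → (∀ x → proj₁ τ ⟨$⟩ʳ (proj₁ τ′ ⟨$⟩ʳ x) ≡ x) → ∀ y → to (lift τ (from (to (lift τ′ (from y))))) ≡ y
    inv τ τ′ eq y = trans (cong (λ z → to (lift τ z)) (from-to _)) (trans (cong to (lift-inverse τ τ′ eq (from y))) (to-from y))
    σ : Permutation′ u
    σ = permutation (λ y → to (lift τ (from y))) (λ y → to (lift (flipAut τ) (from y)))
      (inv τ (flipAut τ) λ x → Perm.inverseʳ (proj₁ τ)) (inv (flipAut τ) τ λ x → Perm.inverseˡ (proj₁ τ))

  extend-g : ∀ τ x → proj₁ (extend τ) ⟨$⟩ʳ g x ≡ g (proj₁ τ ⟨$⟩ʳ x)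
  extend-g τ x = cong to (trans (cong (lift τ) (from-to (f x))) (lift-f τ x))

  realizes : Realizes V u
  realizes = sts , g , (g-injective , subsystem) ,
    (λ σ x → _ , restrict-g σ x) ,
    (λ σ → restrict σ , restrict-g σ) ,
    (λ τ → extend τ , extend-g τ) ,
    record
      { φ = restrict
      ; φ-cong = λ {a} {b} a≈b x → g-injective (trans (sym (restrict-g a x)) (trans (a≈b (g x)) (restrict-g b x)))
      ; φ-hom = λ a b pab x → g-injective (trans (sym (restrict-g (proj₁ a ∘ₚ proj₁ b , pab) x))
          (trans (cong (proj₁ b ⟨$⟩ʳ_) (restrict-g a x)) (restrict-g b _)))
      ; φ-inj = λ {a} {b} eq y → trans (restrict≡ a y) (trans (cong to (lift-cong (restrict a) (restrict b) eq (from y))) (sym (restrict≡ b y)))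
      ; φ-surj = λ c → extend c , λ x → g-injective (trans (sym (restrict-g (extend c) x)) (extend-g c x)) }

-- Bose systems, difference families and cardinalities

-- Bose's construction of a Steiner triple system on A × ℤ/3.
module Bose (h : ℕ) where
  open ℤ/ h

  private
    level : Fin 3 → Fin 3 → Fin 3
    level 0F 0F = 0F
    level 1F 1F = 1F
    level 2F 2F = 2F
    level 0F 1F = 2F
    level 1F 0F = 2F
    level 0F 2F = 1F
    level 2F 0F = 1F
    level 1F 2F = 0F
    level 2F 1F = 0F

    level-idem : ∀ i → level i i ≡ i
    level-idem 0F = refl
    level-idem 1F = refl
    level-idem 2F = refl

    level-comm : ∀ i j → level i j ≡ level j i
    level-comm 0F 0F = refl
    level-comm 0F 1F = refl
    level-comm 0F 2F = refl
    level-comm 1F 0F = refl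
    level-comm 1F 1F = refl
    level-comm 1F 2F = refl
    level-comm 2F 0F = refl
    level-comm 2F 1F = refl
    level-comm 2F 2F = refl

    level-invol : ∀ i j → level i (level i j) ≡ j
    level-invol 0F 0F = refl
    level-invol 0F 1F = refl
    level-invol 0F 2F = refl
    level-invol 1F 0F = refl
    level-invol 1F 1F = refl
    level-invol 1F 2F = refl
    level-invol 2F 0F = refl
    level-invol 2F 1F = refl
    level-invol 2F 2F = refl

    B : Set
    B = A × Fin 3

    -- Two points on one level close up with their midpoint on the next level, the levels being
    -- cyclic; the remaining clauses solve the midpoint equation for an endpoint.
    mixed : A → Fin 3 → A → Fin 3 → B
    mixed x 0F y 0F = half (x + y) , 1F
    mixed x 1F y 1F = half (x + y) , 2F
    mixed x 2F y 2F = half (x + y) , 0F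
    mixed x 0F y 1F = y + y − x , 0F
    mixed x 1F y 2F = y + y − x , 1F
    mixed x 2F y 0F = y + y − x , 2F
    mixed x 1F y 0F = x + x − y , 0F
    mixed x 2F y 1F = x + x − y , 1F
    mixed x 0F y 2F = x + x − y , 2F

    mixed-comm : ∀ x i y j → mixed x i y j ≡ mixed y j x i
    mixed-comm x 0F y 0F = cong (λ z → half z , 1F) (+-comm x y)
    mixed-comm x 1F y 1F = cong (λ z → half z , 2F) (+-comm x y)
    mixed-comm x 2F y 2F = cong (λ z → half z , 0F) (+-comm x y)
    mixed-comm x 0F y 1F = refl
    mixed-comm x 1F y 2F = refl
    mixed-comm x 2F y 0F = refl
    mixed-comm x 1F y 0F = refl
    mixed-comm x 2F y 1F = refl
    mixed-comm x 0F y 2F = refl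

    join : ∀ x (i : Fin 3) y (j : Fin 3) → Dec (x ≡ y) → B
    join x i y j (yes _) = x , level i j
    join x i y j (no _) = mixed x i y j

    op : B → B → B
    op (x , i) (y , j) = join x i y j (x F.≟ y)

    op-same : ∀ x i j → op (x , i) (x , j) ≡ (x , level i j)
    op-same x i j with x F.≟ x
    ... | yes _ = refl
    ... | no ne = ⊥-elim (ne refl)

    op-mixed : ∀ {x y} → x ≢ y → ∀ i j → op (x , i) (y , j) ≡ mixed x i y j
    op-mixed {x} {y} ne i j with x F.≟ y
    ... | yes eq = ⊥-elim (ne eq)
    ... | no _ = refl

    module _ {x y : A} (x≢y : x ≢ y) where

      x≢mid : x ≢ half (x + y)
      x≢mid eq = x≢y (double-injective (trans (cong (x +_) (trans (solve v0 ((v0 :+ v0) :− v0) (x ∷ []) refl)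
        (trans (cong (_− x) (trans (cong₂ _+_ eq eq) (half+half (x + y)))) (solve ((v0 :+ v1) :− v0) v1 (x ∷ y ∷ []) refl))))
        (trans (+-comm x y) (cong (y +_) (trans (solve v0 ((v0 :+ v0) :− v0) (x ∷ []) refl)
        (trans (cong (_− x) (trans (cong₂ _+_ eq eq) (half+half (x + y)))) (solve ((v0 :+ v1) :− v0) v1 (x ∷ y ∷ []) refl)))))))

      x≢up : x ≢ y + y − x
      x≢up eq = x≢y (double-injective (trans (cong (x +_) eq) (solve (v0 :+ ((v1 :+ v1) :− v0)) (v1 :+ v1) (x ∷ y ∷ []) refl)))

      x≢down : x ≢ x + x − y
      x≢down eq = x≢y (sym (trans (solve v1 (v1 :+ (v0 :− v0)) (x ∷ y ∷ []) refl)
        (trans (cong (λ z → y + (z − x)) eq) (solve (v1 :+ (((v0 :+ v0) :− v1) :− v0)) v0 (x ∷ y ∷ []) refl))))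

      from-mid : half (x + y) + half (x + y) − x ≡ y
      from-mid = trans (cong (_− x) (half+half (x + y))) (solve ((v0 :+ v1) :− v0) v1 (x ∷ y ∷ []) refl)

      from-up : half (x + (y + y − x)) ≡ y
      from-up = trans (cong half (solve (v0 :+ ((v1 :+ v1) :− v0)) (v1 :+ v1) (x ∷ y ∷ []) refl)) (half-double y)

      from-down : x + x − (x + x − y) ≡ y
      from-down = solve ((v0 :+ v0) :− ((v0 :+ v0) :− v1)) v1 (x ∷ y ∷ []) refl

      mixed-invol : ∀ i j → op (x , i) (mixed x i y j) ≡ (y , j)
      mixed-invol 0F 0F = trans (op-mixed x≢mid _ _) (cong (_, 0F) from-mid)
      mixed-invol 1F 1F = trans (op-mixed x≢mid _ _) (cong (_, 1F) from-mid)
      mixed-invol 2F 2F = trans (op-mixed x≢mid _ _) (cong (_, 2F) from-mid)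
      mixed-invol 0F 1F = trans (op-mixed x≢up _ _) (cong (_, 1F) from-up)
      mixed-invol 1F 2F = trans (op-mixed x≢up _ _) (cong (_, 2F) from-up)
      mixed-invol 2F 0F = trans (op-mixed x≢up _ _) (cong (_, 0F) from-up)
      mixed-invol 1F 0F = trans (op-mixed x≢down _ _) (cong (_, 0F) from-down)
      mixed-invol 2F 1F = trans (op-mixed x≢down _ _) (cong (_, 1F) from-down)
      mixed-invol 0F 2F = trans (op-mixed x≢down _ _) (cong (_, 2F) from-down)

  squag : Squag (A × Fin 3)
  squag = record
    { _∙_ = op
    ; idem = λ (x , i) → trans (op-same x i i) (cong (x ,_) (level-idem i))
    ; comm = λ (x , i) (y , j) → case x F.≟ y of λ where
        (yes refl) → trans (op-same x i j) (trans (cong (x ,_) (level-comm i j)) (sym (op-same x j i)))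
        (no ne) → trans (op-mixed ne i j) (trans (mixed-comm x i y j) (sym (op-mixed (ne ∘ sym) j i)))
    ; invol = λ (x , i) (y , j) → case x F.≟ y of λ where
        (yes refl) → trans (cong (op (x , i)) (op-same x i j)) (trans (op-same x i _) (cong (x ,_) (level-invol i j)))
        (no ne) → trans (cong (op (x , i)) (op-mixed ne i j)) (mixed-invol ne i j) }

-- Complements of injections, pigeonhole and cardinalities

record Complement {m n : ℕ} (e : Fin m → Fin n) : Set where
  field
    rest      : Fin (n ℕ.∸ m) → Fin n
    injective : ∀ {i j} → rest i ≡ rest j → i ≡ j
    avoids    : ∀ i j → e i ≢ rest j
    covers    : ∀ y → (∀ i → e i ≢ y) → ∃ λ j → rest j ≡ y

complement : ∀ {m n} (e : Fin m → Fin n) → (∀ {i j} → e i ≡ e j → i ≡ j) → Complement e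
complement {zero} e e-inj = record { rest = λ i → i ; injective = λ eq → eq ; avoids = λ () ; covers = λ y _ → y , refl }
complement {suc m} {zero} e e-inj with e 0F
... | ()
complement {suc m} {suc n} e e-inj = record
  { rest = λ j → punchIn (e 0F) (rest j)
  ; injective = λ eq → injective (punchIn-injective (e 0F) _ _ eq)
  ; avoids = λ where
      0F j eq → punchInᵢ≢i (e 0F) (rest j) (sym eq)
      (F.suc i) j eq → avoids i j (punchIn-injective (e 0F) _ _ (trans (punchIn-punchOut (ne i)) eq))
  ; covers = covers′ }
  where
  ne : ∀ i → e 0F ≢ e (F.suc i)
  ne i eq = case e-inj eq of λ ()
  e′ : Fin m → Fin n
  e′ i = punchOut (ne i)
  e′-injective : ∀ {i j} → e′ i ≡ e′ j → i ≡ j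
  e′-injective {i} {j} eq = suc-inj (e-inj (trans (sym (punchIn-punchOut (ne i)))
    (trans (cong (punchIn (e 0F)) eq) (punchIn-punchOut (ne j)))))
    where
    suc-inj : ∀ {n} {i j : Fin n} → F.suc i ≡ F.suc j → i ≡ j
    suc-inj refl = refl
  open Complement (complement e′ e′-injective)
  covers′ : ∀ y → (∀ i → e i ≢ y) → ∃ λ j → punchIn (e 0F) (rest j) ≡ y
  covers′ y avoid = proj₁ found , trans (cong (punchIn (e 0F)) (proj₂ found)) (punchIn-punchOut (avoid 0F))
    where
    found : ∃ λ j → rest j ≡ punchOut (avoid 0F)
    found = covers (punchOut (avoid 0F)) λ i eq → avoid (F.suc i)
      (trans (sym (punchIn-punchOut (ne i))) (trans (cong (punchIn (e 0F)) eq) (punchIn-punchOut (avoid 0F))))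

noInjection : ∀ {X Y : Set} {m n} → X ↔ Fin m → Y ↔ Fin n → n < m → NoInjection X Y
noInjection e e′ n<m f f-inj = ℕₚ.<⇒≱ n<m (injective⇒≤ {f = λ i → Inverse.to e′ (f (Inverse.from e i))} λ {i} {j} eq →
  from-injective e (f-inj (to-injective e′ eq)))
  where
  to-injective : ∀ {X : Set} {n} (e : X ↔ Fin n) {x y} → Inverse.to e x ≡ Inverse.to e y → x ≡ y
  to-injective e eq = trans (sym (Inverse.inverseʳ e refl)) (trans (cong (Inverse.from e) eq) (Inverse.inverseʳ e refl))
  from-injective : ∀ {X : Set} {n} (e : X ↔ Fin n) {x y} → Inverse.from e x ≡ Inverse.from e y → x ≡ y
  from-injective e eq = trans (sym (Inverse.inverseˡ e refl)) (trans (cong (Inverse.to e) eq) (Inverse.inverseˡ e refl))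

infixr 5 _⊎-size_
infixr 6 _×-size_
_⊎-size_ : ∀ {X Y : Set} {m n} → X ↔ Fin m → Y ↔ Fin n → (X ⊎ Y) ↔ Fin (m ℕ.+ n)
e ⊎-size e′ = ↔-sym +↔⊎ ↔-∘ (e ⊎-↔ e′)

_×-size_ : ∀ {X Y : Set} {m n} → X ↔ Fin m → Y ↔ Fin n → (X × Y) ↔ Fin (m ℕ.* n)
e ×-size e′ = ↔-sym *↔× ↔-∘ (e ×-↔ e′)

Bool-size : Bool ↔ Fin 2
Bool-size = ↔-sym 2↔Bool

resize : ∀ {X : Set} {m n} → m ≡ n → X ↔ Fin m → X ↔ Fin n
resize refl e = e

Subset-size : ∀ n → Subset n ↔ Fin (2 ℕ.^ n)
Subset-size zero = mk↔ₛ′ (λ _ → 0F) (λ _ → []) (λ where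
  0F → refl
  (F.suc ())) (λ where [] → refl)
Subset-size (suc n) = (Bool-size ×-size Subset-size n) ↔-∘ mk↔ₛ′ split (λ (b , s) → b ∷ s) (λ _ → refl) join
  where
  split : Subset (suc n) → Bool × Subset n
  split (b ∷ s) = b , s
  join : ∀ s → proj₁ (split s) ∷ proj₂ (split s) ≡ s
  join (b ∷ s) = refl

-- A difference family with t base triangles

module TriangleDifferences (h t : ℕ) (bound : 16 ℕ.* t ≤ ℤ/.p h) where
  open ℤ/ h

  -- Each `r` contributes x, y and z = x + y with residues 1, 2, 3 modulo 4, which keeps all 3t
  -- numbers distinct. They stay below 8t, so with 16t ≤ p their negatives are new residues as well.
  -- D is meant to be only a part of `A`, so gaps between the numbers are harmless.
  X : Fin t → Fin 3 → ℕ
  X r 0F = 1 ℕ.+ toℕ r ℕ.* 4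
  X r 1F = 2 ℕ.+ toℕ r ℕ.* 4
  X r 2F = 3 ℕ.+ (toℕ r ℕ.+ toℕ r) ℕ.* 4

  X-sum : ∀ r → X r 0F ℕ.+ X r 1F ≡ X r 2F
  X-sum r = sum (toℕ r)
    where
    sum : ∀ n → 1 ℕ.+ n ℕ.* 4 ℕ.+ (2 ℕ.+ n ℕ.* 4) ≡ 3 ℕ.+ (n ℕ.+ n) ℕ.* 4
    sum = solve-∀

  X≤ : ∀ r j → X r j ≤ X r 2F
  X≤ r 0F = subst (X r 0F ≤_) (X-sum r) (ℕₚ.m≤m+n (X r 0F) (X r 1F))
  X≤ r 1F = subst (X r 1F ≤_) (X-sum r) (ℕₚ.m≤n+m (X r 1F) (X r 0F))
  X≤ r 2F = ℕₚ.≤-refl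

  X<8t : ∀ r j → X r j < 8 ℕ.* t
  X<8t r j = ℕₚ.≤-trans (s≤s (X≤ r j)) (ℕₚ.≤-trans (subst (suc (X r 2F) ≤_) (eight (toℕ r)) (ℕₚ.m≤m+n _ 4)) (ℕₚ.*-monoʳ-≤ 8 (toℕ<n r)))
    where
    eight : ∀ n → suc (3 ℕ.+ (n ℕ.+ n) ℕ.* 4) ℕ.+ 4 ≡ 8 ℕ.* suc n
    eight = solve-∀

  X+X<p : ∀ r j r′ j′ → X r j ℕ.+ X r′ j′ < p
  X+X<p r j r′ j′ = ℕₚ.<-≤-trans (ℕₚ.+-mono-< (X<8t r j) (X<8t r′ j′)) (subst (_≤ p) (sixteen t) bound)
    where
    sixteen : ∀ n → 16 ℕ.* n ≡ 8 ℕ.* n ℕ.+ 8 ℕ.* n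
    sixteen = solve-∀

  X<p : ∀ r j → X r j < p
  X<p r j = ℕₚ.≤-<-trans (ℕₚ.m≤m+n _ _) (X+X<p r j r j)

  X≢0 : ∀ r j → X r j ≢ 0
  X≢0 r 0F ()
  X≢0 r 1F ()
  X≢0 r 2F ()

  X-injective : ∀ {r j r′ j′} → X r j ≡ X r′ j′ → (r , j) ≡ (r′ , j′)
  X-injective {r} {j} {r′} {j′} eq = go j j′ eq
    where
    mod4 : ∀ a b m n → a ℕ.+ m ℕ.* 4 ≡ b ℕ.+ n ℕ.* 4 → a % 4 ≡ b % 4
    mod4 a b m n eq = trans (sym ([m+kn]%n≡m%n a m 4)) (trans (cong (_% 4) eq) ([m+kn]%n≡m%n b n 4))
    quot : ∀ a m n → a ℕ.+ m ℕ.* 4 ≡ a ℕ.+ n ℕ.* 4 → m ≡ n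
    quot a m n eq = ℕₚ.*-cancelʳ-≡ m n 4 (ℕₚ.+-cancelˡ-≡ a _ _ eq)
    dbl : ∀ m n → m ℕ.+ m ≡ n ℕ.+ n → m ≡ n
    dbl m n eq = ℕₚ.*-cancelʳ-≡ m n 2 (trans (two m) (trans eq (sym (two n))))
      where
      two : ∀ m → m ℕ.* 2 ≡ m ℕ.+ m
      two = solve-∀
    go : ∀ j j′ → X r j ≡ X r′ j′ → (r , j) ≡ (r′ , j′)
    go 0F 0F eq = cong (_, 0F) (toℕ-injective (quot 1 (toℕ r) (toℕ r′) eq))
    go 1F 1F eq = cong (_, 1F) (toℕ-injective (quot 2 (toℕ r) (toℕ r′) eq))
    go 2F 2F eq = cong (_, 2F) (toℕ-injective (dbl (toℕ r) (toℕ r′) (quot 3 (toℕ r ℕ.+ toℕ r) (toℕ r′ ℕ.+ toℕ r′) eq)))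
    go 0F 1F eq = case mod4 1 2 (toℕ r) (toℕ r′) eq of λ ()
    go 0F 2F eq = case mod4 1 3 (toℕ r) (toℕ r′ ℕ.+ toℕ r′) eq of λ ()
    go 1F 0F eq = case mod4 2 1 (toℕ r) (toℕ r′) eq of λ ()
    go 1F 2F eq = case mod4 2 3 (toℕ r) (toℕ r′ ℕ.+ toℕ r′) eq of λ ()
    go 2F 0F eq = case mod4 3 1 (toℕ r ℕ.+ toℕ r) (toℕ r′) eq of λ ()
    go 2F 1F eq = case mod4 3 2 (toℕ r ℕ.+ toℕ r) (toℕ r′) eq of λ ()

  data Code : Set where
    zeroᶜ : Code
    posᶜ negᶜ : Fin t → Fin 3 → Code

  enum : Code → A
  enum zeroᶜ = 0#
  enum (posᶜ r j) = [ X r j ]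
  enum (negᶜ r j) = - [ X r j ]

  private
    0<p : 0 < p
    0<p = s≤s z≤n

    neg-injective : ∀ {a b} → - a ≡ - b → a ≡ b
    neg-injective {a} {b} eq = trans (solve v0 (:- :- v0) (a ∷ []) refl) (trans (cong -_ eq) (solve (:- :- v0) v0 (b ∷ []) refl))

    pos≢0 : ∀ r j → [ X r j ] ≢ 0#
    pos≢0 r j eq = X≢0 r j ([]-injective (X<p r j) 0<p eq)

    neg≢0 : ∀ r j → - [ X r j ] ≢ 0#
    neg≢0 r j eq = pos≢0 r j (neg-injective (trans eq (solve :0 (:- :0) [] refl)))

    pos≢neg : ∀ r j r′ j′ → [ X r j ] ≢ - [ X r′ j′ ]
    pos≢neg r j r′ j′ eq = X≢0 r j (ℕₚ.m+n≡0⇒m≡0 (X r j) ([]-injective (X+X<p r j r′ j′) 0<p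
      (trans (sym ([]-+ (X r j) (X r′ j′))) (trans (cong (_+ [ X r′ j′ ]) eq) (solve (:- v0 :+ v0) :0 ([ X r′ j′ ] ∷ []) refl)))))

  enum-injective : ∀ {c c′} → enum c ≡ enum c′ → c ≡ c′
  enum-injective {zeroᶜ} {zeroᶜ} eq = refl
  enum-injective {zeroᶜ} {posᶜ r j} eq = ⊥-elim (pos≢0 r j (sym eq))
  enum-injective {zeroᶜ} {negᶜ r j} eq = ⊥-elim (neg≢0 r j (sym eq))
  enum-injective {posᶜ r j} {zeroᶜ} eq = ⊥-elim (pos≢0 r j eq)
  enum-injective {negᶜ r j} {zeroᶜ} eq = ⊥-elim (neg≢0 r j eq)
  enum-injective {posᶜ r j} {negᶜ r′ j′} eq = ⊥-elim (pos≢neg r j r′ j′ eq)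
  enum-injective {negᶜ r j} {posᶜ r′ j′} eq = ⊥-elim (pos≢neg r′ j′ r j (sym eq))
  enum-injective {posᶜ r j} {posᶜ r′ j′} eq = cong (λ (r , j) → posᶜ r j) (X-injective {r} {j} {r′} {j′} ([]-injective (X<p r j) (X<p r′ j′) eq))
  enum-injective {negᶜ r j} {negᶜ r′ j′} eq = cong (λ (r , j) → negᶜ r j) (X-injective {r} {j} {r′} {j′} ([]-injective (X<p r j) (X<p r′ j′) (neg-injective eq)))

  Member : A → Set
  Member a = ∃ λ c → enum c ≡ a

  member? : ∀ a → Dec (Member a)
  member? a = map′ to from ((0# F.≟ a) ⊎-dec ((any? λ r → any? λ j → [ X r j ] F.≟ a) ⊎-dec (any? λ r → any? λ j → - [ X r j ] F.≟ a)))
    where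
    to : 0# ≡ a ⊎ ((∃ λ r → ∃ λ j → [ X r j ] ≡ a) ⊎ (∃ λ r → ∃ λ j → - [ X r j ] ≡ a)) → Member a
    to (inj₁ eq) = zeroᶜ , eq
    to (inj₂ (inj₁ (r , j , eq))) = posᶜ r j , eq
    to (inj₂ (inj₂ (r , j , eq))) = negᶜ r j , eq
    from : Member a → 0# ≡ a ⊎ ((∃ λ r → ∃ λ j → [ X r j ] ≡ a) ⊎ (∃ λ r → ∃ λ j → - [ X r j ] ≡ a))
    from (zeroᶜ , eq) = inj₁ eq
    from (posᶜ r j , eq) = inj₂ (inj₁ (r , j , eq))
    from (negᶜ r j , eq) = inj₂ (inj₂ (r , j , eq))

  negate : Code → Code
  negate zeroᶜ = zeroᶜ
  negate (posᶜ r j) = negᶜ r j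
  negate (negᶜ r j) = posᶜ r j

  enum-negate : ∀ c → enum (negate c) ≡ - enum c
  enum-negate zeroᶜ = solve :0 (:- :0) [] refl
  enum-negate (posᶜ r j) = refl
  enum-negate (negᶜ r j) = solve v0 (:- :- v0) ([ X r j ] ∷ []) refl

  -- With x = X r 0F, y = X r 1F, z = x + y = X r 2F, the block {0 , x , z} gives these third points.
  third : Code → Code
  third zeroᶜ = zeroᶜ
  third (posᶜ r 0F) = posᶜ r 2F
  third (posᶜ r 1F) = negᶜ r 0F
  third (posᶜ r 2F) = posᶜ r 0F
  third (negᶜ r 0F) = posᶜ r 1F
  third (negᶜ r 1F) = negᶜ r 2F
  third (negᶜ r 2F) = negᶜ r 1F

  third-third : ∀ c → third (third c) ≡ c
  third-third zeroᶜ = refl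
  third-third (posᶜ r 0F) = refl
  third-third (posᶜ r 1F) = refl
  third-third (posᶜ r 2F) = refl
  third-third (negᶜ r 0F) = refl
  third-third (negᶜ r 1F) = refl
  third-third (negᶜ r 2F) = refl

  third-negate : ∀ c → enum (third c) ≡ enum c + enum (third (negate c))
  third-negate zeroᶜ = solve :0 (:0 :+ :0) [] refl
  third-negate (posᶜ r j) = pos j
    where
    x y : A
    x = [ X r 0F ]
    y = [ X r 1F ]
    z≡ : [ X r 2F ] ≡ x + y
    z≡ = trans (cong [_] (sym (X-sum r))) (sym ([]-+ _ _))
    pos : ∀ j → enum (third (posᶜ r j)) ≡ enum (posᶜ r j) + enum (third (negᶜ r j))
    pos 0F = z≡
    pos 1F = trans (solve (:- v0) (v1 :+ :- (v0 :+ v1)) (x ∷ y ∷ []) refl) (cong (λ z → y + - z) (sym z≡))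
    pos 2F = trans (solve v0 ((v0 :+ v1) :+ :- v1) (x ∷ y ∷ []) refl) (cong (_+ - y) (sym z≡))
  third-negate (negᶜ r j) = neg j
    where
    x y : A
    x = [ X r 0F ]
    y = [ X r 1F ]
    z≡ : [ X r 2F ] ≡ x + y
    z≡ = trans (cong [_] (sym (X-sum r))) (sym ([]-+ _ _))
    neg : ∀ j → enum (third (negᶜ r j)) ≡ enum (negᶜ r j) + enum (third (posᶜ r j))
    neg 0F = trans (solve v1 (:- v0 :+ (v0 :+ v1)) (x ∷ y ∷ []) refl) (cong (- x +_) (sym z≡))
    neg 1F = trans (cong -_ z≡) (solve (:- (v0 :+ v1)) (:- v1 :+ :- v0) (x ∷ y ∷ []) refl)
    neg 2F = trans (solve (:- v1) (:- (v0 :+ v1) :+ v0) (x ∷ y ∷ []) refl) (cong (λ z → - z + x) (sym z≡))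

  χ : A → Bool
  χ a = does (member? a)

  χ-enum : ∀ c → χ (enum c) ≡ true
  χ-enum c = dec-true (member? (enum c)) (c , refl)

  χ⇒member : ∀ {a} → χ a ≡ true → Member a
  χ⇒member {a} = does-true (member? a)

  ν : A → A
  ν a = at (member? a)
    where
    at : Dec (Member a) → A
    at (yes (c , _)) = enum (third c)
    -- An arbitrary value: the laws constrain `ν` on D only.
    at (no _) = 0#

  ν-enum : ∀ c → ν (enum c) ≡ enum (third c)
  ν-enum c with member? (enum c)
  ... | yes (c′ , eq) = cong (enum ∘ third) (enum-injective {c′} {c} eq)
  ... | no ne = ⊥-elim (ne (c , refl))

  abstract
    family : DifferenceFamily h
    family = record
      { χ = χ ; ν = ν ; χ-0 = χ-enum zeroᶜ ; ν-0 = ν-enum zeroᶜ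
      ; χ-neg = λ d → true-iff⇒≡
          (λ eq → subst (λ a → χ a ≡ true) (solve (:- :- v0) v0 (d ∷ []) refl) (χ-neg′ eq)) χ-neg′
      ; χ-ν = λ {d} eq → via (λ d → χ (ν d) ≡ true) (λ c → trans (cong χ (ν-enum c)) (χ-enum (third c))) d eq
      ; ν-ν = λ {d} eq → via (λ d → ν (ν d) ≡ d)
          (λ c → trans (cong ν (ν-enum c)) (trans (ν-enum (third c)) (cong enum (third-third c)))) d eq
      ; ν-neg = λ {d} eq → via (λ d → ν d ≡ d + ν (- d)) (λ c → trans (ν-enum c) (trans (third-negate c)
          (cong (enum c +_) (trans (sym (ν-enum (negate c))) (cong ν (enum-negate c)))))) d eq }
      where
      via : (Q : A → Set) → (∀ c → Q (enum c)) → ∀ d → χ d ≡ true → Q d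
      via Q q d eq = let (c , c≡) = χ⇒member eq in subst Q c≡ (q c)
      χ-neg′ : ∀ {d} → χ d ≡ true → χ (- d) ≡ true
      χ-neg′ {d} eq = via (λ d → χ (- d) ≡ true) (λ c → subst (λ a → χ a ≡ true) (enum-negate c) (χ-enum (negate c))) d eq

    family-χ : ∀ a → DifferenceFamily.χ family a ≡ χ a
    family-χ a = refl

  -- Members of D lie at distance less than 8t from 0 on the cycle of residues, so the window from
  -- 8t up to p - 8t is free of them.
  not-member : ∀ n → 0 < n → 8 ℕ.* t ≤ n → 8 ℕ.* t ℕ.+ n < p → ¬ Member [ n ]
  not-member n 0<n 8t≤n small (c , eq) = go c eq
    where
    n<p : n < p
    n<p = ℕₚ.≤-<-trans (ℕₚ.m≤n+m n (8 ℕ.* t)) small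
    go : ∀ c → enum c ≢ [ n ]
    go zeroᶜ eq = ℕₚ.<⇒≢ 0<n ([]-injective 0<p n<p eq)
    go (posᶜ r j) eq = ℕₚ.<⇒≢ (ℕₚ.<-≤-trans (X<8t r j) 8t≤n) ([]-injective (X<p r j) n<p eq)
    go (negᶜ r j) eq = X≢0 r j (ℕₚ.m+n≡0⇒m≡0 (X r j) ([]-injective (ℕₚ.≤-<-trans (ℕₚ.+-monoˡ-≤ n (ℕₚ.<⇒≤ (X<8t r j))) small) 0<p
      (trans (sym ([]-+ (X r j) n)) (trans (cong ([ X r j ] +_) (sym eq)) (solve (v0 :+ :- v0) :0 ([ X r j ] ∷ []) refl)))))

  size : ℕ
  size = 1 ℕ.+ (t ℕ.* 3 ℕ.+ t ℕ.* 3)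

  Code-size : Code ↔ Fin size
  Code-size = (↔-id (Fin 1) ⊎-size ((↔-id _ ×-size ↔-id _) ⊎-size (↔-id _ ×-size ↔-id _))) ↔-∘ mk↔ₛ′ split join split-join join-split
    where
    Parts : Set
    Parts = Fin 1 ⊎ (Fin t × Fin 3) ⊎ (Fin t × Fin 3)
    split : Code → Parts
    split zeroᶜ = inj₁ 0F
    split (posᶜ r j) = inj₂ (inj₁ (r , j))
    split (negᶜ r j) = inj₂ (inj₂ (r , j))
    join : Parts → Code
    join (inj₁ _) = zeroᶜ
    join (inj₂ (inj₁ (r , j))) = posᶜ r j
    join (inj₂ (inj₂ (r , j))) = negᶜ r j
    split-join : ∀ x → split (join x) ≡ x
    split-join (inj₁ 0F) = refl
    split-join (inj₁ (F.suc ()))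
    split-join (inj₂ (inj₁ _)) = refl
    split-join (inj₂ (inj₂ _)) = refl
    join-split : ∀ c → join (split c) ≡ c
    join-split zeroᶜ = refl
    join-split (posᶜ _ _) = refl
    join-split (negᶜ _ _) = refl

  open StandardFiller family using (Δ; δ; el; ok; δ-cong)

  non-member : ∀ {a} → ¬ Member a → DifferenceFamily.χ family a ≡ false
  non-member {a} ne = trans (family-χ a) (dec-false (member? a) ne)

  Δ-size : Δ ↔ Fin (p ℕ.∸ size)
  Δ-size = mk↔ₛ′ (λ d → proj₁ (find d)) outside-image (λ j → injective (proj₂ (find (outside-image j)))) (λ d → δ-cong (proj₂ (find d)))
    where
    index : Code → Fin size
    index = Inverse.to Code-size
    code : Fin size → Code
    code = Inverse.from Code-size
    enum-index : ∀ c → enum (code (index c)) ≡ enum c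
    enum-index c = cong enum (Inverse.strictlyInverseʳ Code-size c)
    code-injective : ∀ {i j} → code i ≡ code j → i ≡ j
    code-injective {i} {j} eq = trans (sym (Inverse.inverseˡ Code-size refl)) (trans (cong index eq) (Inverse.inverseˡ Code-size refl))
    open Complement (complement (enum ∘ code) λ {i} {j} eq → code-injective (enum-injective {code i} {code j} eq))
    outside-image : Fin (p ℕ.∸ size) → Δ
    outside-image j = δ (rest j) (non-member λ (c , eq) → avoids (index c) j (trans (enum-index c) eq))
    find : ∀ d → ∃ λ j → rest j ≡ el d
    find (δ d q) = covers d λ i eq → case trans (sym (trans (family-χ d) (trans (cong χ (sym eq)) (χ-enum (code i)))))
      (recompute-false q) of λ ()

-- Colour-preserving automorphisms of W come from automorphisms of V

module FrameRigidity {v : ℕ} (V : PSTS v) (k′ : ℕ) {w′ : ℕ}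
  (en : Fin (suc (suc w′)) ↔ SwitchedSloop.L V (4 ℕ.+ k′)) where
  open Frame V k′ en

  private
    Map : Set
    Map = Fin (suc w′) → Fin (suc w′)

    moved : ∀ {π : Map} → (∀ x → col (π x) ≡ col x) → ∀ j → ∃ λ j′ → π (point j) ≡ point j′
    moved inv j = point-col (trans (inv (point j)) (col-point j))

    triple-image : ∀ (τ : Permutation′ v) {π : Map} → IsHom W π → (∀ j → π (point j) ≡ point (τ ⟨$⟩ʳ j)) →
      ∀ {S} → isTriple V S ≡ true → isTriple V (τ · S) ≡ true
    triple-image τ {π} hom on-points {S} isT = at (two-points (triple-3 V S isT))
      where
      τ-injective : ∀ {x y} → τ ⟨$⟩ʳ x ≡ τ ⟨$⟩ʳ y → x ≡ y
      τ-injective eq = trans (sym (Perm.inverseˡ τ)) (trans (cong (τ ⟨$⟩ˡ_) eq) (Perm.inverseˡ τ))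
      at : (∃ λ x → ∃ λ y → x ≢ y × x ∈ S × y ∈ S) → isTriple V (τ · S) ≡ true
      at (x , y , x≢y , x∈ , y∈) = through (three-points (triple-3 V S isT) x≢y x∈ y∈)
        where
        through : (∃ λ z → S ≡ tri x y z × x ≢ z × y ≢ z) → isTriple V (τ · S) ≡ true
        through (z , refl , x≢z , y≢z) = trans (cong (isTriple V) (Action.·-tri τ x y z)) (⋆-point (x≢y ∘ τ-injective)
          (trans (cong₂ _⋆_ (sym (on-points x)) (sym (on-points y))) (trans (sym (hom (point x) (point y)))
            (trans (cong π (point-⋆ x≢y x≢z y≢z isT)) (on-points z)))))

  -- Each extra vector has its own colour and is fixed, and the points of V are permuted. Three
  -- points of V are collinear in W exactly when they form a triple, so the permutation lies in Aut
  -- V; it determines `π` because the marked points generate W.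
  coloured-hom-is-lift : ∀ (π π⁻¹ : Map) → IsHom W π → IsHom W π⁻¹ → (∀ x → π (π⁻¹ x) ≡ x) → (∀ x → π⁻¹ (π x) ≡ x) →
    (∀ x → col (π x) ≡ col x) → Σ (Aut V) λ τ → ∀ x → π x ≡ Lift.lift τ x
  coloured-hom-is-lift π π⁻¹ hom hom⁻¹ ππ⁻¹ π⁻¹π inv = τ ,
      homs-equal π (Lift.lift τ) hom (Lift.lift-hom τ)
        (λ i → trans (extra-col (trans (inv (extra i)) (col-extra i))) (sym (Lift.lift-extra τ i)))
        (λ j → trans (π-point j) (sym (Lift.lift-point τ j)))
    where
    inv⁻¹ : ∀ x → col (π⁻¹ x) ≡ col x
    inv⁻¹ x = trans (sym (inv (π⁻¹ x))) (cong col (ππ⁻¹ x))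
    t t⁻¹ : Fin v → Fin v
    t j = proj₁ (moved inv j)
    t⁻¹ j = proj₁ (moved inv⁻¹ j)
    π-point : ∀ j → π (point j) ≡ point (t j)
    π-point j = proj₂ (moved inv j)
    π⁻¹-point : ∀ j → π⁻¹ (point j) ≡ point (t⁻¹ j)
    π⁻¹-point j = proj₂ (moved inv⁻¹ j)
    tt⁻¹ : ∀ j → t (t⁻¹ j) ≡ j
    tt⁻¹ j = point-injective {t (t⁻¹ j)} {j}
      (trans (sym (π-point (t⁻¹ j))) (trans (cong π (sym (π⁻¹-point j))) (ππ⁻¹ (point j))))
    t⁻¹t : ∀ j → t⁻¹ (t j) ≡ j
    t⁻¹t j = point-injective {t⁻¹ (t j)} {j}
      (trans (sym (π⁻¹-point (t j))) (trans (cong π⁻¹ (sym (π-point j))) (π⁻¹π (point j))))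
    perm : Permutation′ v
    perm = permutation t t⁻¹ tt⁻¹ t⁻¹t
    τ : Aut V
    τ = perm , λ S → true-iff⇒≡
      (λ eq → subst (λ T → isTriple V T ≡ true) (flip-· perm S) (triple-image (flip perm) {π⁻¹} hom⁻¹ π⁻¹-point {perm · S} eq))
      (triple-image perm {π} hom π-point {S})

  lift-cong : ∀ τ τ′ → proj₁ τ Perm.≈ proj₁ τ′ → ∀ x → Lift.lift τ x ≡ Lift.lift τ′ x
  lift-cong τ τ′ eq = homs-equal _ _ (Lift.lift-hom τ) (Lift.lift-hom τ′)
    (λ i → trans (Lift.lift-extra τ i) (sym (Lift.lift-extra τ′ i)))
    (λ j → trans (Lift.lift-point τ j) (trans (cong point (eq j)) (sym (Lift.lift-point τ′ j))))

  lift-inverse : ∀ τ τ′ → (∀ x → proj₁ τ ⟨$⟩ʳ (proj₁ τ′ ⟨$⟩ʳ x) ≡ x) → ∀ x → Lift.lift τ (Lift.lift τ′ x) ≡ x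
  lift-inverse τ τ′ eq = homs-equal (Lift.lift τ ∘ Lift.lift τ′) (λ x → x)
    (λ x y → trans (cong (Lift.lift τ) (Lift.lift-hom τ′ x y)) (Lift.lift-hom τ _ _)) (λ x y → refl)
    (λ i → trans (cong (Lift.lift τ) (Lift.lift-extra τ′ i)) (Lift.lift-extra τ i))
    (λ j → trans (cong (Lift.lift τ) (Lift.lift-point τ′ j)) (trans (Lift.lift-point τ _) (cong point (eq j))))

-- Indexed like `Colour`: 0 for unmarked points, 5 for points of V, then 1, 3, 8, 10, 16 for extra
-- vectors. For distinct x and y in this set, 3y - 2x is again in the set only if x = 0 and y = 1;
-- `colour-numbers-rigid` checks this exhaustively.
colour-number : Fin 7 → ℕ
colour-number = lookup (0 ∷ 5 ∷ 1 ∷ 3 ∷ 8 ∷ 10 ∷ 16 ∷ [])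

ColourRelation : Fin 7 → Fin 7 → Fin 7 → Set
ColourRelation a b c =
  colour-number c ℕ.+ (colour-number a ℕ.+ colour-number a) ≡ colour-number b ℕ.+ (colour-number b ℕ.+ colour-number b) →
  a ≡ b ⊎ (colour-number a ≡ 0 × colour-number b ≡ 1)

colour-numbers-rigid : ∀ a b c → ColourRelation a b c
colour-numbers-rigid = does-true (all? λ a → all? λ b → all? λ c → relation? a b c) refl
  where
  relation? : ∀ a b c → Dec (ColourRelation a b c)
  relation? a b c = (_ ℕ.≟ _) →-dec ((a F.≟ b) ⊎-dec ((_ ℕ.≟ 0) ×-dec (_ ℕ.≟ 1)))

colour-number-injective : ∀ {i j} → colour-number i ≡ colour-number j → i ≡ j
colour-number-injective {i} {j} = does-true (all? λ i → all? λ j → injective? i j) refl i j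
  where
  injective? : ∀ i j → Dec (colour-number i ≡ colour-number j → i ≡ j)
  injective? i j = (_ ℕ.≟ _) →-dec (i F.≟ j)

colour-number-bound : ∀ i → colour-number i ℕ.+ (colour-number i ℕ.+ colour-number i) ≤ 48
colour-number-bound = does-true (all? λ i → _ ℕ.≤? 48) refl

-- The construction for a given order

module Realize {v : ℕ} (V : PSTS v) (k′ : ℕ) {w′ : ℕ} (en : Fin (suc (suc w′)) ↔ SwitchedSloop.L V (4 ℕ.+ k′))
  {h : ℕ} (D : DifferenceFamily h) (F : Squag (StandardFiller.Lab D))
  {m : ℕ} (num : Fin m → ℕ) (paint : Frame.Colour V k′ en → Fin m) (paint-injective : ∀ {c c′} → paint c ≡ paint c′ → c ≡ c′) where

  open ℤ/ h
  open StandardFiller D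
  open Frame V k′ en using (W; col; point; point-injective; point-⋆; ⋆-point; module Lift)
  open FrameRigidity V k′ en
  open Rigidity D W F num (paint ∘ col)
  open Squag W using () renaming (_∙_ to _⋆_)

  0ᴾ : P
  0ᴾ = 0# , false

  embed : Fin v → U
  embed j = inj₂ (point j , 0ᴾ)

  embed-∙ : ∀ {x y} → x ≢ y → embed x ∙ embed y ≡ inj₂ (point x ⋆ point y , 0ᴾ)
  embed-∙ x≢y = trans (∙-diff (x≢y ∘ point-injective) 0ᴾ 0ᴾ)
    (cong (λ a → inj₂ (_ , (a , false))) (solve (:- (:0 :+ :0)) :0 [] refl))

  liftᵁ : Aut V → U → U
  liftᵁ τ (inj₁ l) = inj₁ l
  liftᵁ τ (inj₂ (x , b)) = inj₂ (Lift.lift τ x , b)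

  κ-lift : ∀ τ x → κ (Lift.lift τ x) ≡ κ x
  κ-lift τ x = cong (λ c → [ num (paint c) ]) (Lift.col-lift τ x)

  liftᵁ-hom : ∀ τ → IsHom squag (liftᵁ τ)
  liftᵁ-hom τ (inj₁ l) (inj₁ l′) = refl
  liftᵁ-hom τ (inj₁ l) (inj₂ (x , b)) = cong (λ k → inj₂ (Lift.lift τ x , act k l b)) (sym (κ-lift τ x))
  liftᵁ-hom τ (inj₂ (x , b)) (inj₁ l) = cong (λ k → inj₂ (Lift.lift τ x , act k l b)) (sym (κ-lift τ x))
  liftᵁ-hom τ (inj₂ (x , b)) (inj₂ (y , b′)) = case x F.≟ y of λ where
      (yes refl) → trans (cong (liftᵁ τ) (∙-same x b b′)) (trans (lift-place x (prod (κ x) b b′))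
        (trans (cong (λ k → place (Lift.lift τ x) (prod k b b′)) (sym (κ-lift τ x))) (sym (∙-same (Lift.lift τ x) b b′))))
      (no x≢y) → trans (cong (liftᵁ τ) (∙-diff x≢y b b′)) (trans (cong (λ z → inj₂ (z , b ⊕ b′)) (Lift.lift-hom τ x y))
        (sym (∙-diff (x≢y ∘ Lift.lift-injective τ) b b′)))
    where
    lift-place : ∀ x r → liftᵁ τ (place x r) ≡ place (Lift.lift τ x) r
    lift-place x (inj₁ l) = refl
    lift-place x (inj₂ b) = refl

  module _ (G : Generic) where

    classify : ∀ (σ σ⁻¹ : U → U) → IsHom squag σ → (∀ c → σ (σ⁻¹ c) ≡ c) → (∀ c → σ⁻¹ (σ c) ≡ c) →
      Σ (Aut V) λ τ → ∀ c → σ c ≡ liftᵁ τ c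
    classify σ σ⁻¹ hom σσ⁻¹ σ⁻¹σ = proj₁ found , λ where
        (inj₁ l) → Fwd.σ-lab≡ l
        (inj₂ (x , b)) → trans (Fwd.σ-group≡ x b) (cong (λ y → inj₂ (y , b)) (proj₂ found x))
      where
      module Fwd = Automorphism G σ σ⁻¹ hom σσ⁻¹ σ⁻¹σ
      module Bwd = Automorphism G σ⁻¹ σ Fwd.hom⁻¹ σ⁻¹σ σσ⁻¹
      cancel-index : ∀ {x y : Fin (suc w′)} → inj₂ {A = Lab} (x , 0ᴾ) ≡ inj₂ (y , 0ᴾ) → x ≡ y
      cancel-index eq = ,-injectiveˡ (inj₂-injective eq)
      ππ⁻¹ : ∀ x → Fwd.π (Bwd.π x) ≡ x
      ππ⁻¹ x = cancel-index (trans (sym (Fwd.σ-group≡ (Bwd.π x) 0ᴾ))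
        (trans (cong σ (sym (Bwd.σ-group≡ x 0ᴾ))) (σσ⁻¹ (inj₂ (x , 0ᴾ)))))
      π⁻¹π : ∀ x → Bwd.π (Fwd.π x) ≡ x
      π⁻¹π x = cancel-index (trans (sym (Bwd.σ-group≡ (Fwd.π x) 0ᴾ))
        (trans (cong σ⁻¹ (sym (Fwd.σ-group≡ x 0ᴾ))) (σ⁻¹σ (inj₂ (x , 0ᴾ)))))
      found : Σ (Aut V) λ τ → ∀ x → Fwd.π x ≡ Lift.lift τ x
      found = coloured-hom-is-lift Fwd.π Bwd.π Fwd.π-hom Bwd.π-hom ππ⁻¹ π⁻¹π (λ x → paint-injective (Fwd.col-invariant x))

    realizes : ∀ {u} → U ↔ Fin u → Realizes V u
    realizes e = Assemble.realizes V squag e embed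
      (λ eq → point-injective (,-injectiveˡ (inj₂-injective eq)))
      (λ x≢y x≢z y≢z isT → trans (embed-∙ x≢y) (cong (λ z → inj₂ (z , 0ᴾ)) (point-⋆ x≢y x≢z y≢z isT)))
      (λ x≢y eq → ⋆-point x≢y (,-injectiveˡ (inj₂-injective (trans (sym (embed-∙ x≢y)) eq))))
      liftᵁ liftᵁ-hom
      (λ τ x → cong (λ y → inj₂ (y , 0ᴾ)) (Lift.lift-point τ x))
      (λ where
        τ τ′ eq (inj₁ l) → refl
        τ τ′ eq (inj₂ (x , b)) → cong (λ y → inj₂ (y , b)) (lift-cong τ τ′ eq x))
      (λ where
        τ τ′ eq (inj₁ l) → refl
        τ τ′ eq (inj₂ (x , b)) → cong (λ y → inj₂ (y , b)) (lift-inverse τ τ′ eq x))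
      classify

≤-by : ∀ {m n} d → m ℕ.+ d ≡ n → m ≤ n
≤-by {m} d refl = ℕₚ.m≤m+n m d

module Construction {v : ℕ} (V : PSTS v) (k′ : ℕ) (k′≤1 : k′ ≤ 1) {z : ℕ}
  (en : Fin (16 ℕ.+ z) ↔ SwitchedSloop.L V (4 ℕ.+ k′)) (t i : ℕ) (t+t≤i : t ℕ.+ t ≤ i) (64≤i : 64 ≤ i) where

  -- Chosen so that p = 5 + 6 (t + i): then 3 divides p + 1, hence is invertible modulo p, and |Lab|
  -- = 2p - 1 - 6t is an odd multiple of 3, as Bose's construction requires.
  h : ℕ
  h = 2 ℕ.+ 3 ℕ.* (t ℕ.+ i)

  open ℤ/ h

  p≡ : p ≡ 5 ℕ.+ 6 ℕ.* (t ℕ.+ i)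
  p≡ = lemma (t ℕ.+ i)
    where
    lemma : ∀ n → suc (2 ℕ.+ 3 ℕ.* n ℕ.+ (2 ℕ.+ 3 ℕ.* n)) ≡ 5 ℕ.+ 6 ℕ.* n
    lemma = solve-∀

  private
    16t+2<p : 16 ℕ.* t ℕ.+ 2 < p
    16t+2<p = subst (16 ℕ.* t ℕ.+ 2 <_) (sym p≡) (ℕₚ.≤-trans
      (≤-by {suc (16 ℕ.* t ℕ.+ 2)} (2 ℕ.* t ℕ.+ 2) (expand t)) (ℕₚ.+-monoʳ-≤ 5 (ℕₚ.*-monoʳ-≤ 6 (ℕₚ.+-monoʳ-≤ t t+t≤i))))
      where
      expand : ∀ t → suc (16 ℕ.* t ℕ.+ 2) ℕ.+ (2 ℕ.* t ℕ.+ 2) ≡ 5 ℕ.+ 6 ℕ.* (t ℕ.+ (t ℕ.+ t))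
      expand = solve-∀

    bound : 16 ℕ.* t ≤ p
    bound = ℕₚ.<⇒≤ (ℕₚ.≤-<-trans (ℕₚ.m≤m+n (16 ℕ.* t) 2) 16t+2<p)

    48<p : 48 < p
    48<p = subst (48 <_) (sym p≡) (ℕₚ.≤-trans (does-true (49 ℕ.≤? 5 ℕ.+ 6 ℕ.* 64) refl)
      (ℕₚ.+-monoʳ-≤ 5 (ℕₚ.*-monoʳ-≤ 6 (ℕₚ.≤-trans 64≤i (ℕₚ.m≤n+m i t)))))

  open TriangleDifferences h t bound hiding (Code; third)

  D : DifferenceFamily h
  D = family

  open StandardFiller D

  lab : ℕ
  lab = p ℕ.+ (p ℕ.∸ size)

  Lab-size : Lab ↔ Fin lab
  Lab-size = ↔-id A ⊎-size Δ-size

  P-size : P ↔ Fin (p ℕ.* 2)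
  P-size = ↔-id A ×-size Bool-size

  h′ : ℕ
  h′ = suc (t ℕ.+ (i ℕ.+ i))

  private
    p∸size : p ℕ.∸ size ≡ 4 ℕ.+ 6 ℕ.* i
    p∸size = trans (cong (ℕ._∸ size) (trans p≡ (split t i))) (ℕₚ.m+n∸m≡n size (4 ℕ.+ 6 ℕ.* i))
      where
      split : ∀ t i → 5 ℕ.+ 6 ℕ.* (t ℕ.+ i) ≡ 1 ℕ.+ (t ℕ.* 3 ℕ.+ t ℕ.* 3) ℕ.+ (4 ℕ.+ 6 ℕ.* i)
      split = solve-∀

  lab≡ : lab ≡ 9 ℕ.+ 6 ℕ.* t ℕ.+ 12 ℕ.* i
  lab≡ = trans (cong₂ ℕ._+_ p≡ p∸size) (collect t i)
    where
    collect : ∀ t i → 5 ℕ.+ 6 ℕ.* (t ℕ.+ i) ℕ.+ (4 ℕ.+ 6 ℕ.* i) ≡ 9 ℕ.+ 6 ℕ.* t ℕ.+ 12 ℕ.* i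
    collect = solve-∀

  private
    three-q : ℤ/.p h′ ℕ.* 3 ≡ lab
    three-q = trans (expand t i) (sym lab≡)
      where
      expand : ∀ t i → suc (suc (t ℕ.+ (i ℕ.+ i)) ℕ.+ suc (t ℕ.+ (i ℕ.+ i))) ℕ.* 3 ≡ 9 ℕ.+ 6 ℕ.* t ℕ.+ 12 ℕ.* i
      expand = solve-∀

  F : Squag Lab
  F = transport (↔-sym Lab-size ↔-∘ resize three-q (↔-id (ℤ/.A h′) ×-size ↔-id (Fin 3))) (Bose.squag h′)

  open Frame V k′ en using (Colour; col; col-plain; plain; extra; col-extra; no-affine; W)

  -- The 6 + k′ colours use an initial segment of the table, so one check of rigidity serves both
  -- values of `k′`.
  paint : Colour → Fin 7
  paint c = F.inject≤ c (ℕₚ.+-monoʳ-≤ 6 k′≤1)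

  open Rigidity D W F colour-number (paint ∘ col)
  open Realize V k′ en D F colour-number paint (λ {c} {c′} eq → inject≤-injective (ℕₚ.+-monoʳ-≤ 6 k′≤1) (ℕₚ.+-monoʳ-≤ 6 k′≤1) c c′ eq)
    using (realizes)

  private
    p∸size<p : p ℕ.∸ size < p
    p∸size<p = s≤s (ℕₚ.m∸n≤m (h ℕ.+ h) (t ℕ.* 3 ℕ.+ t ℕ.* 3))

    lab<2p : lab < p ℕ.* 2
    lab<2p = ℕₚ.<-≤-trans (ℕₚ.+-monoʳ-< p p∸size<p) (ℕₚ.≤-reflexive (two p))
      where
      two : ∀ p → p ℕ.+ p ≡ p ℕ.* 2
      two = solve-∀

    -- `Lab` and the two groups account for fewer than 6p codes, against (14 + z) p candidates. The
    -- minimum of four extra basis vectors secures this margin even when V is empty.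
    small-code-size : lab ℕ.+ ((p ℕ.* 2 ℕ.+ p ℕ.* 2) ℕ.+ (15 ℕ.+ z) ℕ.* 2) < (14 ℕ.+ z) ℕ.* p
    small-code-size = ℕₚ.<-≤-trans (ℕₚ.+-monoˡ-< ((p ℕ.* 2 ℕ.+ p ℕ.* 2) ℕ.+ (15 ℕ.+ z) ℕ.* 2) lab<2p) (subst (λ p → p ℕ.* 2 ℕ.+ ((p ℕ.* 2 ℕ.+ p ℕ.* 2) ℕ.+ (15 ℕ.+ z) ℕ.* 2) ≤ (14 ℕ.+ z) ℕ.* p)
      (sym p≡) (≤-by (10 ℕ.+ 8 ℕ.* (6 ℕ.* (t ℕ.+ i)) ℕ.+ 3 ℕ.* z ℕ.+ z ℕ.* (6 ℕ.* (t ℕ.+ i))) (expand z (6 ℕ.* (t ℕ.+ i)))))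
      where
      expand : ∀ z n → (5 ℕ.+ n) ℕ.* 2 ℕ.+ (((5 ℕ.+ n) ℕ.* 2 ℕ.+ (5 ℕ.+ n) ℕ.* 2) ℕ.+ (15 ℕ.+ z) ℕ.* 2)
        ℕ.+ (10 ℕ.+ 8 ℕ.* n ℕ.+ 3 ℕ.* z ℕ.+ z ℕ.* n) ≡ (14 ℕ.+ z) ℕ.* (5 ℕ.+ n)
      expand = solve-∀

    small-group-size : lab ℕ.+ p ℕ.* 2 < (15 ℕ.+ z) ℕ.* (p ℕ.* 2)
    small-group-size = ℕₚ.<-≤-trans (ℕₚ.+-monoˡ-< (p ℕ.* 2) lab<2p) (≤-by ((13 ℕ.+ z) ℕ.* (p ℕ.* 2)) (expand z (p ℕ.* 2)))
      where
      expand : ∀ z n → n ℕ.+ n ℕ.+ (13 ℕ.+ z) ℕ.* n ≡ (15 ℕ.+ z) ℕ.* n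
      expand = solve-∀

    -- 8t + 1 and 8t + 2 are consecutive and just above the numbers `X`; they supply the two cross
    -- labels that `connected` needs.
    n₀ : ℕ
    n₀ = 8 ℕ.* t ℕ.+ 1

    8t+n : ∀ t → 8 ℕ.* t ℕ.+ (8 ℕ.* t ℕ.+ 1 ℕ.+ 1) ≡ 16 ℕ.* t ℕ.+ 2
    8t+n = solve-∀

    non-member₁ : DifferenceFamily.χ D [ n₀ ℕ.+ 1 ] ≡ false
    non-member₁ = non-member (not-member (n₀ ℕ.+ 1) (ℕₚ.m≤n+m 1 n₀) (ℕₚ.≤-trans (ℕₚ.m≤m+n (8 ℕ.* t) 1) (ℕₚ.m≤m+n n₀ 1))
      (subst (_< p) (sym (8t+n t)) 16t+2<p))

    non-member₀ : DifferenceFamily.χ D [ n₀ ] ≡ false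
    non-member₀ = non-member (not-member n₀ (ℕₚ.m≤n+m 1 (8 ℕ.* t)) (ℕₚ.m≤m+n (8 ℕ.* t) 1)
      (ℕₚ.≤-<-trans (ℕₚ.+-monoʳ-≤ (8 ℕ.* t) (ℕₚ.m≤m+n n₀ 1)) (subst (_< p) (sym (8t+n t)) 16t+2<p)))

    torsion : ∀ a → 3 ⊛ a ≡ 0# → a ≡ 0#
    torsion = ⊛-torsion 3 (2 ℕ.+ ((t ℕ.+ i) ℕ.+ (t ℕ.+ i))) (expand (t ℕ.+ i))
      where
      expand : ∀ n → (2 ℕ.+ (n ℕ.+ n)) ℕ.* 3 ≡ suc (suc (2 ℕ.+ 3 ℕ.* n ℕ.+ (2 ℕ.+ 3 ℕ.* n)))
      expand = solve-∀

  generic : Generic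
  generic = record
    { small-code = noInjection (↔-id (Fin (14 ℕ.+ z)) ×-size ↔-id A) (Lab-size ⊎-size (P-size ⊎-size P-size) ⊎-size (↔-id (Fin (15 ℕ.+ z)) ×-size Bool-size)) small-code-size
    ; small-group = noInjection (↔-id (Fin (15 ℕ.+ z)) ×-size P-size) (Lab-size ⊎-size P-size) small-group-size
    ; small-lab = noInjection P-size Lab-size lab<2p
    ; d₀ = δ [ n₀ ] non-member₀
    ; d₁ = δ [ n₀ ℕ.+ 1 ] non-member₁
    ; d₁≡ = sym ([]-+ n₀ 1)
    ; x₀ = plain ; x₁ = extra 0F ; x₃ = extra 1F
    ; num-x₀ = cong (colour-number ∘ paint) col-plain
    ; num-x₁ = cong (colour-number ∘ paint) (col-extra 0F)
    ; num-x₃ = cong (colour-number ∘ paint) (col-extra 1F)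
    ; num-bound = λ i → ℕₚ.≤-<-trans (colour-number-bound i) 48<p
    ; num-injective = colour-number-injective
    ; num-rigid = colour-numbers-rigid
    ; no-affine = no-affine torsion }

  construction : Realizes V (lab ℕ.+ (15 ℕ.+ z) ℕ.* (p ℕ.* 2))
  construction = realizes generic (Lab-size ⊎-size (↔-id (Fin (15 ℕ.+ z)) ×-size P-size))

-- Arithmetic of the orders

record Order (v b : ℕ) : Set where
  constructor order
  field
    k′ z a : ℕ
    k′≤1   : k′ ≤ 1
    power  : 2 ℕ.^ (4 ℕ.+ k′) ℕ.* 2 ℕ.^ v ≡ 16 ℕ.+ z
    mod6   : 16 ℕ.+ z ≡ 2 ℕ.* b ℕ.+ 6 ℕ.* a

-- u ≡ 1 and u ≡ 3 (mod 6) need |W| ≡ 1 and |W| ≡ 3 (mod 6) respectively; one more extra basis vector switches between them.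
orders : ∀ v → Order v 1 × Order v 2
orders zero = order 1 16 5 (s≤s z≤n) refl refl , order 0 0 2 z≤n refl refl
-- Doubling exchanges the residues 2 and 4 modulo 6; the start is 32 = 2 + 6 · 5 and 16 = 4 + 6 · 2.
orders (suc v) = from-4 (proj₂ (orders v)) , from-2 (proj₁ (orders v))
  where
  double : ∀ m n {z} → m ℕ.* n ≡ 16 ℕ.+ z → m ℕ.* (2 ℕ.* n) ≡ 16 ℕ.+ (16 ℕ.+ 2 ℕ.* z)
  double m n {z} eq = trans (swap m n) (trans (cong (2 ℕ.*_) eq) (expand z))
    where
    swap : ∀ m n → m ℕ.* (2 ℕ.* n) ≡ 2 ℕ.* (m ℕ.* n)
    swap = solve-∀
    expand : ∀ z → 2 ℕ.* (16 ℕ.+ z) ≡ 16 ℕ.+ (16 ℕ.+ 2 ℕ.* z)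
    expand = solve-∀
  doubled : ∀ {z n} → 16 ℕ.+ z ≡ n → 16 ℕ.+ (16 ℕ.+ 2 ℕ.* z) ≡ 2 ℕ.* n
  doubled {z} eq = trans (expand z) (cong (2 ℕ.*_) eq)
    where
    expand : ∀ z → 16 ℕ.+ (16 ℕ.+ 2 ℕ.* z) ≡ 2 ℕ.* (16 ℕ.+ z)
    expand = solve-∀
  from-4 : Order v 2 → Order (suc v) 1
  from-4 (order k′ z a k′≤1 power mod6) = order k′ (16 ℕ.+ 2 ℕ.* z) (1 ℕ.+ 2 ℕ.* a) k′≤1
    (double (2 ℕ.^ (4 ℕ.+ k′)) (2 ℕ.^ v) power) (trans (doubled mod6) (expand a))
    where
    expand : ∀ a → 2 ℕ.* (4 ℕ.+ 6 ℕ.* a) ≡ 2 ℕ.+ 6 ℕ.* (1 ℕ.+ 2 ℕ.* a)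
    expand = solve-∀
  from-2 : Order v 1 → Order (suc v) 2
  from-2 (order k′ z a k′≤1 power mod6) = order k′ (16 ℕ.+ 2 ℕ.* z) (2 ℕ.* a) k′≤1
    (double (2 ℕ.^ (4 ℕ.+ k′)) (2 ℕ.^ v) power) (trans (doubled mod6) (expand a))
    where
    expand : ∀ a → 2 ℕ.* (2 ℕ.+ 6 ℕ.* a) ≡ 4 ℕ.+ 6 ℕ.* (2 ℕ.* a)
    expand = solve-∀

module Admissible {v : ℕ} (V : PSTS v) {b : ℕ} (o : Order v b) where
  open Order o

  M : ℕ
  M = 16 ℕ.+ z

  -- Lets the quotient `q` below reach 6M, so that `i` is still at least 4M after `t`, at most 2M,
  -- has been subtracted.
  threshold : ℕ
  threshold = 3 ℕ.* b ℕ.+ 10 ℕ.* a ℕ.+ 6 ℕ.* M ℕ.* (2 ℕ.* M)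

  module _ (u s : ℕ) (u≡ : suc u ≡ 2 ℕ.* b ℕ.+ 6 ℕ.* s) (large : threshold ≤ s) where

    -- With j = t + i the constructed order plus 1 + 6t is M (10 + 12j). Inserting M = 2b + 6a, the
    -- order is `u` exactly when e = 2Mj - t. So the quotient of `e` by 2M is increased by one to
    -- give `j`, and `t` is the excess, between 1 and 2M.
    e q r t j i : ℕ
    e = s ℕ.∸ (3 ℕ.* b ℕ.+ 10 ℕ.* a)
    q = e / (2 ℕ.* M)
    r = e % (2 ℕ.* M)
    t = 2 ℕ.* M ℕ.∸ r
    j = suc q
    i = j ℕ.∸ t

    s≡ : 3 ℕ.* b ℕ.+ 10 ℕ.* a ℕ.+ e ≡ s
    s≡ = ℕₚ.m+[n∸m]≡n (ℕₚ.≤-trans (ℕₚ.m≤m+n (3 ℕ.* b ℕ.+ 10 ℕ.* a) _) large)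

    e≡ : e ≡ r ℕ.+ q ℕ.* (2 ℕ.* M)
    e≡ = m≡m%n+[m/n]*n e (2 ℕ.* M)

    r+t : r ℕ.+ t ≡ 2 ℕ.* M
    r+t = ℕₚ.m+[n∸m]≡n (ℕₚ.<⇒≤ (m%n<n e (2 ℕ.* M)))

    6M≤q : 6 ℕ.* M ≤ q
    6M≤q = subst (_≤ q) (m*n/n≡m (6 ℕ.* M) (2 ℕ.* M)) (/-monoˡ-≤ (2 ℕ.* M)
      (ℕₚ.+-cancelˡ-≤ (3 ℕ.* b ℕ.+ 10 ℕ.* a) _ _ (subst (threshold ≤_) (sym s≡) large)))

    t≤2M : t ≤ 2 ℕ.* M
    t≤2M = ℕₚ.m∸n≤m (2 ℕ.* M) r

    4M+t≤j : 4 ℕ.* M ℕ.+ t ≤ j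
    4M+t≤j = ℕₚ.≤-trans (ℕₚ.+-monoʳ-≤ (4 ℕ.* M) t≤2M) (ℕₚ.≤-trans (ℕₚ.≤-reflexive (six M)) (ℕₚ.m≤n⇒m≤1+n 6M≤q))
      where
      six : ∀ M → 4 ℕ.* M ℕ.+ 2 ℕ.* M ≡ 6 ℕ.* M
      six = solve-∀

    4M≤i : 4 ℕ.* M ≤ i
    4M≤i = subst (_≤ i) (ℕₚ.m+n∸n≡m (4 ℕ.* M) t) (ℕₚ.∸-monoˡ-≤ t 4M+t≤j)

    t+i : t ℕ.+ i ≡ j
    t+i = ℕₚ.m+[n∸m]≡n (ℕₚ.≤-trans (ℕₚ.m≤n+m t (4 ℕ.* M)) 4M+t≤j)

    64≤i : 64 ≤ i
    64≤i = ℕₚ.≤-trans (≤-by (4 ℕ.* z) (expand z)) 4M≤i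
      where
      expand : ∀ z → 64 ℕ.+ 4 ℕ.* z ≡ 4 ℕ.* (16 ℕ.+ z)
      expand = solve-∀

    t+t≤i : t ℕ.+ t ≤ i
    t+t≤i = ℕₚ.≤-trans (ℕₚ.≤-trans (ℕₚ.+-mono-≤ t≤2M t≤2M) (ℕₚ.≤-reflexive (four M))) 4M≤i
      where
      four : ∀ M → 2 ℕ.* M ℕ.+ 2 ℕ.* M ≡ 4 ℕ.* M
      four = solve-∀

    open Construction V k′ k′≤1 (↔-sym (resize power (Subset-size (4 ℕ.+ k′) ×-size Subset-size v))) t i t+t≤i 64≤i
      using (lab; lab≡; p≡; construction)

    order≡ : lab ℕ.+ (15 ℕ.+ z) ℕ.* (ℤ/.p (2 ℕ.+ 3 ℕ.* (t ℕ.+ i)) ℕ.* 2) ≡ u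
    order≡ = ℕₚ.+-cancelʳ-≡ (1 ℕ.+ 6 ℕ.* t) _ _ (begin
      lab ℕ.+ (15 ℕ.+ z) ℕ.* (ℤ/.p (2 ℕ.+ 3 ℕ.* (t ℕ.+ i)) ℕ.* 2) ℕ.+ (1 ℕ.+ 6 ℕ.* t)
        ≡⟨ cong₂ (λ l p → l ℕ.+ (15 ℕ.+ z) ℕ.* (p ℕ.* 2) ℕ.+ (1 ℕ.+ 6 ℕ.* t)) lab≡ p≡ ⟩
      9 ℕ.+ 6 ℕ.* t ℕ.+ 12 ℕ.* i ℕ.+ (15 ℕ.+ z) ℕ.* ((5 ℕ.+ 6 ℕ.* (t ℕ.+ i)) ℕ.* 2) ℕ.+ (1 ℕ.+ 6 ℕ.* t) ≡⟨ collect t i z ⟩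
      M ℕ.* (10 ℕ.+ 12 ℕ.* (t ℕ.+ i)) ≡⟨ cong (λ j → M ℕ.* (10 ℕ.+ 12 ℕ.* j)) t+i ⟩
      M ℕ.* (10 ℕ.+ 12 ℕ.* suc q) ≡⟨ spread M q ⟩
      10 ℕ.* M ℕ.+ 6 ℕ.* (2 ℕ.* M ℕ.+ q ℕ.* (2 ℕ.* M)) ≡⟨ cong (λ n → 10 ℕ.* M ℕ.+ 6 ℕ.* (n ℕ.+ q ℕ.* (2 ℕ.* M))) (sym r+t) ⟩
      10 ℕ.* M ℕ.+ 6 ℕ.* (r ℕ.+ t ℕ.+ q ℕ.* (2 ℕ.* M)) ≡⟨ regroup (10 ℕ.* M) r t (q ℕ.* (2 ℕ.* M)) ⟩
      10 ℕ.* M ℕ.+ 6 ℕ.* (r ℕ.+ q ℕ.* (2 ℕ.* M)) ℕ.+ 6 ℕ.* t ≡⟨ cong₂ (λ m n → 10 ℕ.* m ℕ.+ 6 ℕ.* n ℕ.+ 6 ℕ.* t) mod6 (sym e≡) ⟩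
      10 ℕ.* (2 ℕ.* b ℕ.+ 6 ℕ.* a) ℕ.+ 6 ℕ.* e ℕ.+ 6 ℕ.* t ≡⟨ residue b a e (6 ℕ.* t) ⟩
      2 ℕ.* b ℕ.+ 6 ℕ.* (3 ℕ.* b ℕ.+ 10 ℕ.* a ℕ.+ e) ℕ.+ 6 ℕ.* t ≡⟨ cong (λ s → 2 ℕ.* b ℕ.+ 6 ℕ.* s ℕ.+ 6 ℕ.* t) s≡ ⟩
      2 ℕ.* b ℕ.+ 6 ℕ.* s ℕ.+ 6 ℕ.* t ≡⟨ cong (ℕ._+ 6 ℕ.* t) (sym u≡) ⟩
      suc u ℕ.+ 6 ℕ.* t ≡⟨ sym (ℕₚ.+-suc u (6 ℕ.* t)) ⟩
      u ℕ.+ (1 ℕ.+ 6 ℕ.* t) ∎)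
      where
      open ≡-Reasoning
      collect : ∀ t i z → 9 ℕ.+ 6 ℕ.* t ℕ.+ 12 ℕ.* i ℕ.+ (15 ℕ.+ z) ℕ.* ((5 ℕ.+ 6 ℕ.* (t ℕ.+ i)) ℕ.* 2) ℕ.+ (1 ℕ.+ 6 ℕ.* t)
        ≡ (16 ℕ.+ z) ℕ.* (10 ℕ.+ 12 ℕ.* (t ℕ.+ i))
      collect = solve-∀
      spread : ∀ M q → M ℕ.* (10 ℕ.+ 12 ℕ.* suc q) ≡ 10 ℕ.* M ℕ.+ 6 ℕ.* (2 ℕ.* M ℕ.+ q ℕ.* (2 ℕ.* M))
      spread = solve-∀
      regroup : ∀ m r t n → m ℕ.+ 6 ℕ.* (r ℕ.+ t ℕ.+ n) ≡ m ℕ.+ 6 ℕ.* (r ℕ.+ n) ℕ.+ 6 ℕ.* t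
      regroup = solve-∀
      residue : ∀ b a e n → 10 ℕ.* (2 ℕ.* b ℕ.+ 6 ℕ.* a) ℕ.+ 6 ℕ.* e ℕ.+ n ≡ 2 ℕ.* b ℕ.+ 6 ℕ.* (3 ℕ.* b ℕ.+ 10 ℕ.* a ℕ.+ e) ℕ.+ n
      residue = solve-∀

    realized : Realizes V u
    realized = subst (Realizes V) order≡ construction

  realizes-large : ∀ u → threshold ℕ.* 6 ≤ u → suc (u % 6) ≡ 2 ℕ.* b → Realizes V u
  realizes-large u large res = realized u (u / 6)
    (trans (cong suc (m≡m%n+[m/n]*n u 6)) (trans (cong (ℕ._+ u / 6 ℕ.* 6) res) (cong (2 ℕ.* b ℕ.+_) (ℕₚ.*-comm (u / 6) 6))))
    (subst (_≤ u / 6) (m*n/n≡m threshold 6) (/-monoˡ-≤ 6 large))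

theorem1p3 : ∀ {v} (V : PSTS v) → ∃ λ (N : ℕ) →
    ∀ (u : ℕ) → N ≤ u → (u % 6 ≡ 1 ⊎ u % 6 ≡ 3) →
    Σ (STS u) λ U → Σ (Fin v → Fin u) λ f →
    IsSubsystem V (psts U) f
    × (∀ (σ : Aut (psts U)) (x : Fin v) → ∃ λ y → proj₁ σ ⟨$⟩ʳ f x ≡ f y)
    × (∀ (σ : Aut (psts U)) → Σ (Aut V) λ τ →
    ∀ x → proj₁ σ ⟨$⟩ʳ f x ≡ f (proj₁ τ ⟨$⟩ʳ x))
    × (∀ (τ : Aut V) → Σ (Aut (psts U)) λ σ →
    ∀ x → proj₁ σ ⟨$⟩ʳ f x ≡ f (proj₁ τ ⟨$⟩ʳ x))
    × AutIso (psts U) V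
-- The two residue classes use different systems W; the sum of the bounds dominates each of them.
theorem1p3 {v} V = One.threshold ℕ.* 6 ℕ.+ Three.threshold ℕ.* 6 , λ where
    u N≤u (inj₁ eq) → One.realizes-large u (ℕₚ.≤-trans (ℕₚ.m≤m+n _ _) N≤u) (cong suc eq)
    u N≤u (inj₂ eq) → Three.realizes-large u (ℕₚ.≤-trans (ℕₚ.m≤n+m _ (One.threshold ℕ.* 6)) N≤u) (cong suc eq)
  where
  module One = Admissible V (proj₁ (orders v))
  module Three = Admissible V (proj₂ (orders v))
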